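{- Let $\varepsilon\in(0,1)$, let $d_1\neq d_2$ be positive integers, and let $u_1,u_2$ be vertices of $G_1=\mathbb Z^{d_1}$ and $G_2=\mathbb Z^{d_2}$ respectively. Then $(G_1,u_1)$ and $(G_2,u_2)$ are distinguishable by $S^{(2)}$.
   Context: $\mathbb Z^{d}$ denotes the integer lattice graph (two points are adjacent iff their $\ell_1$-distance is $1$). Noisy voter model (NVM) with noise $\varepsilon\in(0,1)$ on a connected (locally finite, with at least two vertices) graph $G$: let $N_G(u)$ be the set of neighbors of $u$. At time $0$, $X_0(u)\sim\mathrm{Bern}(1/2)$ independently over all $u\in V(G)$. For every $t\ge 1$ and $u\in V(G)$, $$X_t(u)=\xi_t(u)Y_t(u)+(1-\xi_t(u))\sum_{v\in N_G(u)}I(\eta_t(u)=v)X_{t-1}(v),$$ where $\xi_t(u)\sim\mathrm{Bern}(\varepsilon)$, $Y_t(u)\sim\mathrm{Bern}(1/2)$, $\eta_t(u)$ is uniform on $N_G(u)$, and all the variables $\xi_t(u),Y_t(u),\eta_t(u)$ ($t\ge1$, $u\in V(G)$) and $X_0(u)$ ($u\in V(G)$) are independent. Write $X_t(G,u)=X_t(u)$. Distinguishability: let $(G_1,u_1),(G_2,u_2)$ be rooted graphs, both running the NVM with the same $\varepsilon$. They are distinguishable by a sequence $S=(S_t)_{t}$, where $S_t$ is a real-valued function of the observations up to time $t$ at a vertex, if there are sets $\mathcal S_1(t),\mathcal S_2(t)\subset\mathbb R$, disjoint for each $t$, such that $$\mathsf P\big[S_t(X_i(G_1,u_1),\,i\le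 t)\in\mathcal S_1(t),\ S_t(X_i(G_2,u_2),\,i\le t)\in\mathcal S_2(t)\big]\to1\quad (t\to\infty).$$ Repetition statistic: for $d\in\mathbb N$ and $t>d$, $S^{(d)}_t=\frac1{t-d}\sum_{i=1}^{t-d}I(X_i(u)=X_{i+d}(u))$, where $u$ is the observed vertex, and $S^{(d)}=(S^{(d)}_t)_t$. -}

module Defs where

open import Algebra.Apartness.Bundles using (HeytingField)
open import Algebra.Bundles using (CommutativeRing)
open import Algebra.Morphism.Structures using (module RingMorphisms)
open import Data.Bool.Base using (Bool; true; false)
open import Data.Fin.Base using (Fin; toℕ; fromℕ<)
open import Data.Fin.Properties using (toℕ<n)
open import Data.Integer.Base as ℤ using (ℤ; +_; -[1+_]; ∣_∣; 1ℤ; -1ℤ)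
import Data.Integer.Properties as ℤ
open import Data.List.Base as List using (List; []; _∷_; length; foldr)
open import Data.List.Membership.Propositional using (_∈_)
open import Data.List.Membership.Propositional.Properties using (∈-map⁺; ∈-map⁻)
open import Data.List.Relation.Unary.All as All using (All; []; _∷_)
import Data.List.Relation.Unary.All.Properties as All
open import Data.List.Relation.Unary.Any using (here; there)
open import Data.List.Relation.Unary.AllPairs using ([]; _∷_)
open import Data.List.Relation.Unary.Unique.Propositional using (Unique)
import Data.List.Relation.Unary.Unique.Propositional.Properties as Unique
open import Data.Nat.Base as ℕ using (ℕ; zero; suc; s≤s; _∸_)
open import Data.Nat.ListAction using (sum)
import Data.Nat.Properties as ℕ
open import Data.Product.Base using (Σ; ∃-syntax; _×_; _,_)
open import Data.Rational.Base as ℚ using (ℚ; 0ℚ; ½; _/_)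
open import Data.Sum.Base using (_⊎_; inj₁; inj₂)
open import Data.Vec.Base as Vec using (Vec; []; _∷_)
import Data.Vec.Functional as Functional
import Data.Vec.Properties as Vec
open import Function.Bundles using (_⇔_; mk⇔)
open import Level using (0ℓ)
open import Relation.Binary.Core using (Rel)
open import Relation.Binary.Definitions
  using (DecidableEquality; Symmetric; Irreflexive; Cotransitive; _Respects_)
open import Relation.Binary.PropositionalEquality
  using (_≡_; refl; sym; trans; cong; cong₂; subst)
open import Relation.Binary.Structures using (IsStrictPartialOrder)
open import Relation.Nullary.Decidable.Core using (⌊_⌋)
open import Relation.Nullary.Negation using (¬_)
open import Relation.Unary using (Pred; U; ∁; _∩_; _∪_; _≐_; _⊥_)

------------------------------------------------------------------------
-- Real numbers

-- The standard library has no real numbers.  They are axiomatised as a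
-- Cauchy complete Archimedean ordered field, which determines ℝ up to
-- isomorphism.  The axioms are the constructive ones, so they hold of the
-- Cauchy reals as well as of the classical ℝ.
record Reals : Set₁ where
  infix 4 _<_
  field
    heytingField : HeytingField 0ℓ 0ℓ 0ℓ

  open HeytingField heytingField public
    renaming (Carrier to ℝ)

  field
    _<_                    : Rel ℝ 0ℓ
    <-isStrictPartialOrder : IsStrictPartialOrder _≈_ _<_
    <-cotrans              : Cotransitive _<_
    #⇔<⊎>                  : ∀ {x y} → (x # y) ⇔ (x < y ⊎ y < x)
    +-monoˡ-<              : ∀ {x y} z → x < y → x + z < y + z
    *-pos                  : ∀ {x y} → 0# < x → 0# < y → 0# < x * y

  field
    fromℚ        : ℚ → ℝ
    fromℚ-homo   : RingMorphisms.IsRingHomomorphism ℚ.+-*-rawRing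
                     (CommutativeRing.rawRing
                       (record { isCommutativeRing = isCommutativeRing }))
                     fromℚ
    fromℚ-mono-< : ∀ {p q} → p ℚ.< q → fromℚ p < fromℚ q
    archimedean  : ∀ {x y} → x < y → ∃[ q ] (x < fromℚ q × fromℚ q < y)

  -- ∣ x - y ∣ < δ
  Within : ℝ → ℝ → ℝ → Set
  Within δ x y = (x - y < δ) × (y - x < δ)

  _⟶_ : (ℕ → ℝ) → ℝ → Set
  s ⟶ l = ∀ δ → 0# < δ → ∃[ N ] (∀ n → N ℕ.≤ n → Within δ (s n) l)

  Cauchy : (ℕ → ℝ) → Set
  Cauchy s = ∀ δ → 0# < δ →
    ∃[ N ] (∀ m n → N ℕ.≤ m → N ℕ.≤ n → Within δ (s m) (s n))

  field
    complete : ∀ s → Cauchy s → ∃[ l ] (s ⟶ l)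

  fromℕ : ℕ → ℝ
  fromℕ n = fromℚ (+ n / 1)

  product : List ℝ → ℝ
  product = foldr _*_ 1#

------------------------------------------------------------------------
-- Probability

-- Every Kolmogorov probability space is an instance.  Countable additivity
-- is not demanded: all events considered below depend on finitely many
-- discrete random variables.
record ProbabilitySpace (R : Reals) : Set₂ where
  open Reals R
  field
    Ω         : Set
    IsEvent   : Pred Ω 0ℓ → Set₁
    isEvent-≐ : ∀ {A B} → A ≐ B → IsEvent A → IsEvent B
    isEvent-U : IsEvent U
    isEvent-∁ : ∀ {A} → IsEvent A → IsEvent (∁ A)
    isEvent-∩ : ∀ {A B} → IsEvent A → IsEvent B → IsEvent (A ∩ B)
    isEvent-∪ : ∀ {A B} → IsEvent A → IsEvent B → IsEvent (A ∪ B)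

  Event : Set₁
  Event = Σ (Pred Ω 0ℓ) IsEvent

  field
    P        : Event → ℝ
    P-cong   : ∀ {A B} (a : IsEvent A) (b : IsEvent B) →
               A ≐ B → P (A , a) ≈ P (B , b)
    P-nonneg : ∀ A → ¬ (P A < 0#)
    P-U      : P (U , isEvent-U) ≈ 1#
    P-∪      : ∀ {A B} (a : IsEvent A) (b : IsEvent B) → A ⊥ B →
               P (A ∪ B , isEvent-∪ a b) ≈ P (A , a) + P (B , b)

  ⋂ : List Event → Event
  ⋂ = foldr (λ (A , a) (B , b) → A ∩ B , isEvent-∩ a b) (U , isEvent-U)

  -- Only used for countable discrete A, where measurability of the fibres
  -- is measurability.
  record RandomVariable (A : Set) : Set₁ where
    field
      value      : Ω → A
      measurable : ∀ a → IsEvent (λ ω → value ω ≡ a)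

    fibre : A → Event
    fibre a = (λ ω → value ω ≡ a) , measurable a

  open RandomVariable public

  Independent : {I : Set} {A : I → Set} →
                ((i : I) → RandomVariable (A i)) → Set
  Independent {I} {A} Z = (is : List I) → Unique is → (a : ∀ i → A i) →
    P (⋂ (List.map (λ i → fibre (Z i) (a i)) is))
      ≈ product (List.map (λ i → P (fibre (Z i) (a i))) is)

  Bernoulli : ℝ → RandomVariable Bool → Set
  Bernoulli p Z = P (fibre Z true) ≈ p

  -- Used with a list of distinct elements.
  UniformOn : {A : Set} → List A → RandomVariable A → Set
  UniformOn as Z = ∀ a → a ∈ as → fromℕ (length as) * P (fibre Z a) ≈ 1#

------------------------------------------------------------------------
-- Locally finite simple graphs

record Graph : Set₁ where
  field
    V                 : Set
    _≟_               : DecidableEquality V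
    _∼_               : Rel V 0ℓ
    ∼-sym             : Symmetric _∼_
    ∼-irrefl          : Irreflexive _≡_ _∼_
    neighbours        : V → List V
    neighbours-unique : ∀ u → Unique (neighbours u)
    ∈-neighbours      : ∀ u v → v ∈ neighbours u ⇔ u ∼ v

ℓ₁-distance : ∀ {d} → Vec ℤ d → Vec ℤ d → ℕ
ℓ₁-distance x y = Vec.sum (Vec.zipWith (λ a b → ∣ a ℤ.- b ∣) x y)

private
  ℓ₁-sym : ∀ {d} (x y : Vec ℤ d) → ℓ₁-distance x y ≡ ℓ₁-distance y x
  ℓ₁-sym []      []      = refl
  ℓ₁-sym (a ∷ x) (b ∷ y) = cong₂ ℕ._+_ (ℤ.∣i-j∣≡∣j-i∣ a b) (ℓ₁-sym x y)

  ∣a-a∣≡0 : ∀ a → ∣ a ℤ.- a ∣ ≡ 0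
  ∣a-a∣≡0 a = cong ∣_∣ (ℤ.+-inverseʳ a)

  ℓ₁-refl : ∀ {d} (x : Vec ℤ d) → ℓ₁-distance x x ≡ 0
  ℓ₁-refl []      = refl
  ℓ₁-refl (a ∷ x) = cong₂ ℕ._+_ (∣a-a∣≡0 a) (ℓ₁-refl x)

  ∣a-b∣≡0 : ∀ a b → ∣ a ℤ.- b ∣ ≡ 0 → a ≡ b
  ∣a-b∣≡0 a b eq = ℤ.i-j≡0⇒i≡j a b (ℤ.∣i∣≡0⇒i≡0 eq)

  ℓ₁≡0 : ∀ {d} (x y : Vec ℤ d) → ℓ₁-distance x y ≡ 0 → x ≡ y
  ℓ₁≡0 []      []      _  = refl
  ℓ₁≡0 (a ∷ x) (b ∷ y) eq = cong₂ _∷_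
    (∣a-b∣≡0 a b (ℕ.m+n≡0⇒m≡0 ∣ a ℤ.- b ∣ eq))
    (ℓ₁≡0 x y (ℕ.m+n≡0⇒n≡0 ∣ a ℤ.- b ∣ eq))

  a-[a+c] : ∀ a c → a ℤ.- (a ℤ.+ c) ≡ ℤ.- c
  a-[a+c] a c =
    trans (cong (ℤ._+_ a) (ℤ.neg-distrib-+ a c))
    (trans (sym (ℤ.+-assoc a (ℤ.- a) (ℤ.- c)))
    (trans (cong (ℤ._+ (ℤ.- c)) (ℤ.+-inverseʳ a))
           (ℤ.+-identityˡ (ℤ.- c))))

  a-b≡c⇒b : ∀ a b {c} → a ℤ.- b ≡ c → b ≡ a ℤ.+ (ℤ.- c)
  a-b≡c⇒b a b refl = sym
    (trans (cong (ℤ._+_ a) (ℤ.neg-distrib-+ a (ℤ.- b)))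
    (trans (sym (ℤ.+-assoc a (ℤ.- a) (ℤ.- (ℤ.- b))))
    (trans (cong (ℤ._+ (ℤ.- (ℤ.- b))) (ℤ.+-inverseʳ a))
    (trans (ℤ.+-identityˡ (ℤ.- (ℤ.- b))) (ℤ.neg-involutive b)))))

  ∣i∣≡1 : ∀ i → ∣ i ∣ ≡ 1 → i ≡ 1ℤ ⊎ i ≡ -1ℤ
  ∣i∣≡1 (+ 1)    refl = inj₁ refl
  ∣i∣≡1 -[1+ 0 ] refl = inj₂ refl

  a+c≢a+c′ : ∀ a {c c′} → ¬ (c ≡ c′) → ¬ (a ℤ.+ c ≡ a ℤ.+ c′)
  a+c≢a+c′ a c≢c′ eq = c≢c′ (ℤ.neg-injective
    (trans (sym (a-[a+c] a _)) (trans (cong (ℤ._-_ a) eq) (a-[a+c] a _))))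

  lattice-neighbours : ∀ {d} → Vec ℤ d → List (Vec ℤ d)
  lattice-neighbours []      = []
  lattice-neighbours (a ∷ x) =
    (a ℤ.+ 1ℤ ∷ x) ∷ (a ℤ.+ -1ℤ ∷ x) ∷ List.map (a ∷_) (lattice-neighbours x)

  head≢ : ∀ {d} a {c} {x : Vec ℤ d} → ¬ (c ≡ + 0) → ∀ ys →
          All (λ y → ¬ (a ℤ.+ c ∷ x ≡ y)) (List.map (a ∷_) ys)
  head≢ a {c} c≢0 ys = All.map⁺ (All.universal (λ y eq →
    a+c≢a+c′ a c≢0 (trans (Vec.∷-injectiveˡ eq) (sym (ℤ.+-identityʳ a)))) ys)

  lattice-unique : ∀ {d} (x : Vec ℤ d) → Unique (lattice-neighbours x)
  lattice-unique []      = []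
  lattice-unique (a ∷ x) =
    ((λ eq → a+c≢a+c′ a (λ ()) (Vec.∷-injectiveˡ eq))
      ∷ head≢ a (λ ()) (lattice-neighbours x))
    ∷ head≢ a (λ ()) (lattice-neighbours x)
    ∷ Unique.map⁺ Vec.∷-injectiveʳ (lattice-unique x)

  lattice-sound : ∀ {d} (x : Vec ℤ d) {y} →
                  y ∈ lattice-neighbours x → ℓ₁-distance x y ≡ 1
  lattice-sound (a ∷ x) (here refl) =
    cong₂ ℕ._+_ (cong ∣_∣ (a-[a+c] a 1ℤ)) (ℓ₁-refl x)
  lattice-sound (a ∷ x) (there (here refl)) =
    cong₂ ℕ._+_ (cong ∣_∣ (a-[a+c] a -1ℤ)) (ℓ₁-refl x)
  lattice-sound (a ∷ x) (there (there y∈)) with ∈-map⁻ (a ∷_) y∈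
  ... | z , z∈ , refl = cong₂ ℕ._+_ (∣a-a∣≡0 a) (lattice-sound x z∈)

  m+n≡1 : ∀ m {n} → m ℕ.+ n ≡ 1 → (m ≡ 1 × n ≡ 0) ⊎ (m ≡ 0 × n ≡ 1)
  m+n≡1 zero          eq   = inj₂ (refl , eq)
  m+n≡1 (suc zero)    eq   = inj₁ (refl , ℕ.suc-injective eq)

  lattice-complete : ∀ {d} (x y : Vec ℤ d) →
                     ℓ₁-distance x y ≡ 1 → y ∈ lattice-neighbours x
  lattice-complete []      []      ()
  lattice-complete (a ∷ x) (b ∷ y) eq with m+n≡1 ∣ a ℤ.- b ∣ eq
  ... | inj₂ (p , q) rewrite ∣a-b∣≡0 a b p =
    there (there (∈-map⁺ (b ∷_) (lattice-complete x y q)))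
  ... | inj₁ (p , q) rewrite ℓ₁≡0 x y q with ∣i∣≡1 (a ℤ.- b) p
  ...   | inj₁ r = there (here (cong (_∷ y) (a-b≡c⇒b a b r)))
  ...   | inj₂ r = here (cong (_∷ y) (a-b≡c⇒b a b r))

ℤ^_ : ℕ → Graph
ℤ^ d = record
  { V                 = Vec ℤ d
  ; _≟_               = Vec.≡-dec ℤ._≟_
  ; _∼_               = λ x y → ℓ₁-distance x y ≡ 1
  ; ∼-sym             = λ {x} {y} eq → trans (ℓ₁-sym y x) eq
  ; ∼-irrefl          = λ { {x} refl eq → ℕ.0≢1+n (trans (sym (ℓ₁-refl x)) eq) }
  ; neighbours        = lattice-neighbours
  ; neighbours-unique = lattice-unique
  ; ∈-neighbours      = λ x y → mk⇔ (lattice-sound x) (lattice-complete x y)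
  }

------------------------------------------------------------------------
-- The noisy voter model

𝟙 : Bool → ℕ
𝟙 false = 0
𝟙 true  = 1

-- The index t of ξ, Y and η is shifted by one: it stands for time t + 1.
data Source (V : Set) : Set where
  X₀    : V → Source V
  ξ Y η : ℕ → V → Source V

Value : {V : Set} → Source V → Set
Value     (X₀ _)  = Bool
Value     (ξ _ _) = Bool
Value     (Y _ _) = Bool
Value {V} (η _ _) = V

-- Connectedness and the existence of a second vertex play no role in the
-- definition; ℤ^ d has both properties for d ≥ 1.
record NoisyVoterModel {R : Reals} (𝒫 : ProbabilitySpace R) (G : Graph)
                       (ε : Reals.ℝ R) : Set₁ where
  open Reals R
  open ProbabilitySpace 𝒫
  open Graph G
  field
    source      : (s : Source V) → RandomVariable (Value s)
    independent : Independent source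
    X₀-law      : ∀ u → Bernoulli (fromℚ ½) (source (X₀ u))
    ξ-law       : ∀ t u → Bernoulli ε (source (ξ t u))
    Y-law       : ∀ t u → Bernoulli (fromℚ ½) (source (Y t u))
    η-law       : ∀ t u → UniformOn (neighbours u) (source (η t u))

  X : ℕ → V → Ω → ℕ
  X zero    u ω = 𝟙 (value (source (X₀ u)) ω)
  X (suc t) u ω =
    ξₜ ℕ.* 𝟙 (value (source (Y t u)) ω) ℕ.+
    (1 ∸ ξₜ) ℕ.* sum
      (List.map (λ v → 𝟙 ⌊ value (source (η t u)) ω ≟ v ⌋ ℕ.* X t v ω)
                (neighbours u))
    where ξₜ = 𝟙 (value (source (ξ t u)) ω)

------------------------------------------------------------------------
-- Distinguishability

Observations : ℕ → Set
Observations t = Functional.Vector ℕ (suc t)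

Statistic : Reals → Set
Statistic R = (t : ℕ) → Observations t → Reals.ℝ R

-- The two models live on one probability space but no assumption is made
-- on their joint law.  Measurability is automatic classically, because S t
-- only takes finitely many values on 0/1-valued observations.
record Distinguishable
  {R : Reals} {𝒫 : ProbabilitySpace R} {ε : Reals.ℝ R} {G₁ G₂ : Graph}
  (M₁ : NoisyVoterModel 𝒫 G₁ ε) (u₁ : Graph.V G₁)
  (M₂ : NoisyVoterModel 𝒫 G₂ ε) (u₂ : Graph.V G₂)
  (S : Statistic R) : Set₁ where
  open Reals R
  open ProbabilitySpace 𝒫
  module M₁ = NoisyVoterModel M₁
  module M₂ = NoisyVoterModel M₂
  field
    𝒮₁ 𝒮₂     : ℕ → Pred ℝ 0ℓ
    𝒮₁-resp-≈ : ∀ t → 𝒮₁ t Respects _≈_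
    𝒮₂-resp-≈ : ∀ t → 𝒮₂ t Respects _≈_
    disjoint  : ∀ t → 𝒮₁ t ⊥ 𝒮₂ t

  Separated : ℕ → Pred Ω 0ℓ
  Separated t ω = 𝒮₁ t (S t (λ i → M₁.X (toℕ i) u₁ ω)) ×
                  𝒮₂ t (S t (λ i → M₂.X (toℕ i) u₂ ω))

  field
    separated-isEvent : ∀ t → IsEvent (Separated t)
    P-separated⟶1     : (λ t → P (Separated t , separated-isEvent t)) ⟶ 1#

------------------------------------------------------------------------
-- The repetition statistic

-- The summation index j runs over 0 … t - d - 1 and stands for i = j + 1.
repetitions : ∀ d t → Observations t → ℕ
repetitions d t x = sum (List.tabulate {n = t ∸ d} λ j →
  𝟙 ⌊ x (fromℕ< (i<1+t j)) ℕ.≟ x (fromℕ< (i+d<1+t j)) ⌋)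
  where
  i+d<1+t : (j : Fin (t ∸ d)) → suc (toℕ j) ℕ.+ d ℕ.< suc t
  i+d<1+t j = s≤s (ℕ.m≤o∸n⇒m+n≤o (suc (toℕ j)) d≤t (toℕ<n j))
    where
    d≤t : d ℕ.≤ t
    d≤t = ℕ.<⇒≤ (ℕ.m∸n≢0⇒n<m λ eq →
      ℕ.n≮0 (subst (toℕ j ℕ.<_) eq (toℕ<n j)))

  i<1+t : (j : Fin (t ∸ d)) → suc (toℕ j) ℕ.< suc t
  i<1+t j = ℕ.≤-<-trans (ℕ.m≤m+n (suc (toℕ j)) d) (i+d<1+t j)

-- The second argument 0 only arises for t ≤ d, where the statistic is not
-- defined; the value there does not affect limits.
ratio : ℕ → ℕ → ℚ
ratio n zero    = 0ℚ
ratio n (suc m) = + n / suc m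

repetition : (R : Reals) → ℕ → Statistic R
repetition R d t x = Reals.fromℚ R (ratio (repetitions d t x) (t ∸ d))

{-# OPTIONS --safe #-}

-- Write w = (1 - ε)².  Tracing opinions backwards, the spins σ = 2X - 1 of two
-- vertices are correlated exactly when the two ancestral random walks meet before
-- either is killed by noise.  Hence E[σₜ(u) σₜ₊₂(u)] converges to the generating
-- function at w of the first return times of simple random walk, which by the
-- renewal equation is 1 - 1/G with G = Σₙ wⁿ p₂ₙ, where p₂ₙ is the probability of
-- return after 2n steps.  Now p₂ₙ is non-increasing in the dimension, strictly for
-- n = 1: the step operator of ℤᵈ⁺¹ is the average over the coordinates of the step
-- operators that leave this coordinate fixed, and x ↦ x²ⁿ is convex.
--
-- The repetition statistic concentrates because, given the past, the two walks
-- forget it at rate w, so that the covariances decay geometrically and its variance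
-- tends to 0.  No limit has to be taken: the means of the statistics of the two
-- graphs stay apart, and a threshold between them that depends on t suffices.
module Submission where

open import Data.Nat.Base using (ℕ; NonZero)
open import Relation.Binary.PropositionalEquality using (_≢_)
open import Defs
import Algebra.Apartness.Properties.HeytingCommutativeRing as HeytingProperties
open import Algebra.Bundles using (CommutativeRing)
open import Algebra.Morphism.Structures using (module RingMorphisms)
import Algebra.Properties.Semiring.Exp as Exp
import Algebra.Solver.Ring as RingSolver
open import Algebra.Solver.Ring.AlmostCommutativeRing
  using (fromCommutativeRing; _-Raw-AlmostCommutative⟶_)
open import Data.Bool.Base using (Bool; true; false)
import Data.Bool.Properties as Bool
open import Data.Fin.Base as Fin using (Fin)
import Data.Fin.Properties as Fin
open import Data.Integer.Base as ℤ using (ℤ; +_; -[1+_])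
import Data.Integer.Properties as ℤ
open import Data.Integer.Solver using (module +-*-Solver)
open import Data.List.Base as List using (List; []; _∷_; _++_)
import Data.List.Membership.DecPropositional as DecMembership
open import Data.List.Membership.Propositional using (_∈_)
import Data.List.Membership.Propositional.Properties as Membership
import Data.List.Properties as List
open import Data.List.Relation.Unary.All as All using (All; []; _∷_)
import Data.List.Relation.Unary.All.Properties as All
open import Data.List.Relation.Unary.AllPairs using ([]; _∷_)
open import Data.List.Relation.Unary.Any using (here; there)
import Data.List.Relation.Unary.Unique.DecPropositional.Properties as DecUnique
open import Data.List.Relation.Unary.Unique.Propositional using (Unique)
open import Data.Maybe.Base using (Maybe; just; nothing)
open import Data.Nat.Base as ℕ using (zero; suc; _∸_)
open import Data.Nat.GeneralisedArithmetic using (fold)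
open import Data.Nat.ListAction using (sum)
import Data.Nat.Properties as ℕ
open import Data.Product.Base using (Σ; ∃-syntax; _×_; _,_; proj₁; proj₂)
import Data.Product.Properties as Product
open import Data.Rational.Base as ℚ using (ℚ; 1ℚ; ½)
import Data.Rational.Properties as ℚ
open import Data.Rational.Unnormalised.Base using (mkℚᵘ; _≃_; *≡*; *≤*)
import Data.Rational.Unnormalised.Properties as ℚᵘ
open import Data.Sum.Base using (_⊎_; inj₁; inj₂; [_,_]′)
open import Data.Vec.Base as Vec using (Vec; []; _∷_)
import Data.Vec.Properties as Vec
open import Function.Base using (_∘_)
open import Function.Bundles using (Equivalence)
open import Level using (0ℓ)
open import Relation.Binary.Definitions using (DecidableEquality; tri<; tri≈; tri>)
open import Relation.Binary.PropositionalEquality as ≡ using (_≡_)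
import Relation.Binary.Reasoning.Setoid as SetoidReasoning
open import Relation.Binary.Structures using (IsStrictPartialOrder)
open import Relation.Nullary.Decidable.Core using (Dec; yes; no; ⌊_⌋; map′; ¬?; _×-dec_)
open import Relation.Nullary.Negation using (¬_; contradiction)
open import Relation.Unary using (Pred; U; ∁; _∩_; _∪_; _≐_)

-- Two restrictions shape the argument. The reals are constructive: weak inequalities are negations
-- and the sign of a real cannot be tested, so case distinctions are made only on integers, lattice
-- points and rationals. And a probability space offers only events with a finitely additive `P`,
-- neither integral nor conditional expectation. Random variables are therefore formal polynomials
-- in indicators of source values, the predicates `Past t` and `Fresh t x` replace σ-algebras, and
-- conditioning on the past becomes multiplication by a polynomial `F` in the past.
--
-- The correlations are handled at finite times. The function `C` solves their recursion exactly,
-- with the value 1 at displacement 0 restored in every step; unrolled, the recursion is a renewal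
-- equation for each t. Subtracting these equations for the two dimensions bounds the sum over time
-- of the differences of the correlations below by a multiple of n, up to a constant, whereas the
-- variance of the sum of n terms is at most a multiple of n.

private
  toℚᵘ-/ : ∀ i m → ℚ.toℚᵘ (i ℚ./ suc m) ≃ mkℚᵘ i m
  toℚᵘ-/ i m = ℚ.toℚᵘ-fromℚᵘ (mkℚᵘ i m)

/1-+ : ∀ i j → (i ℤ.+ j) ℚ./ 1 ≡ i ℚ./ 1 ℚ.+ j ℚ./ 1
/1-+ i j = ℚ.toℚᵘ-injective (ℚᵘ.≃-trans (toℚᵘ-/ (i ℤ.+ j) 0) (ℚᵘ.≃-trans
  (*≡* (solve 2 (λ i j → (i :+ j) :* con (+ 1) := (i :* con (+ 1) :+ j :* con (+ 1)) :* con (+ 1))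
    ≡.refl i j))
  (ℚᵘ.≃-sym (ℚᵘ.≃-trans (ℚ.toℚᵘ-homo-+ (i ℚ./ 1) (j ℚ./ 1))
    (ℚᵘ.+-cong (toℚᵘ-/ i 0) (toℚᵘ-/ j 0))))))
  where open +-*-Solver

/1-* : ∀ i j → (i ℤ.* j) ℚ./ 1 ≡ (i ℚ./ 1) ℚ.* (j ℚ./ 1)
/1-* i j = ℚ.toℚᵘ-injective (ℚᵘ.≃-trans (toℚᵘ-/ (i ℤ.* j) 0)
  (ℚᵘ.≃-sym (ℚᵘ.≃-trans (ℚ.toℚᵘ-homo-* (i ℚ./ 1) (j ℚ./ 1))
    (ℚᵘ.*-cong (toℚᵘ-/ i 0) (toℚᵘ-/ j 0)))))

/1-neg : ∀ i → (ℤ.- i) ℚ./ 1 ≡ ℚ.- (i ℚ./ 1)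
/1-neg i = ℚ.toℚᵘ-injective (ℚᵘ.≃-trans (toℚᵘ-/ (ℤ.- i) 0)
  (ℚᵘ.≃-sym (ℚᵘ.≃-trans (ℚ.toℚᵘ-homo‿- (i ℚ./ 1)) (ℚᵘ.-‿cong (toℚᵘ-/ i 0)))))

/1-*-ratio : ∀ r n .{{_ : NonZero n}} → + n ℚ./ 1 ℚ.* ratio r n ≡ + r ℚ./ 1
/1-*-ratio r (suc n) = ℚ.toℚᵘ-injective (ℚᵘ.≃-trans
  (ℚᵘ.≃-trans (ℚ.toℚᵘ-homo-* (+ suc n ℚ./ 1) (ratio r (suc n)))
    (ℚᵘ.*-cong (toℚᵘ-/ (+ suc n) 0) (toℚᵘ-/ (+ r) n)))
  (ℚᵘ.≃-trans
    (*≡* (solve 2 (λ n r → (n :* r) :* con (+ 1) := r :* (con (+ 1) :* n)) ≡.refl (+ suc n) (+ r)))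
    (ℚᵘ.≃-sym (toℚᵘ-/ (+ r) 0))))
  where open +-*-Solver

-- Arithmetic and constructive order of the reals

module RealProperties (R : Reals) where
  open Reals R hiding (zero)
  open IsStrictPartialOrder <-isStrictPartialOrder public
    using (<-resp-≈)
    renaming (irrefl to <-irrefl; trans to <-trans; asym to <-asym)

  commutativeRing : CommutativeRing 0ℓ 0ℓ
  commutativeRing = record { isCommutativeRing = isCommutativeRing }

  open HeytingProperties heytingCommutativeRing using (1#0; x-0≈x; #-congʳ)
  module fromℚ-homo = RingMorphisms.IsRingHomomorphism fromℚ-homo

  private
    -- The separate clause for 1 makes `con (+ 1)` denote `1#` and `con -[1+ 0 ]` denote `- 1#`
    -- definitionally, so that solver equations fit goals with these constants.
    multiple : ℕ → ℝ
    multiple 0             = 0#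
    multiple 1             = 1#
    multiple (suc (suc n)) = 1# + multiple (suc n)

    multiple-≈ : ∀ n → multiple n ≈ fromℕ n
    multiple-≈ 0             = sym fromℚ-homo.0#-homo
    multiple-≈ 1             = sym fromℚ-homo.1#-homo
    multiple-≈ (suc (suc n)) = trans (+-cong (multiple-≈ 1) (multiple-≈ (suc n)))
      (trans (sym (fromℚ-homo.+-homo (+ 1 ℚ./ 1) (+ suc n ℚ./ 1)))
        (reflexive (≡.cong fromℚ (≡.sym (/1-+ (+ 1) (+ suc n))))))

    coefficient : ℤ → ℝ
    coefficient (+ n)    = multiple n
    coefficient -[1+ n ] = - multiple (suc n)

    coefficient-≈ : ∀ i → coefficient i ≈ fromℚ (i ℚ./ 1)
    coefficient-≈ (+ n)    = multiple-≈ n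
    coefficient-≈ -[1+ n ] = trans (-‿cong (multiple-≈ (suc n)))
      (trans (sym (fromℚ-homo.-‿homo (+ suc n ℚ./ 1)))
        (reflexive (≡.cong fromℚ (≡.sym (/1-neg (+ suc n))))))

    coefficient-homo : CommutativeRing.rawRing ℤ.+-*-commutativeRing
                       -Raw-AlmostCommutative⟶ fromCommutativeRing commutativeRing
    coefficient-homo = record
      { ⟦_⟧    = coefficient
      ; +-homo = λ i j → trans (coefficient-≈ (i ℤ.+ j)) (trans (reflexive (≡.cong fromℚ (/1-+ i j)))
                   (trans (fromℚ-homo.+-homo (i ℚ./ 1) (j ℚ./ 1))
                     (sym (+-cong (coefficient-≈ i) (coefficient-≈ j)))))
      ; *-homo = λ i j → trans (coefficient-≈ (i ℤ.* j)) (trans (reflexive (≡.cong fromℚ (/1-* i j)))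
                   (trans (fromℚ-homo.*-homo (i ℚ./ 1) (j ℚ./ 1))
                     (sym (*-cong (coefficient-≈ i) (coefficient-≈ j)))))
      ; -‿homo = λ i → trans (coefficient-≈ (ℤ.- i)) (trans (reflexive (≡.cong fromℚ (/1-neg i)))
                   (trans (fromℚ-homo.-‿homo (i ℚ./ 1)) (sym (-‿cong (coefficient-≈ i)))))
      ; 0-homo = refl
      ; 1-homo = refl
      }

    coefficient-≟ : ∀ i j → Maybe (coefficient i ≈ coefficient j)
    coefficient-≟ i j with i ℤ.≟ j
    ... | yes ≡.refl = just refl
    ... | no _       = nothing

  open RingSolver (CommutativeRing.rawRing ℤ.+-*-commutativeRing)
    (fromCommutativeRing commutativeRing) coefficient-homo coefficient-≟ public
    using (solve; _:=_; _:+_; _:*_; _:-_; :-_; con)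

  0<1 : 0# < 1#
  0<1 = proj₁ <-resp-≈ fromℚ-homo.1#-homo
    (proj₂ <-resp-≈ fromℚ-homo.0#-homo (fromℚ-mono-< (ℚ.positive⁻¹ 1ℚ)))

  infix 4 _≤_

  -- A negative statement, as in `P-nonneg`. To prove it a strict inequality may be assumed, and
  -- that assumption supplies the apartness from which `0≤*` and `0≤square` draw the signs of the
  -- factors.
  _≤_ : ℝ → ℝ → Set
  x ≤ y = ¬ (y < x)

  ≤-refl : ∀ {x} → x ≤ x
  ≤-refl = <-irrefl refl

  ≤-reflexive : ∀ {x y} → x ≈ y → x ≤ y
  ≤-reflexive x≈y = <-irrefl (sym x≈y)

  <⇒≤ : ∀ {x y} → x < y → x ≤ y
  <⇒≤ = <-asym

  <-≤-trans : ∀ {x y z} → x < y → y ≤ z → x < z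
  <-≤-trans x<y y≤z with <-cotrans x<y _
  ... | inj₁ x<z = x<z
  ... | inj₂ z<y = contradiction z<y y≤z

  ≤-<-trans : ∀ {x y z} → x ≤ y → y < z → x < z
  ≤-<-trans x≤y y<z with <-cotrans y<z _
  ... | inj₁ y<x = contradiction y<x x≤y
  ... | inj₂ x<z = x<z

  ≤-trans : ∀ {x y z} → x ≤ y → y ≤ z → x ≤ z
  ≤-trans x≤y y≤z z<x = x≤y (≤-<-trans y≤z z<x)

  ≤-antisym : ∀ {x y} → x ≤ y → y ≤ x → x ≈ y
  ≤-antisym x≤y y≤x = proj₁ (tight _ _) λ x#y →
    [ y≤x , x≤y ]′ (Equivalence.to #⇔<⊎> x#y)

  module ≈-Reasoning = SetoidReasoning (CommutativeRing.setoid commutativeRing)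

  <-resp : ∀ {x x′ y y′} → x ≈ x′ → y ≈ y′ → x < y → x′ < y′
  <-resp x≈x′ y≈y′ x<y = proj₁ <-resp-≈ y≈y′ (proj₂ <-resp-≈ x≈x′ x<y)

  ≤-resp : ∀ {x x′ y y′} → x ≈ x′ → y ≈ y′ → x ≤ y → x′ ≤ y′
  ≤-resp x≈x′ y≈y′ x≤y y′<x′ = x≤y (<-resp (sym y≈y′) (sym x≈x′) y′<x′)

  <-by : ∀ {d x y} → 0# < d → y - x ≈ d → x < y
  <-by {d} {x} {y} 0<d eq = <-resp (+-identityˡ x)
    (trans (+-congʳ (sym eq)) (solve 2 (λ x y → y :- x :+ x := y) refl x y))
    (+-monoˡ-< x 0<d)

  0<-sub : ∀ {x y} → x < y → 0# < y - x
  0<-sub {x} x<y = <-resp (-‿inverseʳ x) refl (+-monoˡ-< (- x) x<y)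

  ≤-by : ∀ {d x y} → 0# ≤ d → y - x ≈ d → x ≤ y
  ≤-by {d} {x} {y} 0≤d eq y<x = 0≤d (<-resp eq (-‿inverseʳ x) (+-monoˡ-< (- x) y<x))

  0≤-sub : ∀ {x y} → x ≤ y → 0# ≤ y - x
  0≤-sub {x} {y} x≤y y-x<0 = x≤y (<-resp
    (solve 2 (λ x y → y :- x :+ x := y) refl x y) (+-identityˡ x) (+-monoˡ-< x y-x<0))

  +-mono-≤ : ∀ {x x′ y y′} → x ≤ x′ → y ≤ y′ → x + y ≤ x′ + y′
  +-mono-≤ {x} {x′} {y} {y′} x≤x′ y≤y′ = ≤-trans step (≤-by (0≤-sub y≤y′)
    (solve 3 (λ x′ y y′ → (x′ :+ y′) :- (x′ :+ y) := y′ :- y) refl x′ y y′))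
    where
    step : x + y ≤ x′ + y
    step = ≤-by (0≤-sub x≤x′)
      (solve 3 (λ x x′ y → (x′ :+ y) :- (x :+ y) := x′ :- x) refl x x′ y)

  +-monoˡ-≤ : ∀ {x x′} y → x ≤ x′ → x + y ≤ x′ + y
  +-monoˡ-≤ y x≤x′ = +-mono-≤ x≤x′ ≤-refl

  +-monoʳ-≤ : ∀ x {y y′} → y ≤ y′ → x + y ≤ x + y′
  +-monoʳ-≤ x y≤y′ = +-mono-≤ ≤-refl y≤y′

  0≤+ : ∀ {x y} → 0# ≤ x → 0# ≤ y → 0# ≤ x + y
  0≤+ 0≤x 0≤y = ≤-resp (+-identityˡ 0#) refl (+-mono-≤ 0≤x 0≤y)

  0<+ : ∀ {x y} → 0# < x → 0# < y → 0# < x + y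
  0<+ {x} {y} 0<x 0<y = <-trans 0<y (<-resp (+-identityˡ y) refl (+-monoˡ-< y 0<x))

  neg-mono-≤ : ∀ {x y} → x ≤ y → - y ≤ - x
  neg-mono-≤ {x} {y} x≤y = ≤-by (0≤-sub x≤y)
    (solve 2 (λ x y → (:- x) :- (:- y) := y :- x) refl x y)

  private
    -- An inverse of the product, multiplied by `y`, is an inverse of `x`.
    product#0⇒#0 : ∀ {x y} → x * y # 0# → x # 0#
    product#0⇒#0 {x} {y} xy#0 with #⇒invertible xy#0
    ... | i , i[xy-0]≈1 , _ = invertible⇒# (y * i ,
      trans (*-congˡ (x-0≈x x))
        (trans (solve 3 (λ x y i → y :* i :* x := i :* (x :* y)) refl x y i)
          (trans (*-congˡ (sym (x-0≈x (x * y)))) i[xy-0]≈1)) ,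
      trans (*-congʳ (x-0≈x x))
        (trans (solve 3 (λ x y i → x :* (y :* i) := i :* (x :* y)) refl x y i)
          (trans (*-congˡ (sym (x-0≈x (x * y)))) i[xy-0]≈1)))

  nonneg∧#⇒pos : ∀ {x} → 0# ≤ x → x # 0# → 0# < x
  nonneg∧#⇒pos 0≤x x#0 with Equivalence.to #⇔<⊎> x#0
  ... | inj₁ x<0 = contradiction x<0 0≤x
  ... | inj₂ 0<x = 0<x

  0≤* : ∀ {x y} → 0# ≤ x → 0# ≤ y → 0# ≤ x * y
  0≤* {x} {y} 0≤x 0≤y xy<0 = <-asym xy<0 (*-pos (nonneg∧#⇒pos 0≤x (product#0⇒#0 xy#0))
      (nonneg∧#⇒pos 0≤y (product#0⇒#0 (#-congʳ (*-comm x y) xy#0))))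
    where
    xy#0 : x * y # 0#
    xy#0 = Equivalence.from #⇔<⊎> (inj₁ xy<0)

  *-neg⇒neg : ∀ {x y} → 0# ≤ y → x * y < 0# → x < 0#
  *-neg⇒neg {x} {y} 0≤y xy<0
    with Equivalence.to #⇔<⊎> (product#0⇒#0 (Equivalence.from #⇔<⊎> (inj₁ xy<0)))
  ... | inj₁ x<0 = x<0
  ... | inj₂ 0<x = contradiction xy<0 (0≤* (<⇒≤ 0<x) 0≤y)

  0≤square : ∀ x → 0# ≤ x * x
  0≤square x xx<0 with Equivalence.to #⇔<⊎> (product#0⇒#0 (Equivalence.from #⇔<⊎> (inj₁ xx<0)))
  ... | inj₂ 0<x = <-asym xx<0 (*-pos 0<x 0<x)
  ... | inj₁ x<0 = <-asym xx<0 (<-resp refl (solve 1 (λ x → (:- x) :* (:- x) := x :* x) refl x)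
                     (*-pos 0<-x 0<-x))
    where
    0<-x : 0# < - x
    0<-x = <-by (0<-sub x<0) (solve 1 (λ x → (:- x) :- con (+ 0) := con (+ 0) :- x) refl x)

  *-monoˡ-≤ : ∀ {x y y′} → 0# ≤ x → y ≤ y′ → x * y ≤ x * y′
  *-monoˡ-≤ {x} {y} {y′} 0≤x y≤y′ = ≤-by (0≤* 0≤x (0≤-sub y≤y′))
    (solve 3 (λ x y y′ → x :* y′ :- x :* y := x :* (y′ :- y)) refl x y y′)

  *-monoʳ-≤ : ∀ {x x′ y} → 0# ≤ y → x ≤ x′ → x * y ≤ x′ * y
  *-monoʳ-≤ {x} {x′} {y} 0≤y x≤x′ = ≤-resp (*-comm y x) (*-comm y x′) (*-monoˡ-≤ 0≤y x≤x′)

  *-monoˡ-< : ∀ {x y y′} → 0# < x → y < y′ → x * y < x * y′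
  *-monoˡ-< {x} {y} {y′} 0<x y<y′ = <-by (*-pos 0<x (0<-sub y<y′))
    (solve 3 (λ x y y′ → x :* y′ :- x :* y := x :* (y′ :- y)) refl x y y′)

  *-cancelˡ-≤ : ∀ {x y y′} → 0# < x → x * y ≤ x * y′ → y ≤ y′
  *-cancelˡ-≤ 0<x xy≤xy′ y′<y = xy≤xy′ (*-monoˡ-< 0<x y′<y)

  *-cancelˡ-≈ : ∀ {x y y′} → 0# < x → x * y ≈ x * y′ → y ≈ y′
  *-cancelˡ-≈ 0<x eq = ≤-antisym (*-cancelˡ-≤ 0<x (≤-reflexive eq))
    (*-cancelˡ-≤ 0<x (≤-reflexive (sym eq)))

  double-injective : ∀ {x y} → x + x ≈ y + y → x ≈ y
  double-injective {x} {y} eq = *-cancelˡ-≈ (0<+ 0<1 0<1) (trans (double x) (trans eq (sym (double y))))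
    where
    double : ∀ x → (1# + 1#) * x ≈ x + x
    double = solve 1 (λ x → (con (+ 1) :+ con (+ 1)) :* x := x :+ x) refl

  inverse : ∀ {x} → 0# < x → ∃[ i ] (0# < i × i * x ≈ 1#)
  inverse {x} 0<x with #⇒invertible (Equivalence.from #⇔<⊎> (inj₂ 0<x))
  ... | i , i[x-0]≈1 , _ = i , nonneg∧#⇒pos 0≤i i#0 , ix≈1
    where
    ix≈1 : i * x ≈ 1#
    ix≈1 = trans (*-congˡ (sym (x-0≈x x))) i[x-0]≈1
    0≤i : 0# ≤ i
    0≤i = *-cancelˡ-≤ 0<x (≤-resp (sym (zeroʳ x)) (trans (sym ix≈1) (*-comm i x)) (<⇒≤ 0<1))
    i#0 : i # 0#
    i#0 = product#0⇒#0 (#-congʳ (sym ix≈1) 1#0)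

  private
    reciprocal-pos : ∀ {n w} → 0# < n → n * w ≈ 1# → 0# < w
    reciprocal-pos {n} 0<n nw≈1 =
      let i , 0<i , in≈1 = inverse 0<n in
      <-resp refl (*-cancelˡ-≈ 0<n (trans (trans (*-comm n i) in≈1) (sym nw≈1))) 0<i

  reciprocal-antitone : ∀ {n n′ w w′} → 0# < n → n * w ≈ 1# → n′ * w′ ≈ 1# → n < n′ → w′ < w
  reciprocal-antitone {n} {n′} {w} {w′} 0<n nw≈1 n′w′≈1 n<n′ = <-by
    (*-pos (*-pos (reciprocal-pos 0<n nw≈1) (reciprocal-pos (<-trans 0<n n<n′) n′w′≈1)) (0<-sub n<n′))
    (trans (+-cong (sym (trans (*-congʳ n′w′≈1) (*-identityˡ w)))
                   (-‿cong (sym (trans (*-congʳ nw≈1) (*-identityˡ w′)))))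
      (cross n n′ w w′))
    where
    cross : ∀ n n′ w w′ → (n′ * w′) * w - (n * w) * w′ ≈ w * w′ * (n′ - n)
    cross = solve 4 (λ n n′ w w′ → (n′ :* w′) :* w :- (n :* w) :* w′ := w :* w′ :* (n′ :- n)) refl

  0≤1 : 0# ≤ 1#
  0≤1 = <⇒≤ 0<1

  fromℚ-mono-≤ : ∀ {p q} → p ℚ.≤ q → fromℚ p ≤ fromℚ q
  fromℚ-mono-≤ {p} {q} p≤q with p ℚ.<? q
  ... | yes p<q = <⇒≤ (fromℚ-mono-< p<q)
  ... | no  p≮q = ≤-reflexive (reflexive (≡.cong fromℚ (ℚ.≤-antisym p≤q (ℚ.≮⇒≥ p≮q))))

  fromℚ-cancel-< : ∀ {p q} → fromℚ p < fromℚ q → p ℚ.< q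
  fromℚ-cancel-< {p} {q} fp<fq with p ℚ.<? q
  ... | yes p<q = p<q
  ... | no  p≮q = contradiction fp<fq (fromℚ-mono-≤ (ℚ.≮⇒≥ p≮q))

  infix 4 _∈±_

  _∈±_ : ℝ → ℝ → Set
  x ∈± b = (x ≤ b) × (- b ≤ x)

  ∈±-resp : ∀ {x y b} → x ≈ y → x ∈± b → y ∈± b
  ∈±-resp x≈y (x≤b , -b≤x) = ≤-resp x≈y refl x≤b , ≤-resp refl x≈y -b≤x

  ∈±-weaken : ∀ {x b c} → b ≤ c → x ∈± b → x ∈± c
  ∈±-weaken b≤c (x≤b , -b≤x) = ≤-trans x≤b b≤c , ≤-trans (neg-mono-≤ b≤c) -b≤x

  0∈± : ∀ {x b} → 0# ≤ b → x ≈ 0# → x ∈± b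
  0∈± {x} {b} 0≤b x≈0 = ≤-resp (sym x≈0) refl 0≤b , ≤-resp refl (sym x≈0)
    (≤-by 0≤b (solve 1 (λ b → con (+ 0) :- :- b := b) refl b))

  ∈±0⇒≈0 : ∀ {x} → x ∈± 0# → x ≈ 0#
  ∈±0⇒≈0 (x≤0 , -0≤x) = ≤-antisym x≤0 (≤-resp (solve 0 (:- con (+ 0) := con (+ 0)) refl) refl -0≤x)

  ∈±-*ˡ : ∀ {x b c} → 0# ≤ c → x ∈± b → c * x ∈± c * b
  ∈±-*ˡ {x} {b} {c} 0≤c (x≤b , -b≤x) = *-monoˡ-≤ 0≤c x≤b ,
    ≤-resp (solve 2 (λ c b → c :* (:- b) := :- (c :* b)) refl c b) refl (*-monoˡ-≤ 0≤c -b≤x)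

  ∈±-- : ∀ {x y b c} → x ∈± b → y ∈± c → x - y ∈± b + c
  ∈±-- {x} {y} {b} {c} (x≤b , -b≤x) (y≤c , -c≤y) =
    ≤-resp refl (solve 2 (λ b c → b :- :- c := b :+ c) refl b c) (+-mono-≤ x≤b (neg-mono-≤ -c≤y)) ,
    ≤-resp (solve 2 (λ b c → (:- b) :- c := :- (b :+ c)) refl b c) refl (+-mono-≤ -b≤x (neg-mono-≤ y≤c))

  square≈1⇒∈±1 : ∀ {x} → x * x ≈ 1# → x ∈± 1#
  square≈1⇒∈±1 {x} xx≈1 = (λ 1<x → 1≮square 1<x xx≈1) , λ x<-1 → 1≮square
    (<-by (0<-sub x<-1) (solve 1 (λ x → :- x :- con (+ 1) := :- con (+ 1) :- x) refl x))
    (trans (solve 1 (λ x → (:- x) :* (:- x) := x :* x) refl x) xx≈1)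
    where
    1≮square : ∀ {y} → 1# < y → ¬ (y * y ≈ 1#)
    1≮square {y} 1<y yy≈1 = <-irrefl (sym yy≈1) (<-trans 1<y
      (<-resp (*-identityʳ y) refl (*-monoˡ-< (<-trans 0<1 1<y) 1<y)))

  *-cancelˡ-< : ∀ {x y y′} → 0# < x → x * y < x * y′ → y < y′
  *-cancelˡ-< {x} {y} {y′} 0<x xy<xy′ =
    let i , 0<i , ix≈1 = inverse 0<x
        cancel = λ v → trans (sym (*-assoc i x v)) (trans (*-congʳ ix≈1) (*-identityˡ v))
    in <-resp (cancel y) (cancel y′) (*-monoˡ-< 0<i xy<xy′)

  square-mono-≤ : ∀ {x y} → 0# ≤ x → x ≤ y → x * x ≤ y * y
  square-mono-≤ 0≤x x≤y = ≤-trans (*-monoˡ-≤ 0≤x x≤y) (*-monoʳ-≤ (≤-trans 0≤x x≤y) x≤y)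

-- Finite sums and indicators

module Sums (R : Reals) where
  open Reals R hiding (zero)
  open RealProperties R

  ∑ : {A : Set} → List A → (A → ℝ) → ℝ
  ∑ []       f = 0#
  ∑ (x ∷ xs) f = f x + ∑ xs f

  infixr 5 ∑
  syntax ∑ xs (λ x → e) = ∑[ x ∈ xs ] e

  private variable
    A B C : Set

  ∑-cong-∈ : (xs : List A) {f g : A → ℝ} → (∀ x → x ∈ xs → f x ≈ g x) → ∑ xs f ≈ ∑ xs g
  ∑-cong-∈ []       eq = refl
  ∑-cong-∈ (x ∷ xs) eq = +-cong (eq x (here ≡.refl)) (∑-cong-∈ xs (λ y → eq y ∘ there))

  ∑-cong : (xs : List A) {f g : A → ℝ} → (∀ x → f x ≈ g x) → ∑ xs f ≈ ∑ xs g
  ∑-cong xs eq = ∑-cong-∈ xs (λ x _ → eq x)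

  ∑-+ : (xs : List A) (f g : A → ℝ) → ∑[ x ∈ xs ] (f x + g x) ≈ ∑ xs f + ∑ xs g
  ∑-+ []       f g = sym (+-identityˡ 0#)
  ∑-+ (x ∷ xs) f g = trans (+-congˡ (∑-+ xs f g))
    (solve 4 (λ a b c d → (a :+ b) :+ (c :+ d) := (a :+ c) :+ (b :+ d)) refl _ _ _ _)

  ∑-*ˡ : (xs : List A) (c : ℝ) (f : A → ℝ) → ∑[ x ∈ xs ] (c * f x) ≈ c * ∑ xs f
  ∑-*ˡ []       c f = sym (zeroʳ c)
  ∑-*ˡ (x ∷ xs) c f = trans (+-congˡ (∑-*ˡ xs c f)) (sym (distribˡ c (f x) (∑ xs f)))

  ∑-*ʳ : (xs : List A) (c : ℝ) (f : A → ℝ) → ∑[ x ∈ xs ] (f x * c) ≈ ∑ xs f * c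
  ∑-*ʳ xs c f = trans (∑-cong xs (λ x → *-comm (f x) c)) (trans (∑-*ˡ xs c f) (*-comm c _))

  ∑-0 : (xs : List A) → ∑[ x ∈ xs ] 0# ≈ 0#
  ∑-0 []       = refl
  ∑-0 (x ∷ xs) = trans (+-identityˡ _) (∑-0 xs)

  ∑-++ : (xs ys : List A) (f : A → ℝ) → ∑ (xs ++ ys) f ≈ ∑ xs f + ∑ ys f
  ∑-++ []       ys f = sym (+-identityˡ _)
  ∑-++ (x ∷ xs) ys f = trans (+-congˡ (∑-++ xs ys f)) (sym (+-assoc _ _ _))

  ∑-map : (xs : List A) (h : A → B) (f : B → ℝ) → ∑ (List.map h xs) f ≈ ∑ xs (f ∘ h)
  ∑-map []       h f = refl
  ∑-map (x ∷ xs) h f = +-congˡ (∑-map xs h f)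

  ∑-swap : (xs : List A) (ys : List B) (f : A → B → ℝ) →
           ∑[ x ∈ xs ] ∑[ y ∈ ys ] f x y ≈ ∑[ y ∈ ys ] ∑[ x ∈ xs ] f x y
  ∑-swap []       ys f = sym (∑-0 ys)
  ∑-swap (x ∷ xs) ys f = trans (+-congˡ (∑-swap xs ys f)) (sym (∑-+ ys (f x) _))

  ∑-cartesian : (h : A → B → C) (xs : List A) (ys : List B) (f : C → ℝ) →
    ∑ (List.cartesianProductWith h xs ys) f ≈ ∑[ x ∈ xs ] ∑[ y ∈ ys ] f (h x y)
  ∑-cartesian h []       ys f = refl
  ∑-cartesian h (x ∷ xs) ys f = trans (∑-++ (List.map (h x) ys) _ f)
    (+-cong (∑-map ys (h x) f) (∑-cartesian h xs ys f))

  ∑-concatMap : (h : A → List B) (xs : List A) (f : B → ℝ) →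
    ∑ (List.concatMap h xs) f ≈ ∑[ x ∈ xs ] ∑ (h x) f
  ∑-concatMap h []       f = refl
  ∑-concatMap h (x ∷ xs) f = trans (∑-++ (h x) _ f) (+-congˡ (∑-concatMap h xs f))

  ∑-mono : (xs : List A) {f g : A → ℝ} → (∀ x → f x ≤ g x) → ∑ xs f ≤ ∑ xs g
  ∑-mono []       f≤g = ≤-refl
  ∑-mono (x ∷ xs) f≤g = +-mono-≤ (f≤g x) (∑-mono xs f≤g)

  ∑-nonneg : (xs : List A) {f : A → ℝ} → (∀ x → 0# ≤ f x) → 0# ≤ ∑ xs f
  ∑-nonneg []       0≤f = ≤-refl
  ∑-nonneg (x ∷ xs) 0≤f = 0≤+ (0≤f x) (∑-nonneg xs 0≤f)

  𝟏 : {P : Set} → Dec P → ℝ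
  𝟏 (yes _) = 1#
  𝟏 (no _)  = 0#

  𝟏-cong : {P Q : Set} (p : Dec P) (q : Dec Q) → (P → Q) → (Q → P) → 𝟏 p ≈ 𝟏 q
  𝟏-cong (yes _)  (yes _)  _ _ = refl
  𝟏-cong (no _)   (no _)   _ _ = refl
  𝟏-cong (yes p)  (no ¬q)  f _ = contradiction (f p) ¬q
  𝟏-cong (no ¬p)  (yes q)  _ g = contradiction (g q) ¬p

  𝟏-true : {P : Set} (p : Dec P) → P → 𝟏 p ≈ 1#
  𝟏-true (yes _) _ = refl
  𝟏-true (no ¬p) p = contradiction p ¬p

  𝟏-false : {P : Set} (p : Dec P) → ¬ P → 𝟏 p ≈ 0#
  𝟏-false (no _)  _  = refl
  𝟏-false (yes p) ¬p = contradiction p ¬p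

  module _ (_≟_ : DecidableEquality A) where

    ∑-indicator-∉ : ∀ {x} xs (g : A → ℝ) → All (λ y → ¬ (x ≡ y)) xs →
                    ∑[ y ∈ xs ] (𝟏 (x ≟ y) * g y) ≈ 0#
    ∑-indicator-∉ []       g []          = refl
    ∑-indicator-∉ (y ∷ xs) g (x≢y ∷ x∉) = trans
      (+-cong (trans (*-congʳ (𝟏-false (_ ≟ y) x≢y)) (zeroˡ (g y))) (∑-indicator-∉ xs g x∉))
      (+-identityˡ 0#)

    ∑-indicator-∈ : ∀ {x} xs (g : A → ℝ) → Unique xs → x ∈ xs →
                    ∑[ y ∈ xs ] (𝟏 (x ≟ y) * g y) ≈ g x
    ∑-indicator-∈ (x ∷ xs) g (x∉ ∷ u) (here ≡.refl) = trans
      (+-cong (trans (*-congʳ (𝟏-true (x ≟ x) ≡.refl)) (*-identityˡ (g x))) (∑-indicator-∉ xs g x∉))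
      (+-identityʳ _)
    ∑-indicator-∈ {x} (y ∷ xs) g (y∉ ∷ u) (there x∈) = trans
      (+-cong (trans (*-congʳ (𝟏-false (x ≟ y) λ { ≡.refl → All.lookup y∉ x∈ ≡.refl }))
                (zeroˡ (g y)))
              (∑-indicator-∈ xs g u x∈))
      (+-identityˡ _)

  ∑< : ℕ → (ℕ → ℝ) → ℝ
  ∑< zero    f = 0#
  ∑< (suc n) f = ∑< n f + f n

  ∑<-cong : ∀ n {f g : ℕ → ℝ} → (∀ i → f i ≈ g i) → ∑< n f ≈ ∑< n g
  ∑<-cong zero    eq = refl
  ∑<-cong (suc n) eq = +-cong (∑<-cong n eq) (eq n)

  ∑<-- : ∀ n (f g : ℕ → ℝ) → ∑< n (λ i → f i - g i) ≈ ∑< n f - ∑< n g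
  ∑<-- zero    f g = sym (-‿inverseʳ 0#)
  ∑<-- (suc n) f g = trans (+-congʳ (∑<-- n f g))
    (solve 4 (λ a b c d → (a :- b) :+ (c :- d) := (a :+ c) :- (b :+ d)) refl _ _ _ _)

  ∑<-shift : ∀ n (f : ℕ → ℝ) → ∑< (suc n) f ≈ f 0 + ∑< n (f ∘ suc)
  ∑<-shift zero    f = +-comm 0# (f 0)
  ∑<-shift (suc n) f = trans (+-congʳ (∑<-shift n f)) (+-assoc _ _ _)

-- Addition and subtraction of lattice points

infix  4 _≟ᵥ_
infixl 6 _⊞_ _⊟_

_⊞_ _⊟_ : ∀ {d} → Vec ℤ d → Vec ℤ d → Vec ℤ d
_⊞_ = Vec.zipWith ℤ._+_
_⊟_ = Vec.zipWith ℤ._-_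

𝟎 : ∀ {d} → Vec ℤ d
𝟎 = Vec.replicate _ (+ 0)

_≟ᵥ_ : ∀ {d} → DecidableEquality (Vec ℤ d)
_≟ᵥ_ = Vec.≡-dec ℤ._≟_

module _ where
  open +-*-Solver

  ⊞-assoc : ∀ {d} (x s t : Vec ℤ d) → x ⊞ s ⊞ t ≡ x ⊞ (s ⊞ t)
  ⊞-assoc = Vec.zipWith-assoc ℤ.+-assoc

  ⊞-comm : ∀ {d} (x y : Vec ℤ d) → x ⊞ y ≡ y ⊞ x
  ⊞-comm = Vec.zipWith-comm ℤ.+-comm

  ⊟-⊟ : ∀ {d} (x s t : Vec ℤ d) → x ⊟ s ⊟ t ≡ x ⊟ (s ⊞ t)
  ⊟-⊟ []      []      []      = ≡.refl
  ⊟-⊟ (a ∷ x) (b ∷ s) (c ∷ t) = ≡.cong₂ _∷_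
    (solve 3 (λ a b c → a :- b :- c := a :- (b :+ c)) ≡.refl a b c) (⊟-⊟ x s t)

  ⊞-⊟ : ∀ {d} (x s y : Vec ℤ d) → x ⊞ s ⊟ y ≡ x ⊟ y ⊞ s
  ⊞-⊟ []      []      []      = ≡.refl
  ⊞-⊟ (a ∷ x) (b ∷ s) (c ∷ y) = ≡.cong₂ _∷_
    (solve 3 (λ a b c → a :+ b :- c := a :- c :+ b) ≡.refl a b c) (⊞-⊟ x s y)

  ⊟-⊞-⊟ : ∀ {d} (x y s t : Vec ℤ d) → x ⊟ y ⊞ s ⊟ t ≡ (x ⊞ s) ⊟ (y ⊞ t)
  ⊟-⊞-⊟ []      []      []      []      = ≡.refl
  ⊟-⊞-⊟ (a ∷ x) (b ∷ y) (c ∷ s) (e ∷ t) = ≡.cong₂ _∷_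
    (solve 4 (λ a b c e → a :- b :+ c :- e := (a :+ c) :- (b :+ e)) ≡.refl a b c e)
    (⊟-⊞-⊟ x y s t)

⊟-self : ∀ {d} (x : Vec ℤ d) → x ⊟ x ≡ 𝟎
⊟-self []      = ≡.refl
⊟-self (a ∷ x) = ≡.cong₂ _∷_ (ℤ.+-inverseʳ a) (⊟-self x)

⊟≡𝟎⇒≡ : ∀ {d} (x y : Vec ℤ d) → x ⊟ y ≡ 𝟎 → x ≡ y
⊟≡𝟎⇒≡ []      []      _  = ≡.refl
⊟≡𝟎⇒≡ (a ∷ x) (b ∷ y) eq = ≡.cong₂ _∷_
  (ℤ.i-j≡0⇒i≡j a b (Vec.∷-injectiveˡ eq)) (⊟≡𝟎⇒≡ x y (Vec.∷-injectiveʳ eq))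

-- Positive definite functions and even convolution operators

module Convolution (R : Reals) where
  open Reals R hiding (zero)
  open RealProperties R
  open Sums R

  Function : ℕ → Set
  Function d = Vec ℤ d → ℝ

  Kernel : ℕ → Set
  Kernel d = List (ℝ × Vec ℤ d)

  private variable
    d : ℕ

  -- Positive semidefiniteness of the matrices `f (s ⊟ s′)`. The list `L` may repeat points, so that
  -- shifting a family by a kernel yields another admissible list without collecting terms.
  record PositiveDefinite (f : Function d) : Set where
    constructor positiveDefinite
    field
      0≤form : (L : Kernel d) → 0# ≤ ∑[ (c , s) ∈ L ] ∑[ (c′ , s′) ∈ L ] c * c′ * f (s ⊟ s′)

  δ : Function d
  δ x = 𝟏 (x ≟ᵥ 𝟎)

  -- The form only pairs coefficients of equal points, hence is the sum of the squares of the total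
  -- coefficients. Deduplication makes each point occur once in that sum.
  δ-positiveDefinite : PositiveDefinite (δ {d})
  δ-positiveDefinite {d} = positiveDefinite λ L → let open Form L in
    ≤-resp refl (sym square) (∑-nonneg D λ x → 0≤square (coeff x))
    where
    module Form (L : Kernel d) where
      support D : List (Vec ℤ d)
      support = List.map proj₂ L
      D = List.deduplicate _≟ᵥ_ support

      coeff : Vec ℤ d → ℝ
      coeff x = ∑[ (c , s) ∈ L ] c * 𝟏 (s ≟ᵥ x)

      δ-expand : ∀ {cs} s′ → cs ∈ L → δ (proj₂ cs ⊟ s′) ≈ ∑[ x ∈ D ] 𝟏 (proj₂ cs ≟ᵥ x) * 𝟏 (s′ ≟ᵥ x)
      δ-expand {c , s} s′ cs∈L = trans
        (𝟏-cong (s ⊟ s′ ≟ᵥ 𝟎) (s′ ≟ᵥ s) (≡.sym ∘ ⊟≡𝟎⇒≡ s s′) λ { ≡.refl → ⊟-self s })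
        (sym (∑-indicator-∈ _≟ᵥ_ D (λ x → 𝟏 (s′ ≟ᵥ x)) (DecUnique.deduplicate-! _≟ᵥ_ support)
          (Membership.∈-deduplicate⁺ _≟ᵥ_ (Membership.∈-map⁺ proj₂ cs∈L))))

      square : ∑[ (c , s) ∈ L ] ∑[ (c′ , s′) ∈ L ] c * c′ * δ (s ⊟ s′) ≈ ∑[ x ∈ D ] coeff x * coeff x
      square = begin
        ∑[ (c , s) ∈ L ] ∑[ (c′ , s′) ∈ L ] c * c′ * δ (s ⊟ s′)
          ≈⟨ (∑-cong-∈ L λ (c , s) cs∈L → ∑-cong L λ (c′ , s′) →
               trans (*-congˡ (δ-expand s′ cs∈L)) (trans (sym (∑-*ˡ D _ _)) (∑-cong D λ x →
                 solve 4 (λ c c′ a b → c :* c′ :* (a :* b) := c :* a :* (c′ :* b)) refl c c′ _ _))) ⟩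
        ∑[ (c , s) ∈ L ] ∑[ (c′ , s′) ∈ L ] ∑[ x ∈ D ] c * 𝟏 (s ≟ᵥ x) * (c′ * 𝟏 (s′ ≟ᵥ x))
          ≈⟨ (∑-cong L λ _ → ∑-swap L D _) ⟩
        ∑[ (c , s) ∈ L ] ∑[ x ∈ D ] ∑[ (c′ , s′) ∈ L ] c * 𝟏 (s ≟ᵥ x) * (c′ * 𝟏 (s′ ≟ᵥ x))
          ≈⟨ ∑-swap L D _ ⟩
        ∑[ x ∈ D ] ∑[ (c , s) ∈ L ] ∑[ (c′ , s′) ∈ L ] c * 𝟏 (s ≟ᵥ x) * (c′ * 𝟏 (s′ ≟ᵥ x))
          ≈⟨ (∑-cong D λ x → trans (∑-cong L λ _ → ∑-*ˡ L _ _) (∑-*ʳ L _ _)) ⟩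
        ∑[ x ∈ D ] coeff x * coeff x ∎
        where open ≈-Reasoning

  positiveDefinite⇒nonneg : {f : Function d} → PositiveDefinite f → 0# ≤ f 𝟎
  positiveDefinite⇒nonneg {f = f} pd = ≤-resp refl
    (trans (solve 1 (λ a → con (+ 1) :* con (+ 1) :* a :+ con (+ 0) :+ con (+ 0) := a) refl _)
      (reflexive (≡.cong f (⊟-self 𝟎))))
    (PositiveDefinite.0≤form pd ((1# , 𝟎) ∷ []))

  -- Having both representations says that the kernel is even, i.e. that T is
  -- self-adjoint.
  record EvenConvolution (T : Function d → Function d) : Set where
    field
      kernel : Kernel d
      apply⁺ : ∀ f x → T f x ≈ ∑[ (b , s) ∈ kernel ] b * f (x ⊞ s)
      apply⁻ : ∀ f x → T f x ≈ ∑[ (b , s) ∈ kernel ] b * f (x ⊟ s)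

    T-cong : ∀ {f g} → (∀ x → f x ≈ g x) → ∀ x → T f x ≈ T g x
    T-cong f≈g x = trans (apply⁺ _ x)
      (trans (∑-cong kernel λ (b , s) → *-congˡ (f≈g (x ⊞ s))) (sym (apply⁺ _ x)))

    T-- : ∀ f g x → T (λ v → f v - g v) x ≈ T f x - T g x
    T-- f g x = begin
      T (λ v → f v - g v) x
        ≈⟨ apply⁺ _ x ⟩
      ∑[ (b , s) ∈ kernel ] b * (f (x ⊞ s) - g (x ⊞ s))
        ≈⟨ (∑-cong kernel λ (b , s) →
             solve 3 (λ b f g → b :* (f :- g) := b :* f :+ con -[1+ 0 ] :* (b :* g)) refl b _ _) ⟩
      ∑[ (b , s) ∈ kernel ] (b * f (x ⊞ s) + _ * (b * g (x ⊞ s)))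
        ≈⟨ trans (∑-+ kernel _ _) (+-cong (sym (apply⁺ f x))
             (trans (∑-*ˡ kernel _ _) (*-congˡ (sym (apply⁺ g x))))) ⟩
      T f x + _ * T g x
        ≈⟨ solve 2 (λ a b → a :+ con -[1+ 0 ] :* b := a :- b) refl (T f x) (T g x) ⟩
      T f x - T g x ∎
      where open ≈-Reasoning

  module _ where
    open EvenConvolution

    -- One factor `T` moves over to the other argument: expanding the outer `T` by `apply⁺` and the
    -- inner one by `apply⁻` turns the form of `T (T f)` on `L` into the form of `f` on `L`
    -- convolved with the kernel.
    square-positiveDefinite : {T : Function d → Function d} → EvenConvolution T →
      ∀ {f} → PositiveDefinite f → PositiveDefinite (T (T f))
    square-positiveDefinite {d} {T} ec {f} pd = positiveDefinite λ L → let open Form L in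
      ≤-resp refl (sym expand) (PositiveDefinite.0≤form pd LB)
      where
      module Form (L : Kernel d) where
        B LB : Kernel _
        B  = kernel ec
        LB = List.cartesianProductWith (λ (c , s) (b , t) → c * b , s ⊞ t) L B

        TT : ∀ s s′ → T (T f) (s ⊟ s′) ≈
             ∑[ (b , t) ∈ B ] ∑[ (b′ , t′) ∈ B ] b * (b′ * f ((s ⊞ t) ⊟ (s′ ⊞ t′)))
        TT s s′ = trans (apply⁺ ec (T f) (s ⊟ s′)) (∑-cong B λ (b , t) →
          trans (*-congˡ (apply⁻ ec f (s ⊟ s′ ⊞ t))) (trans (sym (∑-*ˡ B b _))
            (∑-cong B λ (b′ , t′) → *-congˡ (*-congˡ (reflexive (≡.cong f (⊟-⊞-⊟ s s′ t t′)))))))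

        open ≈-Reasoning
        expand : ∑[ (c , s) ∈ L ] ∑[ (c′ , s′) ∈ L ] c * c′ * T (T f) (s ⊟ s′) ≈
                 ∑[ (c , s) ∈ LB ] ∑[ (c′ , s′) ∈ LB ] c * c′ * f (s ⊟ s′)
        expand = begin
          ∑[ (c , s) ∈ L ] ∑[ (c′ , s′) ∈ L ] c * c′ * T (T f) (s ⊟ s′)
            ≈⟨ (∑-cong L λ (c , s) → ∑-cong L λ (c′ , s′) →
                 trans (*-congˡ (TT s s′)) (trans (sym (∑-*ˡ B _ _)) (∑-cong B λ (b , t) →
                 trans (sym (∑-*ˡ B _ _)) (∑-cong B λ (b′ , t′) →
                 solve 5 (λ c c′ b b′ f → c :* c′ :* (b :* (b′ :* f)) := c :* b :* (c′ :* b′) :* f)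
                   refl c c′ b b′ _)))) ⟩
          ∑[ (c , s) ∈ L ] ∑[ (c′ , s′) ∈ L ] ∑[ (b , t) ∈ B ] ∑[ (b′ , t′) ∈ B ]
            c * b * (c′ * b′) * f ((s ⊞ t) ⊟ (s′ ⊞ t′))
            ≈⟨ (∑-cong L λ _ → ∑-swap L B _) ⟩
          ∑[ (c , s) ∈ L ] ∑[ (b , t) ∈ B ] ∑[ (c′ , s′) ∈ L ] ∑[ (b′ , t′) ∈ B ]
            c * b * (c′ * b′) * f ((s ⊞ t) ⊟ (s′ ⊞ t′))
            ≈⟨ trans (∑-cartesian _ L B _) (∑-cong L λ _ → ∑-cong B λ _ → ∑-cartesian _ L B _) ⟨
          ∑[ (c , s) ∈ LB ] ∑[ (c′ , s′) ∈ LB ] c * c′ * f (s ⊟ s′) ∎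

    composition : {T U : Function d → Function d} → EvenConvolution T → EvenConvolution U →
                  EvenConvolution (T ∘ U)
    composition {T = T} {U} et eu = record
      { kernel = List.cartesianProductWith (λ (b , s) (c , t) → b * c , s ⊞ t) (kernel et) (kernel eu)
      ; apply⁺ = λ f x → trans (apply⁺ et (U f) x)
          (trans (∑-cong (kernel et) λ (b , s) → trans (*-congˡ (apply⁺ eu f (x ⊞ s)))
            (trans (sym (∑-*ˡ (kernel eu) b _)) (∑-cong (kernel eu) λ (c , t) →
              trans (sym (*-assoc b c _)) (*-congˡ (reflexive (≡.cong f (⊞-assoc x s t)))))))
          (sym (∑-cartesian _ (kernel et) (kernel eu) _)))
      ; apply⁻ = λ f x → trans (apply⁻ et (U f) x)
          (trans (∑-cong (kernel et) λ (b , s) → trans (*-congˡ (apply⁻ eu f (x ⊟ s)))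
            (trans (sym (∑-*ˡ (kernel eu) b _)) (∑-cong (kernel eu) λ (c , t) →
              trans (sym (*-assoc b c _)) (*-congˡ (reflexive (≡.cong f (⊟-⊟ x s t)))))))
          (sym (∑-cartesian _ (kernel et) (kernel eu) _)))
      }

    difference : {T U : Function d → Function d} → EvenConvolution T → EvenConvolution U →
                 EvenConvolution (λ f x → T f x - U f x)
    difference {T = T} {U} et eu = record
      { kernel = kernel et ++ List.map negate (kernel eu)
      ; apply⁺ = λ f x → trans (+-cong (apply⁺ et f x) (-‿cong (apply⁺ eu f x))) (split _)
      ; apply⁻ = λ f x → trans (+-cong (apply⁻ et f x) (-‿cong (apply⁻ eu f x))) (split _)
      }
      where
      negate : ℝ × Vec ℤ _ → ℝ × Vec ℤ _
      negate (b , s) = - b , s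

      split : (h : Vec ℤ _ → ℝ) →
        (∑[ (b , s) ∈ kernel et ] b * h s) - (∑[ (b , s) ∈ kernel eu ] b * h s) ≈
        ∑[ (b , s) ∈ kernel et ++ List.map negate (kernel eu) ] b * h s
      split h = sym (trans (∑-++ (kernel et) _ _) (+-congˡ (trans (∑-map (kernel eu) negate _)
        (trans (∑-cong (kernel eu) λ (b , s) →
                 solve 2 (λ b h → (:- b) :* h := con -[1+ 0 ] :* (b :* h)) refl b (h s))
        (trans (∑-*ˡ (kernel eu) _ _)
               (solve 1 (λ a → con -[1+ 0 ] :* a := :- a) refl _))))))

    convolutions-commute : {T U : Function d → Function d} → EvenConvolution T → EvenConvolution U →
                           ∀ f x → T (U f) x ≈ U (T f) x
    convolutions-commute {T = T} {U} et eu f x = begin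
      T (U f) x
        ≈⟨ expand et eu ⟩
      ∑[ (b , s) ∈ kernel et ] ∑[ (c , t) ∈ kernel eu ] b * (c * f (x ⊞ s ⊞ t))
        ≈⟨ ∑-swap (kernel et) (kernel eu) _ ⟩
      ∑[ (c , t) ∈ kernel eu ] ∑[ (b , s) ∈ kernel et ] b * (c * f (x ⊞ s ⊞ t))
        ≈⟨ (∑-cong (kernel eu) λ (c , t) → ∑-cong (kernel et) λ (b , s) →
             trans (solve 3 (λ b c f → b :* (c :* f) := c :* (b :* f)) refl b c _)
               (*-congˡ (*-congˡ (reflexive (≡.cong f (swap s t)))))) ⟩
      ∑[ (c , t) ∈ kernel eu ] ∑[ (b , s) ∈ kernel et ] c * (b * f (x ⊞ t ⊞ s))
        ≈⟨ expand eu et ⟨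
      U (T f) x ∎
      where
      open ≈-Reasoning
      expand : {T U : Function _ → Function _} (et : EvenConvolution T) (eu : EvenConvolution U) →
        T (U f) x ≈ ∑[ (b , s) ∈ kernel et ] ∑[ (c , t) ∈ kernel eu ] b * (c * f (x ⊞ s ⊞ t))
      expand et eu = trans (apply⁺ et _ x) (∑-cong (kernel et) λ (b , s) →
        trans (*-congˡ (apply⁺ eu f (x ⊞ s))) (sym (∑-*ˡ (kernel eu) b _)))

      swap : ∀ s t → x ⊞ s ⊞ t ≡ x ⊞ t ⊞ s
      swap s t = ≡.trans (⊞-assoc x s t)
        (≡.trans (≡.cong (x ⊞_) (⊞-comm s t)) (≡.sym (⊞-assoc x t s)))

-- Natural numbers inside the reals

module Naturals (R : Reals) where
  open Reals R hiding (zero)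
  open RealProperties R
  open Sums R

  fromℕ-+ : ∀ m n → fromℕ (m ℕ.+ n) ≈ fromℕ m + fromℕ n
  fromℕ-+ m n = trans (reflexive (≡.cong fromℚ (/1-+ (+ m) (+ n)))) (fromℚ-homo.+-homo (+ m ℚ./ 1) (+ n ℚ./ 1))

  fromℕ-0 : fromℕ 0 ≈ 0#
  fromℕ-0 = fromℚ-homo.0#-homo

  fromℕ-1 : fromℕ 1 ≈ 1#
  fromℕ-1 = fromℚ-homo.1#-homo

  fromℕ-suc : ∀ n → fromℕ (suc n) ≈ 1# + fromℕ n
  fromℕ-suc n = trans (fromℕ-+ 1 n) (+-congʳ fromℕ-1)

  fromℕ-* : ∀ m n → fromℕ (m ℕ.* n) ≈ fromℕ m * fromℕ n
  fromℕ-* zero    n = trans fromℕ-0 (sym (trans (*-congʳ fromℕ-0) (zeroˡ _)))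
  fromℕ-* (suc m) n = trans (fromℕ-+ n (m ℕ.* n)) (trans (+-congˡ (fromℕ-* m n))
    (trans (solve 2 (λ m n → n :+ m :* n := (con (+ 1) :+ m) :* n) refl _ _)
      (*-congʳ (sym (fromℕ-suc m)))))

  0≤fromℕ : ∀ n → 0# ≤ fromℕ n
  0≤fromℕ zero    = ≤-reflexive (sym fromℕ-0)
  0≤fromℕ (suc n) = ≤-resp refl (sym (fromℕ-suc n)) (0≤+ 0≤1 (0≤fromℕ n))

  0<fromℕ : ∀ n .{{_ : NonZero n}} → 0# < fromℕ n
  0<fromℕ (suc n) = <-≤-trans 0<1 (≤-resp (+-identityʳ 1#) (sym (fromℕ-suc n))
    (+-monoʳ-≤ 1# (0≤fromℕ n)))

  fromℕ-mono-≤ : ∀ {m n} → m ℕ.≤ n → fromℕ m ≤ fromℕ n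
  fromℕ-mono-≤ {m} {n} m≤n = ≤-by (0≤fromℕ (n ℕ.∸ m))
    (trans (+-congʳ (trans (reflexive (≡.cong fromℕ (≡.sym (ℕ.m+[n∸m]≡n m≤n)))) (fromℕ-+ m _)))
      (solve 2 (λ m k → m :+ k :- m := k) refl _ _))

  fromℕ-mono-< : ∀ {m n} → m ℕ.< n → fromℕ m < fromℕ n
  fromℕ-mono-< {m} m<n = <-≤-trans
    (<-by 0<1 (trans (+-congʳ (fromℕ-suc m)) (solve 1 (λ m → con (+ 1) :+ m :- m := con (+ 1)) refl _)))
    (fromℕ-mono-≤ m<n)

  fromℕ-*-ratio : ∀ r n .{{_ : NonZero n}} → fromℕ n * fromℚ (ratio r n) ≈ fromℕ r
  fromℕ-*-ratio r n = trans (sym (fromℚ-homo.*-homo (+ n ℚ./ 1) (ratio r n)))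
    (reflexive (≡.cong fromℚ (/1-*-ratio r n)))

  ∑-const : {A : Set} (xs : List A) (c : ℝ) → ∑[ x ∈ xs ] c ≈ fromℕ (List.length xs) * c
  ∑-const []       c = sym (trans (*-congʳ fromℕ-0) (zeroˡ c))
  ∑-const (x ∷ xs) c = trans (+-congˡ (∑-const xs c))
    (trans (solve 2 (λ n c → c :+ n :* c := (con (+ 1) :+ n) :* c) refl _ c)
      (*-congʳ (sym (fromℕ-suc (List.length xs)))))

  ∃-above : ∀ x → ∃[ n ] (x < fromℕ n)
  ∃-above x with archimedean (<-by {x = x} {y = x + 1#} 0<1
                               (solve 1 (λ x → x :+ con (+ 1) :- x := con (+ 1)) refl x))
  ... | q , x<q , _ = ceil q , <-≤-trans x<q (fromℚ-mono-≤ (q≤ceil q))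
    where
    ceil : ℚ → ℕ
    -- The denominator is at least 1, so the absolute value of the numerator bounds `q`.
    ceil q = ℤ.∣ ℚ.↥ q ∣
    q≤ceil : ∀ q → q ℚ.≤ + ceil q ℚ./ 1
    q≤ceil q@(ℚ.mkℚ i d _) = ℚ.toℚᵘ-cancel-≤ (ℚᵘ.≤-respʳ-≃ (ℚᵘ.≃-sym (ℚ.toℚᵘ-fromℚᵘ (mkℚᵘ (+ ceil q) 0)))
      (*≤* (ℤ.≤-trans (ℤ.≤-reflexive (ℤ.*-identityʳ i))
        (ℤ.≤-trans (i≤∣i∣ i) (n≤n*d (ceil q) d)))))
      where
      i≤∣i∣ : ∀ i → i ℤ.≤ + ℤ.∣ i ∣
      i≤∣i∣ (+ n)    = ℤ.≤-refl
      i≤∣i∣ -[1+ n ] = ℤ.-≤+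
      n≤n*d : ∀ n d → + n ℤ.≤ + n ℤ.* + suc d
      n≤n*d n d = ℤ.≤-trans (ℤ.+≤+ (ℕ.m≤m*n n (suc d))) (ℤ.≤-reflexive (ℤ.pos-* n (suc d)))

-- Neighbour averages and the symmetry in the coordinates

nbrs : ∀ {d} → Vec ℤ d → List (Vec ℤ d)
nbrs {d} = Graph.neighbours (ℤ^ d)

length-nbrs : ∀ {d} (x : Vec ℤ d) → List.length (nbrs x) ≡ d ℕ.+ d
length-nbrs []              = ≡.refl
length-nbrs {suc d} (a ∷ x) = ≡.cong suc (≡.trans
  (≡.cong suc (≡.trans (List.length-map (a ∷_) (nbrs x)) (length-nbrs x))) (≡.sym (ℕ.+-suc d d)))

infix 4 _↭ᵥ_

-- Permutations of coordinates without sign changes: `head-sum` keeps the two unit vectors of an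
-- axis together, so only axes have to be exchanged.
data _↭ᵥ_ : ∀ {d} → Vec ℤ d → Vec ℤ d → Set where
  ↭-refl  : ∀ {d} {x : Vec ℤ d} → x ↭ᵥ x
  prep    : ∀ {d} a {x y : Vec ℤ d} → x ↭ᵥ y → a ∷ x ↭ᵥ a ∷ y
  swap    : ∀ {d} a b {x : Vec ℤ d} → a ∷ b ∷ x ↭ᵥ b ∷ a ∷ x
  ↭-trans : ∀ {d} {x y z : Vec ℤ d} → x ↭ᵥ y → y ↭ᵥ z → x ↭ᵥ z

↭ᵥ-sym : ∀ {d} {x y : Vec ℤ d} → x ↭ᵥ y → y ↭ᵥ x
↭ᵥ-sym ↭-refl        = ↭-refl
↭ᵥ-sym (prep a p)    = prep a (↭ᵥ-sym p)
↭ᵥ-sym (swap a b)    = swap b a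
↭ᵥ-sym (↭-trans p q) = ↭-trans (↭ᵥ-sym q) (↭ᵥ-sym p)

↭ᵥ-𝟎 : ∀ {d} {x y : Vec ℤ d} → x ↭ᵥ y → x ≡ 𝟎 → y ≡ 𝟎
↭ᵥ-𝟎 ↭-refl        eq     = eq
↭ᵥ-𝟎 (prep a p)    eq     = ≡.cong₂ _∷_ (Vec.∷-injectiveˡ eq) (↭ᵥ-𝟎 p (Vec.∷-injectiveʳ eq))
↭ᵥ-𝟎 (swap a b)    ≡.refl = ≡.refl
↭ᵥ-𝟎 (↭-trans p q) eq     = ↭ᵥ-𝟎 q (↭ᵥ-𝟎 p eq)

module Lattice (R : Reals) where
  open Reals R hiding (zero)
  open RealProperties R
  open Sums R
  open Naturals R
  open Convolution R

  private variable
    d : ℕ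

  weight : ℕ → ℝ
  weight d = fromℚ (ratio 1 (d ℕ.+ d))

  degree*weight : ∀ d .{{_ : NonZero d}} → fromℕ (d ℕ.+ d) * weight d ≈ 1#
  degree*weight d@(suc _) = trans (fromℕ-*-ratio 1 (d ℕ.+ d)) fromℕ-1

  0<degree : ∀ d .{{_ : NonZero d}} → 0# < fromℕ (d ℕ.+ d)
  0<degree d@(suc _) = 0<fromℕ (d ℕ.+ d)

  0≤weight : ∀ d → 0# ≤ weight d
  0≤weight zero      = ≤-reflexive (sym fromℚ-homo.0#-homo)
  0≤weight d@(suc _) = *-cancelˡ-≤ (0<degree d)
    (≤-resp (sym (zeroʳ _)) (sym (degree*weight d)) 0≤1)

  weight-antitone : ∀ {d d′} .{{_ : NonZero d}} → d ℕ.< d′ → weight d′ < weight d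
  weight-antitone {d} {d′} d<d′ = reciprocal-antitone (0<degree d) (degree*weight d)
    (degree*weight d′) (fromℕ-mono-< (ℕ.+-mono-< d<d′ d<d′))
    where
    instance
      d′≢0 : NonZero d′
      d′≢0 = ℕ.>-nonZero (ℕ.≤-<-trans ℕ.z≤n d<d′)

  avg : Function d → Function d
  avg {d} f x = weight d * ∑ (nbrs x) f

  avg-cong : ∀ {f g : Function d} → (∀ x → f x ≈ g x) → ∀ x → avg f x ≈ avg g x
  avg-cong f≈g x = *-congˡ (∑-cong (nbrs x) f≈g)

  avg-+ : ∀ (f g : Function d) x → avg (λ v → f v + g v) x ≈ avg f x + avg g x
  avg-+ f g x = trans (*-congˡ (∑-+ (nbrs x) f g)) (distribˡ _ _ _)

  avg-*ˡ : ∀ c (f : Function d) x → avg (λ v → c * f v) x ≈ c * avg f x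
  avg-*ˡ {d} c f x = trans (*-congˡ (∑-*ˡ (nbrs x) c f))
    (solve 3 (λ w c s → w :* (c :* s) := c :* (w :* s)) refl (weight d) c _)

  avg-const : .{{_ : NonZero d}} → ∀ c (x : Vec ℤ d) → avg (λ _ → c) x ≈ c
  avg-const {d} c x = begin
    weight d * ∑ (nbrs x) (λ _ → c)  ≈⟨ *-congˡ (trans (∑-const (nbrs x) c)
                                          (*-congʳ (reflexive (≡.cong fromℕ (length-nbrs x))))) ⟩
    weight d * (fromℕ (d ℕ.+ d) * c) ≈⟨ solve 3 (λ w n c → w :* (n :* c) := (n :* w) :* c)
                                          refl (weight d) _ c ⟩
    (fromℕ (d ℕ.+ d) * weight d) * c ≈⟨ trans (*-congʳ (degree*weight d)) (*-identityˡ c) ⟩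
    c                                ∎
    where open ≈-Reasoning

  avg-mono : ∀ {f g : Function d} → (∀ x → f x ≤ g x) → ∀ x → avg f x ≤ avg g x
  avg-mono {d} f≤g x = *-monoˡ-≤ (0≤weight d) (∑-mono (nbrs x) f≤g)

  avg-nonneg : ∀ {f : Function d} → (∀ x → 0# ≤ f x) → ∀ x → 0# ≤ avg f x
  avg-nonneg {d} 0≤f x = 0≤* (0≤weight d) (∑-nonneg (nbrs x) 0≤f)

  ∑-nbrs-⊞ : ∀ (f : Function d) x → ∑ (nbrs x) f ≈ ∑[ s ∈ nbrs 𝟎 ] f (x ⊞ s)
  ∑-nbrs-⊞ f []      = refl
  ∑-nbrs-⊞ {suc d} f (a ∷ x) = +-cong (step _) (+-cong (step _) (trans (∑-map (nbrs x) (a ∷_) f)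
    (trans (∑-nbrs-⊞ (λ v → f (a ∷ v)) x) (trans
      (∑-cong (nbrs 𝟎) λ s → reflexive (≡.cong (λ b → f (b ∷ x ⊞ s)) (≡.sym (ℤ.+-identityʳ a))))
      (sym (∑-map (nbrs (𝟎 {d})) (+ 0 ∷_) (λ s → f ((a ∷ x) ⊞ s))))))))
    where
    step : ∀ c → f (a ℤ.+ c ∷ x) ≈ f (a ℤ.+ (+ 0 ℤ.+ c) ∷ x ⊞ 𝟎)
    step c = reflexive (≡.cong₂ (λ b v → f (a ℤ.+ b ∷ v)) (≡.sym (ℤ.+-identityˡ c))
      (≡.sym (Vec.zipWith-identityʳ ℤ.+-identityʳ x)))

  -- Negation permutes the neighbours of `𝟎` by exchanging the two on each axis. This is what makes
  -- `avg` even.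
  ∑-nbrs-⊟ : ∀ (f : Function d) x → ∑ (nbrs x) f ≈ ∑[ s ∈ nbrs 𝟎 ] f (x ⊟ s)
  ∑-nbrs-⊟ f []      = refl
  ∑-nbrs-⊟ {suc d} f (a ∷ x) = trans
    (+-cong (step _) (+-cong (step _) (trans (∑-map (nbrs x) (a ∷_) f)
      (trans (∑-nbrs-⊟ (λ v → f (a ∷ v)) x) (trans
        (∑-cong (nbrs 𝟎) λ s → reflexive (≡.cong (λ b → f (b ∷ x ⊟ s)) (≡.sym (ℤ.+-identityʳ a))))
        (sym (∑-map (nbrs (𝟎 {d})) (+ 0 ∷_) (λ s → f ((a ∷ x) ⊟ s)))))))))
    (solve 3 (λ p q r → p :+ (q :+ r) := q :+ (p :+ r)) refl _ _ _)
    where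
    ⊟𝟎 : ∀ {n} (v : Vec ℤ n) → v ⊟ 𝟎 ≡ v
    ⊟𝟎 = Vec.zipWith-identityʳ ℤ.+-identityʳ
    step : ∀ c → f (a ℤ.+ c ∷ x) ≈ f (a ℤ.- (+ 0 ℤ.+ (ℤ.- c)) ∷ x ⊟ 𝟎)
    step c = reflexive (≡.cong₂ (λ b v → f (a ℤ.+ b ∷ v))
      (≡.sym (≡.trans (≡.cong ℤ.-_ (ℤ.+-identityˡ (ℤ.- c))) (ℤ.neg-involutive c)))
      (≡.sym (⊟𝟎 x)))

  avg-even : EvenConvolution (avg {d})
  avg-even {d} = record
    { kernel = List.map (weight d ,_) (nbrs 𝟎)
    ; apply⁺ = λ f x → trans (*-congˡ (∑-nbrs-⊞ f x)) (collect _)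
    ; apply⁻ = λ f x → trans (*-congˡ (∑-nbrs-⊟ f x)) (collect _)
    }
    where
    collect : (h : Function d) → weight d * ∑ (nbrs 𝟎) h ≈
              ∑[ (b , s) ∈ List.map (weight d ,_) (nbrs 𝟎) ] b * h s
    collect h = trans (sym (∑-*ˡ (nbrs 𝟎) _ h)) 
      (sym (∑-map (nbrs (𝟎 {d})) (weight d ,_) (λ (b , s) → b * h s)))

  lift : (Function d → Function d) → Function (suc d) → Function (suc d)
  lift T f (a ∷ x) = T (λ v → f (a ∷ v)) x

  lift-even : {T : Function d → Function d} → EvenConvolution T → EvenConvolution (lift T)
  lift-even {d} {T} et = record
    { kernel = List.map extend kernel
    ; apply⁺ = λ { f (a ∷ x) → trans (apply⁺ _ x) (trans
        (∑-cong kernel λ (b , s) → *-congˡ (reflexive (≡.cong (λ c → f (c ∷ x ⊞ s))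
          (≡.sym (ℤ.+-identityʳ a)))))
        (sym (∑-map kernel extend _))) }
    ; apply⁻ = λ { f (a ∷ x) → trans (apply⁻ _ x) (trans
        (∑-cong kernel λ (b , s) → *-congˡ (reflexive (≡.cong (λ c → f (c ∷ x ⊟ s))
          (≡.sym (ℤ.+-identityʳ a)))))
        (sym (∑-map kernel extend _))) }
    }
    where
    open EvenConvolution et
    extend : ℝ × Vec ℤ d → ℝ × Vec ℤ (suc d)
    extend (b , s) = b , + 0 ∷ s

  Symmetric : Function d → Set
  Symmetric f = ∀ {x y} → x ↭ᵥ y → f x ≈ f y

  ∑-nbrs-symmetric : ∀ {f : Function d} {x y} → Symmetric f → x ↭ᵥ y → ∑ (nbrs x) f ≈ ∑ (nbrs y) f
  ∑-nbrs-symmetric         f-sym ↭-refl = refl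
  ∑-nbrs-symmetric {f = f} f-sym (prep a {x} {y} p) =
    +-cong (f-sym (prep _ p)) (+-cong (f-sym (prep _ p))
      (trans (∑-map (nbrs x) (a ∷_) f) (trans
        (∑-nbrs-symmetric (f-sym ∘ prep a) p) (sym (∑-map (nbrs y) (a ∷_) f)))))
  ∑-nbrs-symmetric {f = f} f-sym (swap a b {x}) = trans
    (+-cong (f-sym (swap _ _)) (+-cong (f-sym (swap _ _))
      (+-cong (f-sym (swap _ _)) (+-cong (f-sym (swap _ _))
        (trans (∑-two a b) (trans (∑-cong (nbrs x) λ v → f-sym (swap a b)) (sym (∑-two b a))))))))
    (solve 5 (λ p q r s t → p :+ (q :+ (r :+ (s :+ t))) := r :+ (s :+ (p :+ (q :+ t)))) refl _ _ _ _ _)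
    where
    ∑-two : ∀ a b → ∑ (List.map (a ∷_) (List.map (b ∷_) (nbrs x))) f ≈ ∑[ v ∈ nbrs x ] f (a ∷ b ∷ v)
    ∑-two a b = trans (∑-map (List.map (b ∷_) (nbrs x)) (a ∷_) f)
      (∑-map (nbrs x) (b ∷_) (f ∘ (a ∷_)))
  ∑-nbrs-symmetric f-sym (↭-trans p q) =
    trans (∑-nbrs-symmetric f-sym p) (∑-nbrs-symmetric f-sym q)

  avg-symmetric : ∀ {f : Function d} → Symmetric f → Symmetric (avg f)
  avg-symmetric f-sym p = *-congˡ (∑-nbrs-symmetric f-sym p)

  δ-symmetric : Symmetric (δ {d})
  δ-symmetric p = 𝟏-cong (_ ≟ᵥ 𝟎) (_ ≟ᵥ 𝟎) (↭ᵥ-𝟎 p) (↭ᵥ-𝟎 (↭ᵥ-sym p))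

  head-sum : Function (suc d) → ℝ
  head-sum f = f (+ 1 ∷ 𝟎) + f (-[1+ 0 ] ∷ 𝟎)

  -- A permutation of coordinates carries each of the `d` remaining axes to the first one.
  tail-sum : ∀ {f : Function (suc d)} → Symmetric f →
             ∑[ v ∈ nbrs 𝟎 ] f (+ 0 ∷ v) ≈ fromℕ d * head-sum f
  tail-sum {zero}          f-sym = sym (trans (*-congʳ fromℕ-0) (zeroˡ _))
  tail-sum {suc d} {f = f} f-sym = begin
    f (+ 0 ∷ + 1 ∷ 𝟎) + (f (+ 0 ∷ -[1+ 0 ] ∷ 𝟎) + ∑ (List.map (+ 0 ∷_) (nbrs 𝟎)) (λ v → f (+ 0 ∷ v)))
      ≈⟨ +-cong (f-sym (swap _ _)) (+-cong (f-sym (swap _ _)) (trans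
           (∑-map (nbrs (𝟎 {d})) (+ 0 ∷_) (λ v → f (+ 0 ∷ v)))
           (trans (tail-sum (f-sym ∘ prep (+ 0)))
             (*-congˡ (+-cong (f-sym (swap _ _)) (f-sym (swap _ _))))))) ⟩
    f (+ 1 ∷ 𝟎) + (f (-[1+ 0 ] ∷ 𝟎) + fromℕ d * head-sum f)
      ≈⟨ trans (solve 3 (λ p q n → p :+ (q :+ n :* (p :+ q)) := (con (+ 1) :+ n) :* (p :+ q)) refl _ _ _)
           (*-congʳ (sym (fromℕ-suc d))) ⟩
    fromℕ (suc d) * head-sum f ∎
    where open ≈-Reasoning

  private
    half : ∀ d .{{_ : NonZero d}} h → weight d * (fromℕ d * h) + weight d * (fromℕ d * h) ≈ h
    half d h = trans
      (solve 3 (λ w n h → w :* (n :* h) :+ w :* (n :* h) := (n :+ n) :* w :* h) refl _ _ h)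
      (trans (*-congʳ (trans (*-congʳ (sym (fromℕ-+ d d))) (degree*weight d))) (*-identityˡ h))

  -- Both sides average f over lattice unit vectors, which f does not tell apart.
  lift-avg-symmetric : .{{_ : NonZero d}} → ∀ {f : Function (suc d)} → Symmetric f →
                       lift avg f 𝟎 ≈ avg f 𝟎
  lift-avg-symmetric {d} {f} f-sym = double-injective
    (trans (+-cong (*-congˡ (tail-sum f-sym)) (*-congˡ (tail-sum f-sym))) (trans (half d _)
      (sym (trans (+-cong (*-congˡ whole) (*-congˡ whole)) (half (suc d) _)))))
    where
    whole : ∑ (nbrs 𝟎) f ≈ fromℕ (suc d) * head-sum f
    whole = trans (+-congˡ (+-congˡ (trans (∑-map (nbrs (𝟎 {d})) (+ 0 ∷_) f) (tail-sum f-sym))))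
      (trans (solve 3 (λ p q n → p :+ (q :+ n :* (p :+ q)) := (con (+ 1) :+ n) :* (p :+ q)) refl _ _ _)
        (*-congʳ (sym (fromℕ-suc d))))

-- Monotonicity of the return probabilities in the dimension

module ReturnProbabilities (R : Reals) where
  open Reals R hiding (zero)
  open RealProperties R
  open Sums R
  open Naturals R
  open Convolution R
  open Lattice R

  private variable
    d : ℕ

  avg² : Function d → Function d
  avg² f = avg (avg f)

  -- The probability that simple random walk on ℤ^ d is at its starting point
  -- after 2n steps.
  returnProbability : ℕ → ℕ → ℝ
  returnProbability d n = fold δ (avg² {d}) n 𝟎

  -- The arithmetic-geometric mean inequality for commuting operators: the square of `T - U` sends
  -- `f` to a positive definite function, whose value at `𝟎` is nonnegative.
  square-difference : {T U : Function d → Function d} → EvenConvolution T → EvenConvolution U →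
    ∀ {f} → PositiveDefinite f → T (U f) 𝟎 + T (U f) 𝟎 ≤ T (T f) 𝟎 + U (U f) 𝟎
  square-difference {T = T} {U} et eu {f} pd = ≤-by
    (positiveDefinite⇒nonneg (square-positiveDefinite (difference et eu) pd))
    (sym (begin
      T (λ v → T f v - U f v) 𝟎 - U (λ v → T f v - U f v) 𝟎
        ≈⟨ +-cong (EvenConvolution.T-- et (T f) (U f) 𝟎) (-‿cong (trans
             (EvenConvolution.T-- eu (T f) (U f) 𝟎) (+-congʳ (convolutions-commute eu et f 𝟎)))) ⟩
      (T (T f) 𝟎 - T (U f) 𝟎) - (T (U f) 𝟎 - U (U f) 𝟎)
        ≈⟨ solve 3 (λ a b c → (a :- b) :- (b :- c) := a :+ c :- (b :+ b)) refl _ _ _ ⟩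
      T (T f) 𝟎 + U (U f) 𝟎 - (T (U f) 𝟎 + T (U f) 𝟎) ∎))
    where open ≈-Reasoning

  fold-positiveDefinite : {T : Function d → Function d} → EvenConvolution T →
    ∀ {f} → PositiveDefinite f → ∀ n → PositiveDefinite (fold f (T ∘ T) n)
  fold-positiveDefinite et pd zero    = pd
  fold-positiveDefinite et pd (suc n) = square-positiveDefinite et (fold-positiveDefinite et pd n)

  fold-commute : {T U : Function d → Function d} → EvenConvolution T → EvenConvolution U →
    ∀ f n x → U (fold f T n) x ≈ fold (U f) T n x
  fold-commute         et eu f zero    x = refl
  fold-commute {T = T} et eu f (suc n) x = trans (convolutions-commute eu et (fold f T n) x)
    (EvenConvolution.T-cong et (fold-commute et eu f n) x)

  -- On ℤ^ (1 + d), let m average over all neighbours and y over those with the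
  -- same first coordinate.  Then E k j = ⟨δ, y²ᵏ m²ʲ δ⟩ is convex along k + j = n
  -- because y and m are commuting self-adjoint operators, and it is increasing
  -- at k = 0 because ⟨δ, y mⁱ δ⟩ = ⟨δ, mⁱ⁺¹ δ⟩ by symmetry in the coordinates.
  module _ (d : ℕ) .{{_ : NonZero d}} where
    private
      y m y² m² : Function (suc d) → Function (suc d)
      y    = lift avg
      m    = avg
      y² f = y (y f)
      m²   = avg²

      y-even  = lift-even (avg-even {d})
      y²-even = composition y-even y-even
      m-even  = avg-even {suc d}
      m²-even = composition m-even m-even

      G : ℕ → Function (suc d)
      G j = fold δ m² j

      F : ℕ → ℕ → Function (suc d)
      F k j = fold (G j) y² k

      E : ℕ → ℕ → ℝ
      E k j = F k j 𝟎

      G-positiveDefinite : ∀ j → PositiveDefinite (G j)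
      G-positiveDefinite = fold-positiveDefinite m-even δ-positiveDefinite

      G-symmetric : ∀ j → Symmetric (G j)
      G-symmetric zero    = δ-symmetric
      G-symmetric (suc j) = avg-symmetric (avg-symmetric (G-symmetric j))

      m²F : ∀ k j x → m² (F k j) x ≈ F k (suc j) x
      m²F k j = fold-commute y²-even m²-even (G j) k

      E-convex : ∀ k j → E (suc k) (suc j) + E (suc k) (suc j) ≤ E (suc (suc k)) j + E k (suc (suc j))
      E-convex k j = ≤-resp (+-cong y²m² y²m²)
        (+-congˡ (trans (EvenConvolution.T-cong m²-even (m²F k j) 𝟎) (m²F k (suc j) 𝟎)))
        (square-difference y²-even m²-even (fold-positiveDefinite y-even (G-positiveDefinite j) k))
        where
        y²m² : y² (m² (F k j)) 𝟎 ≈ E (suc k) (suc j)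
        y²m² = EvenConvolution.T-cong y²-even (m²F k j) 𝟎

      E-initial : ∀ j → E 0 (suc j) ≤ E 1 j
      E-initial j = ≤-by (0≤-sub (≤-resp (+-cong ym ym) refl
          (square-difference y-even m-even (G-positiveDefinite j))))
        (solve 2 (λ a b → b :- a := b :+ a :- (a :+ a)) refl (E 0 (suc j)) (E 1 j))
        where
        ym : y (m (G j)) 𝟎 ≈ m (m (G j)) 𝟎
        ym = lift-avg-symmetric {f = m (G j)} (avg-symmetric (G-symmetric j))

      E-step : ∀ k j → E k (suc j) ≤ E (suc k) j
      E-step zero    j = E-initial j
      E-step (suc k) j = ≤-by (0≤+ (0≤-sub (E-step k (suc j))) (0≤-sub (E-convex k j)))
        (solve 3 (λ a b c → c :- b := (b :- a) :+ ((c :+ a) :- (b :+ b))) refl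
          (E k (suc (suc j))) (E (suc k) (suc j)) (E (suc (suc k)) j))

      E-chain : ∀ k j → E 0 (k ℕ.+ j) ≤ E k j
      E-chain zero    j = ≤-refl
      E-chain (suc k) j = ≤-trans
        (≤-trans (≤-reflexive (reflexive (≡.cong (E 0) (≡.sym (ℕ.+-suc k j))))) (E-chain k (suc j)))
        (E-step k j)

      -- `y²` never leaves the slice with first coordinate 0. Hence the end `E n 0` of the
      -- antidiagonal is a return probability of the lower dimension, while the end `E 0 n` belongs
      -- to the higher one.
      y²-slice : ∀ n x → fold δ y² n (+ 0 ∷ x) ≈ fold δ avg² n x
      y²-slice zero    x = 𝟏-cong (+ 0 ∷ x ≟ᵥ 𝟎) (x ≟ᵥ 𝟎) Vec.∷-injectiveʳ (≡.cong (+ 0 ∷_))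
      y²-slice (suc n) x = avg-cong (avg-cong (y²-slice n)) x

    returnProbability-step : ∀ n → returnProbability (suc d) n ≤ returnProbability d n
    returnProbability-step n = ≤-resp (reflexive (≡.cong (E 0) (ℕ.+-identityʳ n))) (y²-slice n 𝟎)
      (E-chain n 0)

  returnProbability-antitone : ∀ {d d′} .{{_ : NonZero d}} → d ℕ.≤ d′ → ∀ n →
                               returnProbability d′ n ≤ returnProbability d n
  returnProbability-antitone d≤d′ = go (ℕ.≤⇒≤′ d≤d′)
    where
    go : ∀ {d d′} .{{_ : NonZero d}} → d ℕ.≤′ d′ → ∀ n → returnProbability d′ n ≤ returnProbability d n
    go ℕ.≤′-refl n = ≤-refl
    go {d} {suc d′} (ℕ.≤′-step d≤d′) n = ≤-trans
      (returnProbability-step d′ {{ℕ.>-nonZero (ℕ.≤-trans (ℕ.>-nonZero⁻¹ d) (ℕ.≤′⇒≤ d≤d′))}} n)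
      (go d≤d′ n)

  -- Whatever the first step is, exactly one of the equally likely second steps leads back.
  returnProbability-1 : ∀ d .{{_ : NonZero d}} → returnProbability d 1 ≈ weight d
  returnProbability-1 d = trans
    (*-congˡ (∑-cong-∈ (nbrs (𝟎 {d})) (λ v v∈ → trans (*-congˡ (one v v∈)) (*-identityʳ (weight d)))))
    (avg-const (weight d) 𝟎)
    where
    open Graph (ℤ^ d)
    one : ∀ v → v ∈ nbrs 𝟎 → ∑ (nbrs v) δ ≈ 1#
    one v v∈ = trans
      (∑-cong (nbrs v) λ x → trans (𝟏-cong (x ≟ᵥ 𝟎) (𝟎 ≟ᵥ x) ≡.sym ≡.sym) (sym (*-identityʳ _)))
      (∑-indicator-∈ _≟ᵥ_ (nbrs v) (λ _ → 1#) (neighbours-unique v)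
        (Equivalence.from (∈-neighbours v 𝟎) (∼-sym {𝟎} {v} (Equivalence.to (∈-neighbours 𝟎 v) v∈))))

  0≤fold-avg² : ∀ n (x : Vec ℤ d) → 0# ≤ fold δ avg² n x
  0≤fold-avg² zero    x with x ≟ᵥ 𝟎
  ... | yes _ = 0≤1
  ... | no  _ = ≤-refl
  0≤fold-avg² (suc n) x = avg-nonneg (avg-nonneg (0≤fold-avg² n)) x

  fold-avg²≤1 : .{{_ : NonZero d}} → ∀ n (x : Vec ℤ d) → fold δ avg² n x ≤ 1#
  fold-avg²≤1 zero    x with x ≟ᵥ 𝟎
  ... | yes _ = ≤-refl
  ... | no  _ = 0≤1
  fold-avg²≤1 (suc n) x = ≤-trans (avg-mono (λ v → ≤-trans (avg-mono (fold-avg²≤1 n) v)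
    (≤-reflexive (avg-const 1# v))) x) (≤-reflexive (avg-const 1# x))

-- Convolution of sequences

module Convolutions (R : Reals) where
  open Reals R hiding (zero)
  open RealProperties R
  open Sums R

  -- conv a b n = Σ_{i ≤ n} aᵢ b_{n-i}
  conv : (ℕ → ℝ) → (ℕ → ℝ) → ℕ → ℝ
  conv a b zero    = a 0 * b 0
  conv a b (suc n) = conv a (b ∘ suc) n + a (suc n) * b 0

  conv-congʳ : ∀ a {b b′ : ℕ → ℝ} → (∀ i → b i ≈ b′ i) → ∀ n → conv a b n ≈ conv a b′ n
  conv-congʳ a eq zero    = *-congˡ (eq 0)
  conv-congʳ a eq (suc n) = +-cong (conv-congʳ a (eq ∘ suc) n) (*-congˡ (eq 0))

  conv-+ʳ : ∀ a b b′ n → conv a (λ i → b i + b′ i) n ≈ conv a b n + conv a b′ n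
  conv-+ʳ a b b′ zero    = distribˡ _ _ _
  conv-+ʳ a b b′ (suc n) = trans (+-congʳ (conv-+ʳ a (b ∘ suc) (b′ ∘ suc) n))
    (solve 5 (λ p q a x y → p :+ q :+ a :* (x :+ y) := p :+ a :* x :+ (q :+ a :* y))
      refl _ _ _ _ _)

  conv-*ʳ : ∀ a c b n → conv a (λ i → c * b i) n ≈ c * conv a b n
  conv-*ʳ a c b zero    = solve 3 (λ a c x → a :* (c :* x) := c :* (a :* x)) refl _ _ _
  conv-*ʳ a c b (suc n) = trans (+-congʳ (conv-*ʳ a c (b ∘ suc) n))
    (solve 4 (λ p a c x → c :* p :+ a :* (c :* x) := c :* (p :+ a :* x)) refl _ _ _ _)

  conv--ˡ : ∀ a a′ b n → conv (λ i → a i - a′ i) b n ≈ conv a b n - conv a′ b n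
  conv--ˡ a a′ b zero    = solve 3 (λ a a′ x → (a :- a′) :* x := a :* x :- a′ :* x) refl _ _ _
  conv--ˡ a a′ b (suc n) = trans (+-congʳ (conv--ˡ a a′ (b ∘ suc) n))
    (solve 5 (λ p q a a′ x → p :- q :+ (a :- a′) :* x := p :+ a :* x :- (q :+ a′ :* x))
      refl _ _ _ _ _)

  conv--ʳ : ∀ a b b′ n → conv a (λ i → b i - b′ i) n ≈ conv a b n - conv a b′ n
  conv--ʳ a b b′ zero    = solve 3 (λ a x y → a :* (x :- y) := a :* x :- a :* y) refl _ _ _
  conv--ʳ a b b′ (suc n) = trans (+-congʳ (conv--ʳ a (b ∘ suc) (b′ ∘ suc) n))
    (solve 5 (λ p q a x y → p :- q :+ a :* (x :- y) := p :+ a :* x :- (q :+ a :* y))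
      refl _ _ _ _ _)

  conv-const : ∀ a c n → conv a (λ _ → c) n ≈ ∑< (suc n) a * c
  conv-const a c zero    = *-congʳ (sym (+-identityˡ _))
  conv-const a c (suc n) = trans (+-congʳ (conv-const a c n)) (sym (distribʳ c _ _))

  conv-nonneg : ∀ {a b} → (∀ i → 0# ≤ a i) → (∀ i → 0# ≤ b i) → ∀ n → 0# ≤ conv a b n
  conv-nonneg 0≤a 0≤b zero    = 0≤* (0≤a 0) (0≤b 0)
  conv-nonneg 0≤a 0≤b (suc n) =
    0≤+ (conv-nonneg 0≤a (0≤b ∘ suc) n) (0≤* (0≤a (suc n)) (0≤b 0))

  -- Of the nonnegative terms only the last one, `a n * b 0`, is kept.
  conv-lower : ∀ {a b c} → 0# ≤ c → (∀ i → c ≤ a i) → (∀ i → 0# ≤ b i) → ∀ n → c * b 0 ≤ conv a b n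
  conv-lower 0≤c c≤a 0≤b zero    = *-monoʳ-≤ (0≤b 0) (c≤a 0)
  conv-lower {b = b} {c} 0≤c c≤a 0≤b (suc n) = ≤-resp (+-identityˡ _) refl
    (+-mono-≤ (conv-nonneg (λ i → ≤-trans 0≤c (c≤a i)) (0≤b ∘ suc) n)
              (*-monoʳ-≤ (0≤b 0) (c≤a (suc n))))

  -- An error estimate for a sequence `a` of unknown sign: each term is at least minus the bound `e`
  -- of its factor from `b`.
  conv-≥-∑ : ∀ {a b e} n → (∀ i → - 1# ≤ a i) → (∀ i → i ℕ.≤ n → 0# ≤ b i) →
             (∀ i → i ℕ.≤ n → b i ≤ e i) → - ∑< (suc n) e ≤ conv a b n
  conv-≥-∑ {a} {b} {e} n -1≤a 0≤b b≤e = ≤-resp (-‿cong (+-identityʳ _)) refl (go n 0≤b b≤e)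
    where
    term : ∀ {α β ζ} → - 1# ≤ α → 0# ≤ β → β ≤ ζ → - ζ ≤ α * β
    term {α} {β} {ζ} -1≤α 0≤β β≤ζ = ≤-by (0≤+ (0≤-sub β≤ζ) (0≤* (0≤-sub -1≤α) 0≤β))
      (solve 3 (λ α β ζ → α :* β :- :- ζ := ζ :- β :+ (α :- :- con (+ 1)) :* β) refl α β ζ)

    go : ∀ {b e} n → (∀ i → i ℕ.≤ n → 0# ≤ b i) → (∀ i → i ℕ.≤ n → b i ≤ e i) →
         - (∑< (suc n) e + 0#) ≤ conv a b n
    go {b} {e} zero 0≤b b≤e = ≤-resp
      (-‿cong (solve 1 (λ x → x := con (+ 0) :+ x :+ con (+ 0)) refl (e 0))) refl
      (term (-1≤a 0) (0≤b 0 ℕ.z≤n) (b≤e 0 ℕ.z≤n))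
    go {b} {e} (suc n) 0≤b b≤e = ≤-resp
      (trans (solve 2 (λ s x → :- (s :+ con (+ 0)) :+ :- x := :- (x :+ s)) refl _ (e 0))
        (-‿cong (trans (sym (∑<-shift (suc n) e)) (sym (+-identityʳ _))))) refl
      (+-mono-≤ (go n (λ i i≤n → 0≤b (suc i) (ℕ.s≤s i≤n)) (λ i i≤n → b≤e (suc i) (ℕ.s≤s i≤n)))
                (term (-1≤a (suc n)) (0≤b 0 ℕ.z≤n) (b≤e 0 ℕ.z≤n)))

  -- Summation is convolution with the constant 1, so by associativity it can be moved to the second
  -- factor.
  ∑<-conv : ∀ a b n → ∑< (suc n) (conv a b) ≈ conv a (λ j → ∑< (suc j) b) n
  ∑<-conv a b zero    = solve 2 (λ a b → con (+ 0) :+ a :* b := a :* (con (+ 0) :+ b)) refl _ _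
  ∑<-conv a b (suc n) = trans (+-congʳ (∑<-conv a b n))
    (trans (solve 4 (λ p q a b → p :+ (q :+ a :* b) := p :+ q :+ a :* (con (+ 0) :+ b)) refl _ _ _ _)
      (+-congʳ (sym (conv-+ʳ a _ (b ∘ suc) n))))

-- The correlation function, its renewal equation and the gap between dimensions

module Correlations (R : Reals) (w : Reals.ℝ R) (0<w : Reals._<_ R (Reals.0# R) w)
                    (w<1 : Reals._<_ R w (Reals.1# R)) where
  open Reals R hiding (zero)
  open RealProperties R
  open Sums R
  open Naturals R
  open Convolution R
  open Lattice R
  open ReturnProbabilities R
  open Convolutions R
  open Exp (CommutativeRing.semiring commutativeRing) using (_^_)

  private variable
    d : ℕ

  0≤w : 0# ≤ w
  0≤w = <⇒≤ 0<w

  q : ℝ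
  q = 1# - w

  0<q : 0# < q
  0<q = 0<-sub w<1

  0≤q : 0# ≤ q
  0≤q = <⇒≤ 0<q

  0≤w^ : ∀ n → 0# ≤ w ^ n
  0≤w^ zero    = 0≤1
  0≤w^ (suc n) = 0≤* 0≤w (0≤w^ n)

  -- One step back in time for a pair of ancestral walks: both escape the noise with probability
  -- `w`, and their two independent symmetric steps move the displacement by two steps of simple
  -- random walk.
  K : Function d → Function d
  K f x = w * avg² f x

  -- The correlation at time t of two spins at displacement x.
  C : ℕ → Function d
  C     zero    x = δ x
  C {d} (suc t) x = K (C t) x + (1# - K (C t) (𝟎 {d})) * δ x

  -- The mean of the product of the spins of one vertex at times t and t + 2, by `E-g`: the later
  -- spin is traced back two steps, so that two spins of time t remain.
  γ : ℕ → ℕ → ℝ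
  γ d t = K (C t) (𝟎 {d})

  δ-𝟎 : δ {d} 𝟎 ≈ 1#
  δ-𝟎 {d} = 𝟏-true (𝟎 {d} ≟ᵥ 𝟎) ≡.refl

  δ-≢𝟎 : ∀ {x : Vec ℤ d} → ¬ (x ≡ 𝟎) → δ x ≈ 0#
  δ-≢𝟎 {x = x} = 𝟏-false (x ≟ᵥ 𝟎)

  C-𝟎 : ∀ t → C {d} t 𝟎 ≈ 1#
  C-𝟎 {d} zero    = δ-𝟎 {d}
  C-𝟎 {d} (suc t) = trans (+-congˡ (*-congˡ (δ-𝟎 {d})))
    (solve 1 (λ k → k :+ (con (+ 1) :- k) :* con (+ 1) := con (+ 1)) refl (γ d t))

  C-≢𝟎 : ∀ t {x : Vec ℤ d} → ¬ (x ≡ 𝟎) → C (suc t) x ≈ K (C t) x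
  C-≢𝟎 t x≢𝟎 = trans (+-congˡ (trans (*-congˡ (δ-≢𝟎 x≢𝟎)) (zeroʳ _))) (+-identityʳ _)

  0≤C : ∀ t (x : Vec ℤ d) → 0# ≤ C t x
  0≤C zero    x = 0≤fold-avg² 0 x
  0≤C {d} (suc t) x = go (x ≟ᵥ 𝟎)
    where
    go : Dec (x ≡ 𝟎) → 0# ≤ C (suc t) x
    go (yes ≡.refl) = ≤-resp refl (sym (C-𝟎 {d} (suc t))) 0≤1
    go (no  x≢𝟎)    = ≤-resp refl (sym (C-≢𝟎 t x≢𝟎)) (0≤* 0≤w (avg-nonneg (avg-nonneg (0≤C t)) x))

  avg²-≤ : .{{_ : NonZero d}} → ∀ {f : Function d} {c} → (∀ x → f x ≤ c) → ∀ x → avg² f x ≤ c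
  avg²-≤ {c = c} f≤c x = ≤-trans
    (avg-mono (λ v → ≤-trans (avg-mono f≤c v) (≤-reflexive (avg-const c v))) x)
    (≤-reflexive (avg-const c x))

  K-≤w : .{{_ : NonZero d}} → ∀ {f : Function d} → (∀ x → f x ≤ 1#) → ∀ x → K f x ≤ w
  K-≤w f≤1 x = ≤-trans (*-monoˡ-≤ 0≤w (avg²-≤ f≤1 x)) (≤-reflexive (*-identityʳ w))

  C≤1 : .{{_ : NonZero d}} → ∀ t (x : Vec ℤ d) → C t x ≤ 1#
  C≤1 zero    x = fold-avg²≤1 0 x
  C≤1 {d} (suc t) x = go (x ≟ᵥ 𝟎)
    where
    go : Dec (x ≡ 𝟎) → C (suc t) x ≤ 1#
    go (yes ≡.refl) = ≤-reflexive (C-𝟎 {d} (suc t))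
    go (no  x≢𝟎)    = ≤-trans (≤-reflexive (C-≢𝟎 t x≢𝟎)) (≤-trans (K-≤w (C≤1 t) x) (<⇒≤ w<1))

  γ≤w : ∀ d .{{_ : NonZero d}} t → γ d t ≤ w
  γ≤w d t = K-≤w (C≤1 t) (𝟎 {d})

  0≤γ : ∀ d t → 0# ≤ γ d t
  0≤γ d t = 0≤* 0≤w (avg-nonneg (avg-nonneg (0≤C t)) (𝟎 {d}))

  -- The mass added at `𝟎` at time t in order that `C t 𝟎` be 1.
  r : ℕ → ℕ → ℝ
  r d zero    = 1#
  r d (suc t) = 1# - γ d t

  q≤r : ∀ d .{{_ : NonZero d}} t → q ≤ r d t
  q≤r d zero    = ≤-by 0≤w (solve 1 (λ w → con (+ 1) :- (con (+ 1) :- w) := w) refl w)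
  q≤r d (suc t) = +-monoʳ-≤ 1# (neg-mono-≤ (γ≤w d t))

  r≤1 : ∀ d t → r d t ≤ 1#
  r≤1 d zero    = ≤-refl
  r≤1 d (suc t) = ≤-by (0≤γ d t) (solve 1 (λ g → con (+ 1) :- (con (+ 1) :- g) := g) refl (γ d t))

  k : ℕ → ℕ → ℝ
  k d n = w ^ n * returnProbability d n

  K-conv : ∀ (a : ℕ → ℝ) (φ : ℕ → Function d) n x →
           K (λ v → conv a (λ i → φ i v) n) x ≈ conv a (λ i → K (φ i) x) n
  K-conv a φ zero    x = trans (*-congˡ (trans (avg-cong (avg-*ˡ (a 0) (φ 0)) x) (avg-*ˡ (a 0) _ x)))
    (solve 3 (λ w a f → w :* (a :* f) := a :* (w :* f)) refl w (a 0) _)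
  K-conv a φ (suc n) x = trans
    (*-congˡ (trans (avg-cong (avg-+ _ _) x) (trans (avg-+ _ _ x)
      (+-congˡ (trans (avg-cong (avg-*ˡ (a (suc n)) (φ 0)) x) (avg-*ˡ (a (suc n)) _ x))))))
    (trans (solve 4 (λ w p a f → w :* (p :+ a :* f) := w :* p :+ a :* (w :* f)) refl w _ (a (suc n)) _)
      (+-congʳ (K-conv a (φ ∘ suc) n x)))

  Kⁿδ : ∀ n (x : Vec ℤ d) → fold δ K n x ≈ w ^ n * fold δ avg² n x
  Kⁿδ zero    x = sym (*-identityˡ _)
  Kⁿδ (suc n) x = trans
    (*-congˡ (trans (avg-cong (avg-cong (Kⁿδ n)) x)
      (trans (avg-cong (avg-*ˡ (w ^ n) _) x) (avg-*ˡ (w ^ n) _ x))))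
    (sym (*-assoc w _ _))

  -- Superposition: the mass added at time t - n has since been spread by n applications of `K`.
  C-conv : ∀ t (x : Vec ℤ d) → C t x ≈ conv (r d) (λ n → fold δ K n x) t
  C-conv         zero    x = sym (*-identityˡ _)
  C-conv {d = d} (suc t) x = +-congʳ (trans
    (*-congˡ (avg-cong (avg-cong (C-conv t)) x)) (K-conv (r d) (fold δ K) t x))

  -- The renewal equation: r d is the convolution inverse of k d, up to summation.
  renewal : ∀ d t → conv (r d) (k d) t ≈ 1#
  renewal d t = trans (sym (trans (C-conv {d} t 𝟎) (conv-congʳ (r d) (λ n → Kⁿδ n 𝟎) t))) (C-𝟎 {d} t)

  private
    G : ℕ → ℕ → ℝ
    G d n = ∑< (suc n) (k d)

  k≤w^ : ∀ d .{{_ : NonZero d}} n → k d n ≤ w ^ n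
  k≤w^ d n = ≤-trans (*-monoˡ-≤ (0≤w^ n) (fold-avg²≤1 n (𝟎 {d}))) (≤-reflexive (*-identityʳ _))

  0≤k : ∀ d n → 0# ≤ k d n
  0≤k d n = 0≤* (0≤w^ n) (0≤fold-avg² n (𝟎 {d}))

  module _ (d : ℕ) .{{_ : NonZero d}} where
    private
      -- Divided by `q`, this is the partial sum `G d n` plus the geometric tail that dominates the
      -- rest of the series. Replacing a term of the tail by the smaller true term can only lower
      -- it, which bounds the remainder without an infinite sum.
      potential : ℕ → ℝ
      potential n = q * G d n + w ^ suc n

      potential-step : ∀ n → potential (suc n) ≤ potential n
      potential-step n = ≤-by (0≤* 0≤q (0≤-sub (k≤w^ d (suc n))))
        (solve 4 (λ w g k v → (con (+ 1) :- w) :* g :+ v :- ((con (+ 1) :- w) :* (g :+ k) :+ w :* v) :=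
                              (con (+ 1) :- w) :* (v :- k)) refl w (G d n) (k d (suc n)) (w ^ suc n))

      potential-antitone : ∀ {j n} → j ℕ.≤′ n → potential n ≤ potential j
      potential-antitone ℕ.≤′-refl       = ≤-refl
      potential-antitone (ℕ.≤′-step {n} j≤n) = ≤-trans (potential-step n) (potential-antitone j≤n)

    G-mono : ∀ {j n} → j ℕ.≤′ n → G d j ≤ G d n
    G-mono ℕ.≤′-refl             = ≤-refl
    G-mono (ℕ.≤′-step {n} j≤n) = ≤-trans (G-mono j≤n)
      (≤-by (0≤k d (suc n)) (solve 2 (λ g k → g :+ k :- g := k) refl (G d n) (k d (suc n))))

    G-tail : ∀ {j n} → j ℕ.≤ n → q * (G d n - G d j) ≤ w ^ suc j
    G-tail {j} {n} j≤n = ≤-by (0≤+ (0≤-sub (potential-antitone (ℕ.≤⇒≤′ j≤n))) (0≤w^ (suc n)))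
      (solve 5 (λ q g g′ v v′ → v :- q :* (g′ :- g) := (q :* g :+ v) :- (q :* g′ :+ v′) :+ v′)
        refl q (G d j) (G d n) (w ^ suc j) (w ^ suc n))

    k-0 : k d 0 ≈ 1#
    k-0 = trans (*-identityˡ _) (δ-𝟎 {d})

    1≤G : ∀ n → 1# ≤ G d n
    1≤G n = ≤-trans (≤-reflexive (sym (trans (+-identityˡ _) k-0)))
      (G-mono {0} {n} (ℕ.≤⇒≤′ ℕ.z≤n))

    qG≤1 : ∀ n → q * G d n ≤ 1#
    qG≤1 n = ≤-by (0≤+ (0≤-sub (potential-antitone {0} {n} (ℕ.≤⇒≤′ ℕ.z≤n))) (0≤w^ (suc n)))
      (trans (+-congʳ (sym (trans (+-congʳ (*-congˡ (trans (+-identityˡ _) k-0)))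
         (solve 1 (λ w → (con (+ 1) :- w) :* con (+ 1) :+ w :* con (+ 1) := con (+ 1)) refl w))))
       (solve 3 (λ p a v → p :- a := p :- (a :+ v) :+ v) refl _ (q * G d n) (w ^ suc n)))

  q∑w^≤1 : ∀ n → q * ∑< n (λ j → w ^ suc j) ≤ 1#
  q∑w^≤1 n = ≤-trans (≤-by (0≤w^ (suc n)) (sub n)) (<⇒≤ w<1)
    where
    sub : ∀ n → w - q * ∑< n (λ j → w ^ suc j) ≈ w ^ suc n
    sub zero    = solve 1 (λ w → w :- (con (+ 1) :- w) :* con (+ 0) := w :* con (+ 1)) refl w
    sub (suc n) = trans
      (solve 3 (λ w s v → w :- (con (+ 1) :- w) :* (s :+ v) :=
         w :- (con (+ 1) :- w) :* s :- (con (+ 1) :- w) :* v) refl w _ (w ^ suc n))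
      (trans (+-congʳ (sub n)) (solve 2 (λ w v → v :- (con (+ 1) :- w) :* v := w :* v) refl w (w ^ suc n)))

  -- With k a ≥ k b, the renewal equations give Σ_{s ≤ t} hₛ (k b)_{t-s} ≥ gain for
  -- h = r b - r a and t ≥ 1.  Summing over t turns k b into its partial sums
  -- G b, which are constant up to a geometric error.
  module Gap {a b : ℕ} .{{a≢0 : NonZero a}} .{{b≢0 : NonZero b}} (a<b : a ℕ.< b) where
    private
      κ h : ℕ → ℝ
      κ i = k a i - k b i
      h i = r b i - r a i

      -- `κ 1` is `w` times the difference of the two-step return probabilities, the one place where
      -- strictness enters; `q` bounds `r a` from below.
      gain : ℝ
      gain = q * κ 1

      0≤κ : ∀ i → 0# ≤ κ i
      0≤κ i = 0≤-sub (*-monoˡ-≤ (0≤w^ i) (returnProbability-antitone (ℕ.<⇒≤ a<b) i))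

      0<κ1 : 0# < κ 1
      0<κ1 = 0<-sub (<-resp (*-congˡ (sym (returnProbability-1 b))) (*-congˡ (sym (returnProbability-1 a)))
        (*-monoˡ-< (<-resp refl (sym (*-identityʳ w)) 0<w) (weight-antitone a<b)))

      -- By the renewal equations `conv (r b) (k b)` may be replaced by `conv (r a) (k a)`, both
      -- being 1.
      h-conv : ∀ t → conv h (k b) t ≈ conv (r a) κ t
      h-conv t = trans (conv--ˡ (r b) (r a) (k b) t) (trans
        (+-congʳ (trans (renewal b t) (sym (renewal a t)))) (sym (conv--ʳ (r a) (k a) (k b) t)))

      h-conv-≥ : ∀ t → gain ≤ conv h (k b) (suc t)
      h-conv-≥ t = ≤-trans
        (≤-resp (+-identityʳ gain) refl (+-mono-≤ (conv-lower 0≤q (q≤r a) (0≤κ ∘ suc) t)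
          (0≤* (≤-trans 0≤q (q≤r a (suc t))) (0≤κ 0))))
        (≤-reflexive (sym (h-conv (suc t))))

      ∑-h-conv : ∀ n → fromℕ n * gain ≤ ∑< (suc n) (conv h (k b))
      ∑-h-conv zero    = ≤-resp (sym (trans (*-congʳ fromℕ-0) (zeroˡ gain)))
        (trans (sym (h-conv 0)) (sym (+-identityˡ _)))
        (conv-nonneg (λ i → ≤-trans 0≤q (q≤r a i)) 0≤κ 0)
      ∑-h-conv (suc n) = ≤-trans (≤-reflexive (trans (*-congʳ (fromℕ-suc n))
          (solve 2 (λ n g → (con (+ 1) :+ n) :* g := n :* g :+ g) refl _ gain)))
        (+-mono-≤ (∑-h-conv n) (h-conv-≥ n))

      -1≤h : ∀ i → - 1# ≤ h i
      -1≤h i = ≤-by (0≤+ (≤-trans 0≤q (q≤r b i)) (0≤-sub (r≤1 a i)))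
        (solve 2 (λ x y → x :- y :- :- con (+ 1) := x :+ (con (+ 1) :- y)) refl (r b i) (r a i))

      h≤1 : ∀ i → h i ≤ 1#
      h≤1 i = ≤-by (0≤+ (≤-trans 0≤q (q≤r a i)) (0≤-sub (r≤1 b i)))
        (solve 2 (λ x y → con (+ 1) :- (x :- y) := y :+ (con (+ 1) :- x)) refl (r b i) (r a i))

    -- The guaranteed growth of the gap per unit of time. One factor `q` clears the denominator 1/q
    -- of the tail estimate `G-tail`, the other that of the sum of these estimates over j.
    η′ : ℝ
    η′ = q * (q * gain)

    0<η′ : 0# < η′
    0<η′ = *-pos 0<q (*-pos 0<q (*-pos 0<q 0<κ1))

    private
      -- Were `G b` constant, the sum of `conv h (k b)` would be `G b n` times the sum of `h`. The
      -- deviation is the convolution of `h` with the tails `G b n - G b j`; after the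
      -- multiplication by `q * q` it costs at most 1 in total.
      ∑h-bound : ∀ n → fromℕ n * η′ - 1# ≤ q * (q * G b n) * ∑< (suc n) h
      ∑h-bound n = ≤-by (0≤+ (0≤+ (0≤* (0≤* 0≤q 0≤q) (0≤-sub (∑-h-conv n)))
                                  (0≤* 0≤q (0≤-sub error)))
                             (0≤-sub (q∑w^≤1 (suc n))))
        (trans (solve 6 (λ q m g H c e →
             q :* (q :* g) :* H :- (m :* (q :* (q :* c)) :- con (+ 1)) :=
             q :* q :* (e :- m :* c) :+ q :* (q :* (H :* g :- e)) :+ con (+ 1))
             refl q (fromℕ n) (G b n) H gain S)
          (trans (solve 4 (λ x q y s → x :+ q :* y :+ con (+ 1) :=
             x :+ q :* (y :- :- s) :+ (con (+ 1) :- q :* s)) refl _ q _ E)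
             (+-congʳ (+-congˡ (*-congˡ (+-congʳ (sym tail)))))))
        where
        H S E : ℝ
        H = ∑< (suc n) h
        S = ∑< (suc n) (conv h (k b))
        E = ∑< (suc n) (λ j → w ^ suc j)

        tail : conv h (λ j → q * (G b n - G b j)) n ≈ q * (H * G b n - S)
        tail = trans (conv-*ʳ h q (λ j → G b n - G b j) n) (*-congˡ (trans
          (conv--ʳ h (λ _ → G b n) (G b) n)
          (+-cong (conv-const h (G b n) n) (-‿cong (sym (∑<-conv h (k b) n))))))

        error : - E ≤ conv h (λ j → q * (G b n - G b j)) n
        error = conv-≥-∑ n -1≤h
          (λ i i≤n → 0≤* 0≤q (0≤-sub (G-mono b (ℕ.≤⇒≤′ i≤n)))) (λ i i≤n → G-tail b i≤n)

      -- The factor `q * (q * G b n)` is positive, so the sum of `h` is nonnegative, and it is at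
      -- most 1, so it may then be dropped.
      ∑h-≥ : ∀ n → 1# ≤ fromℕ n * η′ → fromℕ n * η′ - 1# ≤ ∑< (suc n) h
      ∑h-≥ n 1≤nη′ = ≤-trans (∑h-bound n) (≤-by (0≤* (0≤-sub c≤1) 0≤H)
        (solve 2 (λ c H → H :- c :* H := (con (+ 1) :- c) :* H) refl c _))
        where
        c : ℝ
        c = q * (q * G b n)
        q≤1 : q ≤ 1#
        q≤1 = q≤r b 0
        c≤1 : c ≤ 1#
        c≤1 = ≤-trans (*-monoˡ-≤ 0≤q (qG≤1 b n)) (≤-trans (≤-reflexive (*-identityʳ q)) q≤1)
        0<c : 0# < c
        0<c = *-pos 0<q (*-pos 0<q (<-≤-trans 0<1 (1≤G b n)))
        0≤H : 0# ≤ ∑< (suc n) h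
        0≤H = *-cancelˡ-≤ 0<c (≤-trans (≤-reflexive (zeroʳ c)) (≤-trans (0≤-sub 1≤nη′) (∑h-bound n)))

    gap : ∀ n → 1# ≤ fromℕ n * η′ →
          fromℕ n * η′ - (1# + 1#) ≤ ∑< n (γ a ∘ suc) - ∑< n (γ b ∘ suc)
    gap n 1≤nη′ = ≤-resp refl (∑<-- n (γ a ∘ suc) (γ b ∘ suc))
      (≤-by (0≤+ (0≤-sub (∑h-≥ (suc n) (≤-trans 1≤nη′ nη′≤))) (0≤+ (0≤-sub nη′≤) (0≤-sub (h≤1 1))))
        (trans (solve 3 (λ s x y → s :- (x :- (con (+ 1) :+ con (+ 1))) :=
                  (con (+ 1) :- con (+ 1) :+ (y :+ s)) :- (x :- con (+ 1)) :+ (con (+ 1) :- y))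
                 refl Γ (fromℕ n * η′) (h 1))
          (trans (+-congʳ (+-congʳ (sym split)))
            (solve 4 (λ S x x′ z → S :- (x :- con (+ 1)) :+ z :=
                S :- (x′ :- con (+ 1)) :+ (x′ :- x :+ z)) refl _ _ (fromℕ (suc n) * η′) _))))
      where
      Γ : ℝ
      Γ = ∑< n (λ i → γ a (suc i) - γ b (suc i))
      nη′≤ : fromℕ n * η′ ≤ fromℕ (suc n) * η′
      nη′≤ = *-monoʳ-≤ (<⇒≤ 0<η′) (fromℕ-mono-≤ (ℕ.n≤1+n n))
      -- `h 0` vanishes, and `h 1` compares `γ` at time 0, which the statistic omits because it
      -- starts at time 1. Its bound 1 is the second 1 lost in `gap`.
      split : ∑< (suc (suc n)) h ≈ 1# - 1# + (h 1 + Γ)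
      split = trans (∑<-shift (suc n) h) (+-congˡ (trans (∑<-shift n (h ∘ suc)) (+-congˡ
        (∑<-cong n (λ i → solve 2 (λ x y → (con (+ 1) :- y) :- (con (+ 1) :- x) := x :- y)
          refl (γ a (suc i)) (γ b (suc i)))))))

  -- 2/q, the sum of the geometric series with terms 2 wᵏ that dominates the covariances.
  tailBound : ℝ
  tailBound = (1# + 1#) * proj₁ (inverse 0<q)

  tailBound*q : tailBound * q ≈ 1# + 1#
  tailBound*q = trans (*-assoc _ _ q)
    (trans (*-congˡ (proj₂ (proj₂ (inverse 0<q)))) (*-identityʳ _))

  0≤tailBound : 0# ≤ tailBound
  0≤tailBound = 0≤* (0≤+ 0≤1 0≤1) (<⇒≤ (proj₁ (proj₂ (inverse 0<q))))

  -- The growth of the variance per summand: two mixed terms, each at most the bound of `W-next`,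
  -- and one square, at most 2.
  varianceRate : ℝ
  varianceRate = (tailBound + (1# + 1#)) + (tailBound + (1# + 1#)) + (1# + 1#)

-- Finitely additive probability of decidable events

module Events {R : Reals} (𝒫 : ProbabilitySpace R) where
  open Reals R hiding (zero)
  open RealProperties R
  open ProbabilitySpace 𝒫

  infixr 6 _∩ᵉ_

  _∩ᵉ_ : Event → Event → Event
  (A , a) ∩ᵉ (B , b) = A ∩ B , isEvent-∩ a b

  ∁ᵉ : Event → Event
  ∁ᵉ (A , a) = ∁ A , isEvent-∁ a

  Uᵉ : Event
  Uᵉ = U , isEvent-U

  infix 4 _∈ᵉ_

  _∈ᵉ_ : Ω → Event → Set
  ω ∈ᵉ A = proj₁ A ω

  P-cong′ : ∀ (A B : Event) → (∀ ω → ω ∈ᵉ A → ω ∈ᵉ B) → (∀ ω → ω ∈ᵉ B → ω ∈ᵉ A) → P A ≈ P B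
  P-cong′ (_ , a) (_ , b) A⊆B B⊆A = P-cong a b ((λ {ω} → A⊆B ω) , (λ {ω} → B⊆A ω))

  P-empty : ∀ (A : Event) → (∀ ω → ¬ (ω ∈ᵉ A)) → P A ≈ 0#
  P-empty A@(_ , a) empty = begin
    P A                   ≈⟨ solve 2 (λ p u → p := (u :+ p) :- u) refl (P A) (P Uᵉ) ⟩
    (P Uᵉ + P A) - P Uᵉ   ≈⟨ +-congʳ (P-∪ isEvent-U a λ { {ω} (_ , p) → empty ω p }) ⟨
    P (U ∪ proj₁ A , isEvent-∪ isEvent-U a) - P Uᵉ
                          ≈⟨ +-congʳ (P-cong′ _ Uᵉ _ (λ _ → inj₁)) ⟩
    P Uᵉ - P Uᵉ           ≈⟨ -‿inverseʳ _ ⟩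
    0#                    ∎
    where open ≈-Reasoning

  -- Covering `A` by its parts inside and outside `B` needs a decision of membership in `B`; this is
  -- why decision procedures accompany the events from here on.
  P-split : ∀ (A B : Event) → (∀ ω → Dec (ω ∈ᵉ B)) → P A ≈ P (A ∩ᵉ B) + P (A ∩ᵉ ∁ᵉ B)
  P-split A@(_ , a) B@(_ , b) B? = trans
    (P-cong′ A (proj₁ A ∩ proj₁ B ∪ proj₁ A ∩ ∁ (proj₁ B) , isEvent-∪ a∩b a∩∁b) split
      λ { _ (inj₁ (p , _)) → p ; _ (inj₂ (p , _)) → p })
    (P-∪ a∩b a∩∁b λ ((_ , p) , (_ , ¬p)) → ¬p p)
    where
    a∩b  = isEvent-∩ a b
    a∩∁b = isEvent-∩ a (isEvent-∁ b)
    split : ∀ ω → ω ∈ᵉ A → (proj₁ A ∩ proj₁ B ∪ proj₁ A ∩ ∁ (proj₁ B)) ω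
    split ω p with B? ω
    ... | yes q = inj₁ (p , q)
    ... | no ¬q = inj₂ (p , ¬q)

  P-∁ : ∀ (A : Event) → (∀ ω → Dec (ω ∈ᵉ A)) → P (∁ᵉ A) ≈ 1# - P A
  P-∁ A A? = begin
    P (∁ᵉ A)             ≈⟨ solve 2 (λ p x → x := (p :+ x) :- p) refl (P A) (P (∁ᵉ A)) ⟩
    (P A + P (∁ᵉ A)) - P A
      ≈⟨ +-congʳ (+-cong (P-cong′ (Uᵉ ∩ᵉ A) A (λ _ → proj₂) (λ _ p → _ , p))
                         (P-cong′ (Uᵉ ∩ᵉ ∁ᵉ A) (∁ᵉ A) (λ _ → proj₂) (λ _ p → _ , p))) ⟨
    (P (Uᵉ ∩ᵉ A) + P (Uᵉ ∩ᵉ ∁ᵉ A)) - P A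
      ≈⟨ +-congʳ (trans (sym (P-split Uᵉ A A?)) P-U) ⟩
    1# - P A             ∎
    where open ≈-Reasoning

  P-mono : ∀ (A B : Event) → (∀ ω → Dec (ω ∈ᵉ A)) → (∀ ω → ω ∈ᵉ A → ω ∈ᵉ B) → P A ≤ P B
  P-mono A B A? A⊆B = ≤-by (P-nonneg (B ∩ᵉ ∁ᵉ A)) (trans
    (+-congʳ (trans (P-split B A A?)
      (+-congʳ (P-cong′ (B ∩ᵉ A) A (λ _ → proj₂) (λ ω p → A⊆B ω p , p)))))
    (solve 2 (λ a x → a :+ x :- a := x) refl (P A) _))

  P≤1 : ∀ (A : Event) → (∀ ω → Dec (ω ∈ᵉ A)) → P A ≤ 1#
  P≤1 A A? = ≤-trans (P-mono A Uᵉ A? _) (≤-reflexive P-U)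

  P-∩-bound : ∀ (A B : Event) → (∀ ω → Dec (ω ∈ᵉ A)) → (∀ ω → Dec (ω ∈ᵉ B)) →
              1# - P (A ∩ᵉ B) ≤ P (∁ᵉ A) + P (∁ᵉ B)
  P-∩-bound A B A? B? = ≤-by (0≤-sub (P-mono (A ∩ᵉ ∁ᵉ B) (∁ᵉ B) (λ ω → A? ω ×-dec ¬? (B? ω)) (λ _ → proj₂)))
    (trans (+-congʳ (+-congʳ (trans (P-∁ A A?) (+-congˡ (-‿cong (P-split A B B?))))))
      (solve 3 (λ x y z → con (+ 1) :- (x :+ y) :+ z :- (con (+ 1) :- x) := z :- y) refl _ _ _))

-- Expectation of polynomials in indicators

-- A polynomial over L is a formal linear combination of products of indicators
-- of the events ⟦ l ⟧.
module Polynomials {R : Reals} (𝒫 : ProbabilitySpace R) {L : Set}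
  (⟦_⟧ : L → ProbabilitySpace.Event 𝒫) (⟦_⟧? : ∀ l ω → Dec (proj₁ (⟦_⟧ l) ω)) where
  open Reals R hiding (zero)
  open RealProperties R
  open Sums R
  open ProbabilitySpace 𝒫
  open Events 𝒫

  Monomial Polynomial : Set
  Monomial   = List L
  Polynomial = List (ℝ × Monomial)

  ⟦_⟧ₘ : Monomial → Event
  ⟦ m ⟧ₘ = ⋂ (List.map ⟦_⟧ m)

  ⟦_⟧ₘ? : ∀ m ω → Dec (ω ∈ᵉ ⟦ m ⟧ₘ)
  ⟦ []    ⟧ₘ? ω = yes _
  ⟦ l ∷ m ⟧ₘ? ω = ⟦ l ⟧? ω ×-dec ⟦ m ⟧ₘ? ω

  indicator : Monomial → Ω → ℝ
  indicator []      ω = 1#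
  indicator (l ∷ m) ω = 𝟏 (⟦ l ⟧? ω) * indicator m ω

  indicator-∈ : ∀ m ω → ω ∈ᵉ ⟦ m ⟧ₘ → indicator m ω ≈ 1#
  indicator-∈ []      ω _         = refl
  indicator-∈ (l ∷ m) ω (ω∈l , ω∈m) =
    trans (*-cong (𝟏-true (⟦ l ⟧? ω) ω∈l) (indicator-∈ m ω ω∈m)) (*-identityʳ 1#)

  indicator-∉ : ∀ m ω → ¬ (ω ∈ᵉ ⟦ m ⟧ₘ) → indicator m ω ≈ 0#
  indicator-∉ []      ω ω∉ = contradiction _ ω∉
  indicator-∉ (l ∷ m) ω ω∉ with ⟦ l ⟧? ω
  ... | yes ω∈l = trans (*-identityˡ _) (indicator-∉ m ω (λ ω∈m → ω∉ (ω∈l , ω∈m)))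
  ... | no  _   = zeroˡ _

  indicator-++ : ∀ m m′ ω → indicator (m ++ m′) ω ≈ indicator m ω * indicator m′ ω
  indicator-++ []      m′ ω = sym (*-identityˡ _)
  indicator-++ (l ∷ m) m′ ω = trans (*-congˡ (indicator-++ m m′ ω)) (sym (*-assoc _ _ _))

  scale : ℝ → Polynomial → Polynomial
  scale a = List.map (λ (c , m) → a * c , m)

  infixl 7 _⊗_
  infixl 6 _⊖_

  _⊗_ : Polynomial → Polynomial → Polynomial
  _⊗_ = List.cartesianProductWith (λ (c , m) (c′ , m′) → c * c′ , m ++ m′)

  ∑-⊗ : ∀ p p′ (f : ℝ × Monomial → ℝ) →
        ∑ (p ⊗ p′) f ≈ ∑[ (c , m) ∈ p ] ∑[ (c′ , m′) ∈ p′ ] f (c * c′ , m ++ m′)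
  ∑-⊗ p p′ f = ∑-cartesian _ p p′ f

  _⊖_ : Polynomial → Polynomial → Polynomial
  p ⊖ p′ = p ++ scale (- 1#) p′

  const : ℝ → Polynomial
  const c = (c , []) ∷ []

  private
    ∑-scale : ∀ a p (f : Monomial → ℝ) →
              ∑[ (c , m) ∈ scale a p ] c * f m ≈ a * ∑ p (λ (c , m) → c * f m)
    ∑-scale a p f = trans (∑-map p _ _) (trans (∑-cong p λ (c , m) → *-assoc a c (f m)) (∑-*ˡ p a _))

    ⊖-sub : ∀ {x x′ y y′ z} → z ≈ x + y → y ≈ - 1# * y′ → x ≈ x′ → z ≈ x′ - y′
    ⊖-sub eq₁ eq₂ eq₃ = trans eq₁ (trans (+-cong eq₃ eq₂)
      (solve 2 (λ x y → x :+ con -[1+ 0 ] :* y := x :- y) refl _ _))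

  opaque
    eval : Polynomial → Ω → ℝ
    eval p ω = ∑[ (c , m) ∈ p ] c * indicator m ω

    -- Expectation extended linearly from events to formal expressions. That it depends only on the
    -- function `eval p` is the content of `E-cong`.
    E : Polynomial → ℝ
    E p = ∑[ (c , m) ∈ p ] c * P ⟦ m ⟧ₘ

    -- Not normalised: the expectation of `p` times the indicator of `A`.
    E[_∣_] : Polynomial → Event → ℝ
    E[ p ∣ A ] = ∑[ (c , m) ∈ p ] c * P (A ∩ᵉ ⟦ m ⟧ₘ)

  opaque
    unfolding eval E E[_∣_]

    eval-++ : ∀ p p′ ω → eval (p ++ p′) ω ≈ eval p ω + eval p′ ω
    eval-++ p p′ ω = ∑-++ p p′ _

    eval-concatMap : ∀ {A : Set} (xs : List A) (f : A → Polynomial) ω →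
                     eval (List.concatMap f xs) ω ≈ ∑[ x ∈ xs ] eval (f x) ω
    eval-concatMap xs f ω = ∑-concatMap f xs _

    E-concatMap : ∀ {A : Set} (xs : List A) (f : A → Polynomial) →
                  E (List.concatMap f xs) ≈ ∑[ x ∈ xs ] E (f x)
    E-concatMap xs f = ∑-concatMap f xs _

    E-++ : ∀ p p′ → E (p ++ p′) ≈ E p + E p′
    E-++ p p′ = ∑-++ p p′ _

    eval-scale : ∀ a p ω → eval (scale a p) ω ≈ a * eval p ω
    eval-scale a p ω = ∑-scale a p (λ m → indicator m ω)

    E-scale : ∀ a p → E (scale a p) ≈ a * E p
    E-scale a p = ∑-scale a p (λ m → P ⟦ m ⟧ₘ)

    eval-⊖ : ∀ p p′ ω → eval (p ⊖ p′) ω ≈ eval p ω - eval p′ ω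
    eval-⊖ p p′ ω = ⊖-sub (eval-++ p _ ω) (eval-scale (- 1#) p′ ω) refl

    E-⊖ : ∀ p p′ → E (p ⊖ p′) ≈ E p - E p′
    E-⊖ p p′ = ⊖-sub (E-++ p _) (E-scale (- 1#) p′) refl

    eval-⊗ : ∀ p p′ ω → eval (p ⊗ p′) ω ≈ eval p ω * eval p′ ω
    eval-⊗ p p′ ω = trans (∑-⊗ p p′ _) (trans
      (∑-cong p λ (c , m) → trans
        (∑-cong p′ λ (c′ , m′) → trans (*-congˡ (indicator-++ m m′ ω))
          (solve 4 (λ c c′ i i′ → c :* c′ :* (i :* i′) := c :* i :* (c′ :* i′)) refl c c′ _ _))
        (∑-*ˡ p′ _ _))
      (∑-*ʳ p _ _))

    eval-const : ∀ c ω → eval (const c) ω ≈ c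
    eval-const c ω = trans (+-identityʳ _) (*-identityʳ c)

    E-const : ∀ c → E (const c) ≈ c
    E-const c = trans (+-identityʳ _) (trans (*-congˡ P-U) (*-identityʳ c))

    E-split : ∀ p (A B : Event) → (∀ ω → Dec (ω ∈ᵉ B)) →
              E[ p ∣ A ] ≈ E[ p ∣ A ∩ᵉ B ] + E[ p ∣ A ∩ᵉ ∁ᵉ B ]
    E-split p A B B? = trans
      (∑-cong p λ (c , m) → trans
        (*-congˡ (trans (P-split (A ∩ᵉ ⟦ m ⟧ₘ) B B?) (+-cong (commute m B) (commute m (∁ᵉ B)))))
        (distribˡ c _ _))
      (∑-+ p _ _)
      where
      commute : ∀ m C → P ((A ∩ᵉ ⟦ m ⟧ₘ) ∩ᵉ C) ≈ P ((A ∩ᵉ C) ∩ᵉ ⟦ m ⟧ₘ)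
      commute m C = P-cong′ ((A ∩ᵉ ⟦ m ⟧ₘ) ∩ᵉ C) ((A ∩ᵉ C) ∩ᵉ ⟦ m ⟧ₘ)
        (λ _ ((a , m) , c) → (a , c) , m) (λ _ ((a , c) , m) → (a , m) , c)

    E-U : ∀ p → E[ p ∣ Uᵉ ] ≈ E p
    E-U p = ∑-cong p λ (c , m) →
      *-congˡ (P-cong′ (Uᵉ ∩ᵉ ⟦ m ⟧ₘ) ⟦ m ⟧ₘ (λ _ → proj₂) (λ _ ω∈ → _ , ω∈))

    -- Refining A by the first monomial reduces the claim to a shorter polynomial
    -- with a constant added on the part of A inside that monomial.
    E-nonneg-on : ∀ p (A : Event) a → (∀ ω → ω ∈ᵉ A → 0# ≤ a + eval p ω) → 0# ≤ a * P A + E[ p ∣ A ]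
    -- If `a * P A` were negative, then `a` would be negative; the hypothesis would make `A` empty,
    -- and the product would be 0.
    E-nonneg-on [] A a 0≤a+ = ≤-resp refl (sym (+-identityʳ _)) λ aP<0 →
      <-irrefl (trans (*-congˡ (P-empty A λ ω ω∈A →
        0≤a+ ω ω∈A (<-resp (sym (+-identityʳ a)) refl (*-neg⇒neg (P-nonneg A) aP<0)))) (zeroʳ a)) aP<0
    E-nonneg-on ((c , m) ∷ p) A a 0≤a+ = ≤-resp refl
      (trans (solve 6 (λ a c x y e f → (a :+ c) :* x :+ e :+ (a :* y :+ f) :=
          a :* (x :+ y) :+ (c :* x :+ (e :+ f))) refl a c _ _ _ _)
        (sym (+-cong (*-congˡ (P-split A ⟦ m ⟧ₘ ⟦ m ⟧ₘ?)) (+-congˡ (E-split p A ⟦ m ⟧ₘ ⟦ m ⟧ₘ?)))))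
      (0≤+
        (E-nonneg-on p (A ∩ᵉ ⟦ m ⟧ₘ) (a + c) λ ω (ω∈A , ω∈m) → ≤-resp refl
          (trans (+-congˡ (+-congʳ (trans (*-congˡ (indicator-∈ m ω ω∈m)) (*-identityʳ c))))
            (sym (+-assoc a c _))) (0≤a+ ω ω∈A))
        (E-nonneg-on p (A ∩ᵉ ∁ᵉ ⟦ m ⟧ₘ) a λ ω (ω∈A , ω∉m) → ≤-resp refl
          (+-congˡ (trans (+-congʳ (trans (*-congˡ (indicator-∉ m ω ω∉m)) (zeroʳ c))) (+-identityˡ _)))
          (0≤a+ ω ω∈A)))

    E-nonneg : ∀ p → (∀ ω → 0# ≤ eval p ω) → 0# ≤ E p
    E-nonneg p 0≤p = ≤-resp refl (trans (+-cong (zeroˡ _) (E-U p)) (+-identityˡ _))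
      (E-nonneg-on p Uᵉ 0# (λ ω _ → ≤-resp refl (sym (+-identityˡ _)) (0≤p ω)))

    E-mono : ∀ p p′ → (∀ ω → eval p ω ≤ eval p′ ω) → E p ≤ E p′
    E-mono p p′ p≤p′ = ≤-by
      (E-nonneg (p′ ⊖ p) (λ ω → ≤-resp refl (sym (eval-⊖ p′ p ω)) (0≤-sub (p≤p′ ω)))) (sym (E-⊖ p′ p))

    -- Reduces identities between expectations to pointwise algebra, which makes the syntactic form
    -- of a polynomial irrelevant.
    E-cong : ∀ p p′ → (∀ ω → eval p ω ≈ eval p′ ω) → E p ≈ E p′
    E-cong p p′ eq = ≤-antisym (E-mono p p′ (≤-reflexive ∘ eq)) (E-mono p′ p (≤-reflexive ∘ sym ∘ eq))

    markov : ∀ p (A : Event) a → (∀ ω → Dec (ω ∈ᵉ A)) →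
             (∀ ω → 0# ≤ eval p ω) → (∀ ω → ω ∈ᵉ A → a ≤ eval p ω) → a * P A ≤ E p
    markov p A a A? 0≤p a≤p = ≤-by
      -- The constant added to `p` is `- a` inside `A` and 0 outside.
      (0≤+ (E-nonneg-on p (Uᵉ ∩ᵉ A) (- a) λ ω (_ , ω∈A) →
              ≤-resp refl (+-comm _ _) (0≤-sub (a≤p ω ω∈A)))
           (E-nonneg-on p (Uᵉ ∩ᵉ ∁ᵉ A) 0# λ ω _ → ≤-resp refl (sym (+-identityˡ _)) (0≤p ω)))
      (trans (+-cong (trans (sym (E-U p)) (E-split p Uᵉ A A?))
                     (-‿cong (*-congˡ (P-cong′ A (Uᵉ ∩ᵉ A) (λ _ ω∈ → _ , ω∈) (λ _ → proj₂)))))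
        (solve 5 (λ a x e f y → e :+ f :- a :* x := (:- a) :* x :+ e :+ (con (+ 0) :* y :+ f))
          refl a _ _ _ _))

-- Independence of the sources and factorisation of expectations

module _ {V : Set} where
  private
    code : Source V → ℕ × ℕ × V
    code (X₀ v)  = 0 , 0 , v
    code (ξ t v) = 1 , t , v
    code (Y t v) = 2 , t , v
    code (η t v) = 3 , t , v

    code-injective : ∀ s s′ → code s ≡ code s′ → s ≡ s′
    code-injective (X₀ _)  (X₀ _)  ≡.refl = ≡.refl
    code-injective (ξ _ _) (ξ _ _) ≡.refl = ≡.refl
    code-injective (Y _ _) (Y _ _) ≡.refl = ≡.refl
    code-injective (η _ _) (η _ _) ≡.refl = ≡.refl

  source-≟ : DecidableEquality V → DecidableEquality (Source V)
  source-≟ _≟_ s s′ = map′ (code-injective s s′) (≡.cong code)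
    (Product.≡-dec ℕ._≟_ (Product.≡-dec ℕ._≟_ _≟_) (code s) (code s′))

  value-≟ : DecidableEquality V → (s : Source V) → DecidableEquality (Value s)
  value-≟ _≟_ (X₀ _)  = Bool._≟_
  value-≟ _≟_ (ξ _ _) = Bool._≟_
  value-≟ _≟_ (Y _ _) = Bool._≟_
  value-≟ _≟_ (η _ _) = _≟_

  default : V → (s : Source V) → Value s
  default v (X₀ _)  = false
  default v (ξ _ _) = false
  default v (Y _ _) = false
  default v (η _ _) = v

module Factorisation {R : Reals} {𝒫 : ProbabilitySpace R} {d : ℕ} {ε : Reals.ℝ R}
                     (M : NoisyVoterModel 𝒫 (ℤ^ d) ε) where
  open Reals R hiding (zero; _#_)
  open RealProperties R
  open Sums R
  open ProbabilitySpace 𝒫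
  open Events 𝒫
  open NoisyVoterModel M

  private
    V : Set
    V = Vec ℤ d

    _≟ₛ_ : DecidableEquality (Source V)
    _≟ₛ_ = source-≟ _≟ᵥ_

  open DecMembership _≟ₛ_ using (_∈?_)

  Literal : Set
  Literal = Σ (Source V) Value

  ⟦_⟧ : Literal → Event
  ⟦ s , a ⟧ = fibre (source s) a

  ⟦_⟧? : ∀ l ω → Dec (ω ∈ᵉ ⟦ l ⟧)
  ⟦ s , a ⟧? ω = value-≟ _≟ᵥ_ s (value (source s) ω) a

  open Polynomials 𝒫 ⟦_⟧ ⟦_⟧? public

  private
    Assignment : Set
    Assignment = (s : Source V) → Value s

    update : Assignment → (s : Source V) → Value s → Assignment
    update f s a s′ with s ≟ₛ s′
    ... | yes ≡.refl = a
    ... | no _       = f s′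

    update-≡ : ∀ f s a → update f s a s ≡ a
    update-≡ f s a with s ≟ₛ s
    ... | yes ≡.refl = ≡.refl
    ... | no  s≢s    = contradiction ≡.refl s≢s

    update-≢ : ∀ f s a {s′} → ¬ (s ≡ s′) → update f s a s′ ≡ f s′
    update-≢ f s a {s′} s≢s′ with s ≟ₛ s′
    ... | yes s≡s′ = contradiction s≡s′ s≢s′
    ... | no  _    = ≡.refl

    Agrees : List (Source V) → Assignment → Ω → Set
    Agrees ss f ω = ∀ s → s ∈ ss → value (source s) ω ≡ f s

    cylinder : List (Source V) → Assignment → Event
    cylinder ss f = ⋂ (List.map (λ s → fibre (source s) (f s)) ss)

    agrees⇒∈ : ∀ ss f ω → Agrees ss f ω → ω ∈ᵉ cylinder ss f
    agrees⇒∈ []       f ω ag = _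
    agrees⇒∈ (s ∷ ss) f ω ag = ag s (here ≡.refl) , agrees⇒∈ ss f ω (λ s′ → ag s′ ∘ there)

    ∈⇒agrees : ∀ ss f ω → ω ∈ᵉ cylinder ss f → Agrees ss f ω
    ∈⇒agrees (s ∷ ss) f ω (eq , _) _ (here ≡.refl) = eq
    ∈⇒agrees (s ∷ ss) f ω (_ , ω∈) s′ (there s′∈)  = ∈⇒agrees ss f ω ω∈ s′ s′∈

    -- Independence concerns distinct sources with one value each, whereas a monomial may mention a
    -- source several times. Its event is nevertheless such a cylinder, unless two literals
    -- contradict each other and it is empty.
    record Cylindrical (m : Monomial) : Set where
      field
        sources : List (Source V)
        unique  : Unique sources
        values  : Assignment
        bounded : ∀ s → s ∈ sources → s ∈ List.map proj₁ m
        to      : ∀ ω → ω ∈ᵉ ⟦ m ⟧ₘ → Agrees sources values ω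
        from    : ∀ ω → Agrees sources values ω → ω ∈ᵉ ⟦ m ⟧ₘ
    open Cylindrical

    cylindrical-∷ : ∀ s a {m} → Cylindrical m →
                    Cylindrical ((s , a) ∷ m) ⊎ (∀ ω → ¬ (ω ∈ᵉ ⟦ (s , a) ∷ m ⟧ₘ))
    cylindrical-∷ s a N with s ∈? sources N
    ... | yes s∈ with value-≟ _≟ᵥ_ s a (values N s)
    ...   | yes a≡ = inj₁ record
      { sources = sources N
      ; unique  = unique N
      ; values  = values N
      ; bounded = λ s′ → there ∘ bounded N s′
      ; to      = λ ω (_ , ω∈m) → to N ω ω∈m
      ; from    = λ ω ag → ≡.trans (ag s s∈) (≡.sym a≡) , from N ω ag
      }
    ...   | no a≢ = inj₂ λ ω (eq , ω∈m) → a≢ (≡.trans (≡.sym eq) (to N ω ω∈m s s∈))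
    cylindrical-∷ s a N | no s∉ = inj₁ record
      { sources = s ∷ sources N
      ; unique  = All.tabulate (λ { s∈ ≡.refl → s∉ s∈ }) ∷ unique N
      ; values  = update (values N) s a
      ; bounded = λ { _ (here ≡.refl) → here ≡.refl ; s′ (there s′∈) → there (bounded N s′ s′∈) }
      ; to      = λ { ω (eq , _)   _  (here ≡.refl) → ≡.trans eq (≡.sym (update-≡ (values N) s a))
                    ; ω (_ , ω∈m) s′ (there s′∈)   →
                        ≡.trans (to N ω ω∈m s′ s′∈) (≡.sym (old s′∈)) }
      ; from    = λ ω ag → ≡.trans (ag s (here ≡.refl)) (update-≡ (values N) s a)
                         , from N ω (λ s′ s′∈ → ≡.trans (ag s′ (there s′∈)) (old s′∈))
      }
      where
      old : ∀ {s′} → s′ ∈ sources N → update (values N) s a s′ ≡ values N s′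
      old s′∈ = update-≢ (values N) s a λ { ≡.refl → s∉ s′∈ }

    cylindrical : ∀ m → Cylindrical m ⊎ (∀ ω → ¬ (ω ∈ᵉ ⟦ m ⟧ₘ))
    cylindrical [] = inj₁ record
      { sources = []
      ; unique  = []
      ; values  = default 𝟎
      ; bounded = λ _ ()
      ; to      = λ _ _ _ ()
      ; from    = λ _ _ → _
      }
    cylindrical ((s , a) ∷ m) with cylindrical m
    ... | inj₁ N     = cylindrical-∷ s a N
    ... | inj₂ empty = inj₂ λ ω (_ , ω∈m) → empty ω ω∈m

  -- A syntactic substitute for measurability with respect to the sources satisfying `Q`.
  On : (Source V → Set) → Polynomial → Set
  On Q = All (λ (c , m) → All (λ (s , _) → Q s) m)

  -- Independence is used twice, for the cylinder of `m` with and without `s`; `bounded` ensures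
  -- that `s` is not among its sources.
  P-factor : ∀ s a m → All (λ (s′ , _) → ¬ (s ≡ s′)) m →
             P ⟦ (s , a) ∷ m ⟧ₘ ≈ P ⟦ s , a ⟧ * P ⟦ m ⟧ₘ
  P-factor s a m s∉m = go (cylindrical m)
    where
    go : Cylindrical m ⊎ (∀ ω → ¬ (ω ∈ᵉ ⟦ m ⟧ₘ)) → P ⟦ (s , a) ∷ m ⟧ₘ ≈ P ⟦ s , a ⟧ * P ⟦ m ⟧ₘ
    go (inj₂ empty) = trans (P-empty ⟦ (s , a) ∷ m ⟧ₘ (λ ω (_ , ω∈m) → empty ω ω∈m))
      (sym (trans (*-congˡ (P-empty ⟦ m ⟧ₘ empty)) (zeroʳ _)))
    go (inj₁ N) = trans whole (trans (independent (s ∷ sources N) (s∉N ∷ unique N) f)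
      (*-cong (reflexive (≡.cong (λ b → P ⟦ s , b ⟧) (update-≡ (values N) s a)))
        (sym (trans part (independent (sources N) (unique N) f)))))
      where
      f : Assignment
      f = update (values N) s a

      s∉N : All (λ s′ → ¬ (s ≡ s′)) (sources N)
      s∉N = All.tabulate λ {s′} s′∈ → All.lookup (All.map⁺ {f = proj₁} s∉m) (bounded N s′ s′∈)

      f-old : ∀ s′ → s′ ∈ sources N → f s′ ≡ values N s′
      f-old s′ s′∈ = update-≢ (values N) s a (All.lookup s∉N s′∈)

      part : P ⟦ m ⟧ₘ ≈ P (cylinder (sources N) f)
      part = P-cong′ ⟦ m ⟧ₘ (cylinder (sources N) f)
        (λ ω ω∈m → agrees⇒∈ (sources N) f ω λ s′ s′∈ →
          ≡.trans (to N ω ω∈m s′ s′∈) (≡.sym (f-old s′ s′∈)))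
        (λ ω ω∈ → from N ω λ s′ s′∈ →
          ≡.trans (∈⇒agrees (sources N) f ω ω∈ s′ s′∈) (f-old s′ s′∈))

      whole : P ⟦ (s , a) ∷ m ⟧ₘ ≈ P (cylinder (s ∷ sources N) f)
      whole = P-cong′ ⟦ (s , a) ∷ m ⟧ₘ (cylinder (s ∷ sources N) f)
        (λ ω (eq , ω∈m) → ≡.trans eq (≡.sym (update-≡ (values N) s a)) ,
          agrees⇒∈ (sources N) f ω λ s′ s′∈ → ≡.trans (to N ω ω∈m s′ s′∈) (≡.sym (f-old s′ s′∈)))
        (λ ω (eq , ω∈) → ≡.trans eq (update-≡ (values N) s a) , from N ω λ s′ s′∈ →
          ≡.trans (∈⇒agrees (sources N) f ω ω∈ s′ s′∈) (f-old s′ s′∈))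

  lit : (s : Source V) → Value s → Polynomial
  lit s a = (1# , (s , a) ∷ []) ∷ []

  opaque
    unfolding eval E

    eval-lit : ∀ s a ω → eval (lit s a) ω ≈ 𝟏 (⟦ s , a ⟧? ω)
    eval-lit s a ω = solve 1 (λ i → con (+ 1) :* (i :* con (+ 1)) :+ con (+ 0) := i) refl _

    E-lit-⊗ : ∀ s a p → On (λ s′ → ¬ (s ≡ s′)) p → E (lit s a ⊗ p) ≈ P ⟦ s , a ⟧ * E p
    E-lit-⊗ s a p s∉p = trans (∑-⊗ (lit s a) p (λ (c , m) → c * P ⟦ m ⟧ₘ)) (trans (+-identityʳ _)
      (trans (∑-cong-∈ p λ (c , m) cm∈p →
          trans (*-congˡ (P-factor s a m (All.lookup s∉p cm∈p)))
            (solve 3 (λ c x y → con (+ 1) :* c :* (x :* y) := x :* (c :* y)) refl c _ _))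
        (∑-*ˡ p _ _)))

  module _ {Q : Source V → Set} where
    On-++ : ∀ {p p′} → On Q p → On Q p′ → On Q (p ++ p′)
    On-++ = All.++⁺

    On-scale : ∀ c {p} → On Q p → On Q (scale c p)
    On-scale c []       = []
    On-scale c (q ∷ qs) = q ∷ On-scale c qs

    On-⊗ : ∀ {p p′} → On Q p → On Q p′ → On Q (p ⊗ p′)
    On-⊗ {[]}          []       qs′ = []
    On-⊗ {(c , m) ∷ p} (q ∷ qs) qs′ = All.++⁺ (All.map⁺ (All.map (All.++⁺ q) qs′)) (On-⊗ qs qs′)

    On-lit : ∀ {s a} → Q s → On Q (lit s a)
    On-lit q = (q ∷ []) ∷ []

    On-const : ∀ c → On Q (const c)
    On-const c = [] ∷ []

    On-concatMap : ∀ {A : Set} (xs : List A) {f : A → Polynomial} →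
                   (∀ x → On Q (f x)) → On Q (List.concatMap f xs)
    On-concatMap []       qs = []
    On-concatMap (x ∷ xs) qs = On-++ (qs x) (On-concatMap xs qs)

  On-map : ∀ {Q Q′ : Source V → Set} {p} → (∀ s → Q s → Q′ s) → On Q p → On Q′ p
  On-map f = All.map (All.map (f _))

-- Spins as polynomials and their evolution in one step

module Noise (R : Reals) (ε : Reals.ℝ R) (0<ε : Reals._<_ R (Reals.0# R) ε)
             (ε<1 : Reals._<_ R ε (Reals.1# R)) where
  open Reals R hiding (zero)
  open RealProperties R

  z w : ℝ
  z = 1# - ε
  w = z * z

  0<z : 0# < z
  0<z = 0<-sub ε<1

  z<1 : z < 1#
  z<1 = <-by 0<ε (solve 1 (λ e → con (+ 1) :- (con (+ 1) :- e) := e) refl ε)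

  0<w : 0# < w
  0<w = *-pos 0<z 0<z

  w<1 : w < 1#
  w<1 = <-trans (<-resp refl (*-identityʳ z) (*-monoˡ-< 0<z z<1)) z<1

𝟙-01 : ∀ b → 𝟙 b ≡ 0 ⊎ 𝟙 b ≡ 1
𝟙-01 false = inj₁ ≡.refl
𝟙-01 true  = inj₂ ≡.refl

module _ {A : Set} (_≟_ : DecidableEquality A) (f : A → ℕ) where
  private
    term : A → A → ℕ
    term h v = 𝟙 ⌊ h ≟ v ⌋ ℕ.* f v

  sum-select-∉ : ∀ h vs → All (λ v → ¬ (h ≡ v)) vs → sum (List.map (term h) vs) ≡ 0
  sum-select-∉ h []       []         = ≡.refl
  sum-select-∉ h (v ∷ vs) (h≢v ∷ h∉) with h ≟ v
  ... | yes h≡v = contradiction h≡v h≢v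
  ... | no _    = sum-select-∉ h vs h∉

  -- The value 0 covers an `h` outside `vs`: the law of `η` gives the vertices that are not
  -- neighbours probability 0, but does not exclude them pointwise.
  sum-select : ∀ h vs → Unique vs →
               sum (List.map (term h) vs) ≡ 0 ⊎ sum (List.map (term h) vs) ≡ f h
  sum-select h []       _       = inj₁ ≡.refl
  sum-select h (v ∷ vs) (v∉ ∷ u) with h ≟ v
  ... | no _       = sum-select h vs u
  ... | yes ≡.refl = inj₂ (≡.trans (≡.cong₂ ℕ._+_ (ℕ.+-identityʳ (f h)) (sum-select-∉ h vs v∉))
                                   (ℕ.+-identityʳ (f h)))

module Spins {R : Reals} {𝒫 : ProbabilitySpace R} {d : ℕ} .{{d≢0 : NonZero d}} {ε : Reals.ℝ R}
             (0<ε : Reals._<_ R (Reals.0# R) ε) (ε<1 : Reals._<_ R ε (Reals.1# R))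
             (M : NoisyVoterModel 𝒫 (ℤ^ d) ε) where
  open Reals R hiding (zero; _#_)
  open RealProperties R
  open Sums R
  open Naturals R
  open Lattice R
  open Noise R ε 0<ε ε<1
  open ProbabilitySpace 𝒫
  open Events 𝒫
  open NoisyVoterModel M
  open Graph (ℤ^ d) using (neighbours-unique)
  open Factorisation M public

  private
    V : Set
    V = Vec ℤ d

  X-01 : ∀ t x ω → X t x ω ≡ 0 ⊎ X t x ω ≡ 1
  X-01 zero    x ω = 𝟙-01 (value (source (X₀ x)) ω)
  X-01 (suc t) x ω with value (source (ξ t x)) ω
  ... | true  = ≡.subst (λ n → n ≡ 0 ⊎ n ≡ 1)
    (≡.sym (≡.trans (ℕ.+-identityʳ _) (ℕ.+-identityʳ _))) (𝟙-01 (value (source (Y t x)) ω))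
  ... | false with sum-select _≟ᵥ_ (λ v → X t v ω) (value (source (η t x)) ω) (nbrs x) (neighbours-unique x)
  ...   | inj₁ eq = inj₁ (≡.trans (ℕ.+-identityʳ _) eq)
  ...   | inj₂ eq = ≡.subst (λ n → n ≡ 0 ⊎ n ≡ 1)
    (≡.sym (≡.trans (ℕ.+-identityʳ _) eq)) (X-01 t (value (source (η t x)) ω) ω)

  Xₚ : ℕ → V → Polynomial
  Xₚ zero    x = lit (X₀ x) true
  Xₚ (suc t) x = lit (ξ t x) true ⊗ lit (Y t x) true ++
                 lit (ξ t x) false ⊗ List.concatMap (λ v → lit (η t x) v ⊗ Xₚ t v) (nbrs x)

  private
    𝟏-true? : ∀ b → 𝟏 (b Bool.≟ true) ≈ fromℕ (𝟙 b)
    𝟏-true? false = sym fromℕ-0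
    𝟏-true? true  = sym fromℕ-1

    𝟏-false? : ∀ b → 𝟏 (b Bool.≟ false) ≈ fromℕ (1 ∸ 𝟙 b)
    𝟏-false? false = sym fromℕ-1
    𝟏-false? true  = sym fromℕ-0

    fromℕ-𝟙 : ∀ {A : Set} (a? : Dec A) → fromℕ (𝟙 ⌊ a? ⌋) ≈ 𝟏 a?
    fromℕ-𝟙 (yes _) = fromℕ-1
    fromℕ-𝟙 (no _)  = fromℕ-0

    fromℕ-sum : ∀ {A : Set} (xs : List A) (f : A → ℕ) →
                fromℕ (sum (List.map f xs)) ≈ ∑[ x ∈ xs ] fromℕ (f x)
    fromℕ-sum []       f = fromℕ-0
    fromℕ-sum (x ∷ xs) f = trans (fromℕ-+ (f x) _) (+-congˡ (fromℕ-sum xs f))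

  eval-Xₚ : ∀ t x ω → eval (Xₚ t x) ω ≈ fromℕ (X t x ω)
  eval-Xₚ zero    x ω = trans (eval-lit (X₀ x) true ω) (𝟏-true? (value (source (X₀ x)) ω))
  eval-Xₚ (suc t) x ω = begin
    eval (Xₚ (suc t) x) ω
      ≈⟨ trans (eval-++ (lit (ξ t x) true ⊗ lit (Y t x) true) _ ω)
           (+-cong (eval-⊗ (lit (ξ t x) true) (lit (Y t x) true) ω)
             (eval-⊗ (lit (ξ t x) false) moves ω)) ⟩
    eval (lit (ξ t x) true) ω * eval (lit (Y t x) true) ω + eval (lit (ξ t x) false) ω * eval moves ω
      ≈⟨ +-cong
           (*-cong (trans (eval-lit (ξ t x) true ω) (𝟏-true? (value (source (ξ t x)) ω)))
                   (trans (eval-lit (Y t x) true ω) (𝟏-true? (value (source (Y t x)) ω))))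
           (*-cong (trans (eval-lit (ξ t x) false ω) (𝟏-false? (value (source (ξ t x)) ω)))
                   eval-moves) ⟩
    fromℕ (𝟙 ξₜ) * fromℕ (𝟙 Yₜ) + fromℕ (1 ∸ 𝟙 ξₜ) * fromℕ (sum (List.map (λ v →
      𝟙 ⌊ ηₜ ≟ᵥ v ⌋ ℕ.* X t v ω) (nbrs x)))
      ≈⟨ trans (fromℕ-+ (𝟙 ξₜ ℕ.* 𝟙 Yₜ) _) (+-cong (fromℕ-* (𝟙 ξₜ) _) (fromℕ-* (1 ∸ 𝟙 ξₜ) _)) ⟨
    fromℕ (X (suc t) x ω) ∎
    where
    open ≈-Reasoning
    ξₜ Yₜ : Bool
    ξₜ = value (source (ξ t x)) ω
    Yₜ = value (source (Y t x)) ω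
    ηₜ : V
    ηₜ = value (source (η t x)) ω
    moves : Polynomial
    moves = List.concatMap (λ v → lit (η t x) v ⊗ Xₚ t v) (nbrs x)

    eval-moves : eval moves ω ≈ fromℕ (sum (List.map (λ v → 𝟙 ⌊ ηₜ ≟ᵥ v ⌋ ℕ.* X t v ω) (nbrs x)))
    eval-moves = trans (eval-concatMap (nbrs x) (λ v → lit (η t x) v ⊗ Xₚ t v) ω) (trans
      (∑-cong (nbrs x) λ v → trans (eval-⊗ (lit (η t x) v) (Xₚ t v) ω)
        (trans (*-cong (trans (eval-lit (η t x) v ω) (sym (fromℕ-𝟙 (ηₜ ≟ᵥ v)))) (eval-Xₚ t v ω))
          (sym (fromℕ-* (𝟙 ⌊ ηₜ ≟ᵥ v ⌋) (X t v ω)))))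
      (sym (fromℕ-sum (nbrs x) (λ v → 𝟙 ⌊ ηₜ ≟ᵥ v ⌋ ℕ.* X t v ω))))

  σ : ℕ → V → Polynomial
  σ t x = (Xₚ t x ++ Xₚ t x) ⊖ const 1#

  eval-σ : ∀ t x ω → eval (σ t x) ω ≈ fromℕ (X t x ω) + fromℕ (X t x ω) - 1#
  eval-σ t x ω = trans (eval-⊖ (Xₚ t x ++ Xₚ t x) (const 1#) ω) (+-cong
    (trans (eval-++ (Xₚ t x) (Xₚ t x) ω) (+-cong (eval-Xₚ t x ω) (eval-Xₚ t x ω)))
    (-‿cong (eval-const 1# ω)))

  σ²≈1 : ∀ t x ω → eval (σ t x) ω * eval (σ t x) ω ≈ 1#
  σ²≈1 t x ω = trans (*-cong (eval-σ t x ω) (eval-σ t x ω)) (go (X t x ω) (X-01 t x ω))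
    where
    go : ∀ n → n ≡ 0 ⊎ n ≡ 1 → (fromℕ n + fromℕ n - 1#) * (fromℕ n + fromℕ n - 1#) ≈ 1#
    go _ (inj₁ ≡.refl) = trans (*-cong eq eq)
      (solve 0 ((con (+ 0) :+ con (+ 0) :- con (+ 1)) :* (con (+ 0) :+ con (+ 0) :- con (+ 1)) := con (+ 1)) refl)
      where eq = +-congʳ (+-cong fromℕ-0 fromℕ-0)
    go _ (inj₂ ≡.refl) = trans (*-cong eq eq)
      (solve 0 ((con (+ 1) :+ con (+ 1) :- con (+ 1)) :* (con (+ 1) :+ con (+ 1) :- con (+ 1)) := con (+ 1)) refl)
      where eq = +-congʳ (+-cong fromℕ-1 fromℕ-1)

  E-σ-⊗ : ∀ t x p → E (σ t x ⊗ p) ≈ E (Xₚ t x ⊗ p) + E (Xₚ t x ⊗ p) - E p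
  E-σ-⊗ t x p = trans (E-cong (σ t x ⊗ p) ((Xₚ t x ⊗ p ++ Xₚ t x ⊗ p) ⊖ p) λ ω → trans
      (trans (eval-⊗ (σ t x) p ω) (*-congʳ (trans (eval-σ t x ω)
        (+-congʳ (+-cong (sym (eval-Xₚ t x ω)) (sym (eval-Xₚ t x ω)))))))
      (trans (solve 2 (λ a b → (a :+ a :- con (+ 1)) :* b := a :* b :+ a :* b :- b) refl _ _)
        (sym (trans (eval-⊖ (Xₚ t x ⊗ p ++ Xₚ t x ⊗ p) p ω) (+-congʳ
          (trans (eval-++ (Xₚ t x ⊗ p) _ ω) (+-cong (eval-⊗ (Xₚ t x) p ω) (eval-⊗ (Xₚ t x) p ω))))))))
    (trans (E-⊖ (Xₚ t x ⊗ p ++ Xₚ t x ⊗ p) p) (+-congʳ (E-++ (Xₚ t x ⊗ p) _)))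

  time : Source V → ℕ
  time (X₀ _)  = 0
  time (ξ t _) = suc t
  time (Y t _) = suc t
  time (η t _) = suc t

  Past : ℕ → Polynomial → Set
  Past t = On (λ s → time s ℕ.≤ t)

  -- Excludes the three sources that update `x` from time t to t + 1, so that a polynomial on the
  -- others is independent of this update.
  Fresh : ℕ → V → Source V → Set
  Fresh t x s = ¬ (ξ t x ≡ s) × ¬ (Y t x ≡ s) × ¬ (η t x ≡ s)

  Past-weaken : ∀ {t t′ p} → t ℕ.≤ t′ → Past t p → Past t′ p
  Past-weaken t≤t′ = On-map λ _ s≤t → ℕ.≤-trans s≤t t≤t′

  Past-X : ∀ t x → Past t (Xₚ t x)
  Past-X zero    x = On-lit ℕ.z≤n
  Past-X (suc t) x = On-++ (On-⊗ (On-lit ℕ.≤-refl) (On-lit ℕ.≤-refl))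
    (On-⊗ (On-lit ℕ.≤-refl) (On-concatMap (nbrs x) λ v →
      On-⊗ (On-lit ℕ.≤-refl) (Past-weaken {p = Xₚ t v} (ℕ.n≤1+n t) (Past-X t v))))

  Past-σ : ∀ t x → Past t (σ t x)
  Past-σ t x = On-++ (On-++ (Past-X t x) (Past-X t x)) (On-scale (- 1#) (On-const 1#))

  past⇒fresh : ∀ {t x p} → Past t p → On (Fresh t x) p
  past⇒fresh = On-map λ s s≤t →
    (λ { ≡.refl → ℕ.1+n≰n s≤t }) , (λ { ≡.refl → ℕ.1+n≰n s≤t }) , (λ { ≡.refl → ℕ.1+n≰n s≤t })

  Fresh-σ : ∀ t {x y} → ¬ (x ≡ y) → On (Fresh t x) (σ (suc t) y)
  Fresh-σ t {x} {y} x≢y = On-++ (On-++ fresh-X fresh-X) (On-scale (- 1#) (On-const 1#))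
    where
    fresh-X : On (Fresh t x) (Xₚ (suc t) y)
    fresh-X = On-++
      (On-⊗ (On-lit ((λ { ≡.refl → x≢y ≡.refl }) , (λ ()) , (λ ())))
            (On-lit ((λ ()) , (λ { ≡.refl → x≢y ≡.refl }) , (λ ()))))
      (On-⊗ (On-lit ((λ { ≡.refl → x≢y ≡.refl }) , (λ ()) , (λ ())))
        (On-concatMap (nbrs y) λ v →
          On-⊗ (On-lit ((λ ()) , (λ ()) , (λ { ≡.refl → x≢y ≡.refl }))) (past⇒fresh (Past-X t v))))

  private
    ½+½ : ∀ x → fromℚ ½ * x + fromℚ ½ * x ≈ x
    ½+½ x = trans (sym (distribʳ x (fromℚ ½) (fromℚ ½))) (trans
      (*-congʳ (trans (sym (fromℚ-homo.+-homo ½ ½)) fromℚ-homo.1#-homo)) (*-identityˡ x))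

    P-ξ-false : ∀ t x → P ⟦ ξ t x , false ⟧ ≈ z
    P-ξ-false t x = trans
      (P-cong′ ⟦ ξ t x , false ⟧ (∁ᵉ ⟦ ξ t x , true ⟧)
        (λ ω eq eq′ → contradiction (≡.trans (≡.sym eq) eq′) λ ()) (λ ω → Bool.¬-not))
      (trans (P-∁ ⟦ ξ t x , true ⟧ ⟦ ξ t x , true ⟧?) (+-congˡ (-‿cong (ξ-law t x))))

    P-η : ∀ t x v → v ∈ nbrs x → P ⟦ η t x , v ⟧ ≈ weight d
    P-η t x v v∈ = *-cancelˡ-≈ (0<degree d)
      (trans (trans (*-congʳ (reflexive (≡.cong fromℕ (≡.sym (length-nbrs x))))) (η-law t x v v∈))
        (sym (degree*weight d)))

  E-X-step : ∀ t x p → On (Fresh t x) p → E (Xₚ (suc t) x ⊗ p) ≈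
             ε * (fromℚ ½ * E p) + z * avg (λ v → E (Xₚ t v ⊗ p)) x
  E-X-step t x p fresh = begin
    E (Xₚ (suc t) x ⊗ p)
      ≈⟨ E-cong (Xₚ (suc t) x ⊗ p) (noise ++ copy) same ⟩
    E (noise ++ copy)
      ≈⟨ E-++ noise copy ⟩
    E noise + E copy
      ≈⟨ +-cong
           (trans (E-lit-⊗ (ξ t x) true (lit (Y t x) true ⊗ p) (On-⊗ (On-lit (λ ())) (On-map (λ _ → proj₁) fresh)))
             (*-cong (ξ-law t x) (trans (E-lit-⊗ (Y t x) true p (On-map (λ _ → proj₁ ∘ proj₂) fresh))
               (*-congʳ (Y-law t x)))))
           (trans (E-lit-⊗ (ξ t x) false moves (On-concatMap (nbrs x) λ v →
                     On-⊗ (On-lit (λ ())) (On-⊗ (On-map (λ _ → proj₁) (fresh-X v)) (On-map (λ _ → proj₁) fresh))))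
             (*-cong (P-ξ-false t x) E-moves)) ⟩
    ε * (fromℚ ½ * E p) + z * avg (λ v → E (Xₚ t v ⊗ p)) x ∎
    where
    open ≈-Reasoning
    moves noise copy : Polynomial
    moves = List.concatMap (λ v → lit (η t x) v ⊗ (Xₚ t v ⊗ p)) (nbrs x)
    noise = lit (ξ t x) true ⊗ (lit (Y t x) true ⊗ p)
    copy  = lit (ξ t x) false ⊗ moves

    fresh-X : ∀ v → On (Fresh t x) (Xₚ t v)
    fresh-X v = past⇒fresh (Past-X t v)

    E-moves : E moves ≈ avg (λ v → E (Xₚ t v ⊗ p)) x
    E-moves = trans (E-concatMap (nbrs x) (λ v → lit (η t x) v ⊗ (Xₚ t v ⊗ p))) (trans
      (∑-cong-∈ (nbrs x) λ v v∈ → trans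
        (E-lit-⊗ (η t x) v (Xₚ t v ⊗ p)
          (On-⊗ (On-map (λ _ → proj₂ ∘ proj₂) (fresh-X v)) (On-map (λ _ → proj₂ ∘ proj₂) fresh)))
        (*-congʳ (P-η t x v v∈)))
      (∑-*ˡ (nbrs x) (weight d) _))

    same : ∀ ω → eval (Xₚ (suc t) x ⊗ p) ω ≈ eval (noise ++ copy) ω
    same ω = trans (eval-⊗ (Xₚ (suc t) x) p ω) (trans
      (trans (*-congʳ (trans (eval-++ (lit (ξ t x) true ⊗ lit (Y t x) true) _ ω)
                 (+-cong (eval-⊗ (lit (ξ t x) true) (lit (Y t x) true) ω)
                   (trans (eval-⊗ (lit (ξ t x) false) _ ω) (*-congˡ (eval-concatMap (nbrs x) _ ω))))))
        (solve 5 (λ a b c e p → (a :* b :+ c :* e) :* p := a :* (b :* p) :+ c :* (e :* p))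
          refl _ _ _ _ (eval p ω)))
      (sym (trans (eval-++ noise copy ω) (+-cong
        (trans (eval-⊗ (lit (ξ t x) true) _ ω) (*-congˡ (eval-⊗ (lit (Y t x) true) p ω)))
        (trans (eval-⊗ (lit (ξ t x) false) moves ω) (*-congˡ (trans (eval-concatMap (nbrs x) _ ω)
          (trans (∑-cong (nbrs x) λ v → trans (eval-⊗ (lit (η t x) v) (Xₚ t v ⊗ p) ω)
              (trans (*-congˡ (eval-⊗ (Xₚ t v) p ω)) (trans (sym (*-assoc _ _ _))
                (*-congʳ (sym (eval-⊗ (lit (η t x) v) (Xₚ t v) ω))))))
            (∑-*ʳ (nbrs x) (eval p ω) _)))))))))

  -- A fair coin has mean spin 0, so the noise contributes nothing and only copying, of probability
  -- `z`, remains.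
  E-σ-step : ∀ t x p → On (Fresh t x) p → E (σ (suc t) x ⊗ p) ≈ z * avg (λ v → E (σ t v ⊗ p)) x
  E-σ-step t x p fresh = begin
    E (σ (suc t) x ⊗ p)
      ≈⟨ E-σ-⊗ (suc t) x p ⟩
    E (Xₚ (suc t) x ⊗ p) + E (Xₚ (suc t) x ⊗ p) - E p
      ≈⟨ +-congʳ (+-cong (E-X-step t x p fresh) (E-X-step t x p fresh)) ⟩
    (ε * (fromℚ ½ * E p) + z * a) + (ε * (fromℚ ½ * E p) + z * a) - E p
      ≈⟨ solve 4 (λ e h a p → (e :* h :+ (con (+ 1) :- e) :* a) :+ (e :* h :+ (con (+ 1) :- e) :* a) :- p :=
            e :* (h :+ h) :+ ((con (+ 1) :- e) :* (a :+ a) :- p)) refl ε _ a (E p) ⟩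
    ε * (fromℚ ½ * E p + fromℚ ½ * E p) + (z * (a + a) - E p)
      ≈⟨ +-congʳ (*-congˡ (½+½ (E p))) ⟩
    ε * E p + (z * (a + a) - E p)
      ≈⟨ solve 3 (λ e a p → e :* p :+ ((con (+ 1) :- e) :* (a :+ a) :- p) :=
            (con (+ 1) :- e) :* (a :+ a :+ con -[1+ 0 ] :* p)) refl ε a (E p) ⟩
    z * (a + a + - 1# * E p)
      ≈⟨ *-congˡ (trans (avg-cong (λ v → trans (E-σ-⊗ t v p)
             (solve 2 (λ y p → y :+ y :- p := y :+ y :+ con -[1+ 0 ] :* p) refl _ (E p))) x)
           (trans (avg-+ _ _ x) (+-cong (avg-+ _ _ x) (avg-const _ x)))) ⟨
    z * avg (λ v → E (σ t v ⊗ p)) x ∎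
    where
    open ≈-Reasoning
    a : ℝ
    a = avg (λ v → E (Xₚ t v ⊗ p)) x

  E-σ-initial : ∀ x p → On (λ s → ¬ (X₀ x ≡ s)) p → E (σ 0 x ⊗ p) ≈ 0#
  E-σ-initial x p avoids = trans (E-σ-⊗ 0 x p) (trans
    (+-congʳ (trans (+-cong half half) (½+½ (E p)))) (-‿inverseʳ (E p)))
    where
    half : E (Xₚ 0 x ⊗ p) ≈ fromℚ ½ * E p
    half = trans (E-lit-⊗ (X₀ x) true p avoids) (*-congʳ (X₀-law x))

-- Pair correlations in the presence of the past

module Covariances {R : Reals} {𝒫 : ProbabilitySpace R} {d : ℕ} .{{d≢0 : NonZero d}} {ε : Reals.ℝ R}
                   (0<ε : Reals._<_ R (Reals.0# R) ε) (ε<1 : Reals._<_ R ε (Reals.1# R))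
                   (M : NoisyVoterModel 𝒫 (ℤ^ d) ε) where
  open Reals R hiding (zero; _#_)
  open RealProperties R
  open Sums R
  open Convolution R using (Function; δ; module EvenConvolution)
  open Lattice R
  open ReturnProbabilities R using (avg²)
  open Noise R ε 0<ε ε<1
  open Correlations R w 0<w w<1
  open Exp (CommutativeRing.semiring commutativeRing) using (_^_)
  open Spins 0<ε ε<1 M public

  private
    V : Set
    V = Vec ℤ d

  avg-∈± : ∀ {f : Function d} {b} → (∀ x → f x ∈± b) → ∀ x → avg f x ∈± b
  avg-∈± {f} {b} f∈ x =
    ≤-trans (avg-mono (proj₁ ∘ f∈) x) (≤-reflexive (avg-const b x)) ,
    ≤-trans (≤-reflexive (sym (avg-const (- b) x))) (avg-mono (proj₂ ∘ f∈) x)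

  avg-- : ∀ (f g : Function d) x → avg (λ v → f v - g v) x ≈ avg f x - avg g x
  avg-- = EvenConvolution.T-- avg-even

  avg-translate : ∀ (f : Function d) b y → avg (λ v → f (v ⊟ b)) y ≈ avg f (y ⊟ b)
  avg-translate f b y = *-congˡ (trans (∑-nbrs-⊞ (λ v → f (v ⊟ b)) y) (trans
    (∑-cong (nbrs 𝟎) λ s → reflexive (≡.cong f (⊞-⊟ y s b)))
    (sym (∑-nbrs-⊞ f (y ⊟ b)))))

  avg-reflect : ∀ (f : Function d) y x → avg (λ v → f (y ⊟ v)) x ≈ avg f (y ⊟ x)
  avg-reflect f y x = *-congˡ (trans (∑-nbrs-⊞ (λ v → f (y ⊟ v)) x) (trans
    (∑-cong (nbrs 𝟎) λ s → reflexive (≡.cong f (≡.sym (⊟-⊟ y x s))))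
    (sym (∑-nbrs-⊟ f (y ⊟ x)))))

  -- Each of the two averages moves the displacement by one lattice step; that of `x` enters with a
  -- minus sign, which evenness absorbs.
  avg²-difference : ∀ (f : Function d) x y →
                    avg (λ x′ → avg (λ y′ → f (y′ ⊟ x′)) y) x ≈ avg² f (y ⊟ x)
  avg²-difference f x y = trans (avg-cong (λ x′ → avg-translate f x′ y) x) (avg-reflect (avg f) y x)

  -- The polynomial `F` stands for information from the past. If the pair of spins had forgotten it,
  -- the value would be `E F * C t (y ⊟ x)`.
  φ : Polynomial → ℕ → V → V → ℝ
  φ F t x y = E (σ t x ⊗ (σ t y ⊗ F))

  private
    E-swap : ∀ p p′ F → E (p ⊗ (p′ ⊗ F)) ≈ E (p′ ⊗ (p ⊗ F))
    E-swap p p′ F = E-cong (p ⊗ (p′ ⊗ F)) (p′ ⊗ (p ⊗ F)) λ ω →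
      trans (trans (eval-⊗ p _ ω) (*-congˡ (eval-⊗ p′ F ω)))
        (trans (solve 3 (λ a b c → a :* (b :* c) := b :* (a :* c)) refl _ _ _)
          (sym (trans (eval-⊗ p′ _ ω) (*-congˡ (eval-⊗ p F ω)))))

  φ-diagonal : ∀ F t x → φ F t x x ≈ E F
  φ-diagonal F t x = E-cong (σ t x ⊗ (σ t x ⊗ F)) F λ ω →
    trans (eval-⊗ (σ t x) _ ω) (trans (*-congˡ (eval-⊗ (σ t x) F ω))
      (trans (sym (*-assoc _ _ _)) (trans (*-congʳ (σ²≈1 t x ω)) (*-identityˡ _))))

  φ-step : ∀ F t {x y} → ¬ (x ≡ y) → Past t F →
           φ F (suc t) x y ≈ w * avg (λ x′ → avg (λ y′ → φ F t x′ y′) y) x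
  φ-step F t {x} {y} x≢y past = begin
    φ F (suc t) x y
      -- `x` is traced back while `σ (suc t) y` is still present; since `x ≢ y`, the two updates
      -- share no source.
      ≈⟨ E-σ-step t x _ (On-⊗ (Fresh-σ t x≢y) (past⇒fresh past)) ⟩
    z * avg (λ x′ → E (σ t x′ ⊗ (σ (suc t) y ⊗ F))) x
      ≈⟨ *-congˡ (avg-cong (λ x′ → begin
           E (σ t x′ ⊗ (σ (suc t) y ⊗ F))
             ≈⟨ E-swap (σ t x′) (σ (suc t) y) F ⟩
           E (σ (suc t) y ⊗ (σ t x′ ⊗ F))
             ≈⟨ E-σ-step t y _ (past⇒fresh (On-⊗ (Past-σ t x′) past)) ⟩
           z * avg (λ y′ → E (σ t y′ ⊗ (σ t x′ ⊗ F))) y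
             ≈⟨ *-congˡ (avg-cong (λ y′ → E-swap (σ t y′) (σ t x′) F) y) ⟩
           z * avg (λ y′ → φ F t x′ y′) y ∎) x) ⟩
    z * avg (λ x′ → z * avg (λ y′ → φ F t x′ y′) y) x
      ≈⟨ trans (*-congˡ (avg-*ˡ z _ x)) (sym (*-assoc z z _)) ⟩
    w * avg (λ x′ → avg (λ y′ → φ F t x′ y′) y) x ∎
    where open ≈-Reasoning

  -- Both φ F t and E F · C t satisfy the recursion of φ-step off the diagonal and
  -- equal E F on it, so their difference contracts by w in each step.
  φ-decay : ∀ F t₀ {b} → 0# ≤ b → Past t₀ F →
            (∀ x y → φ F t₀ x y - E F * C t₀ (y ⊟ x) ∈± b) →
            ∀ k x y → φ F (k ℕ.+ t₀) x y - E F * C (k ℕ.+ t₀) (y ⊟ x) ∈± w ^ k * b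
  φ-decay F t₀ {b} 0≤b past base zero    x y = ∈±-weaken (≤-reflexive (sym (*-identityˡ b))) (base x y)
  φ-decay F t₀ {b} 0≤b past base (suc k) x y = go (x ≟ᵥ y)
    where
    t : ℕ
    t = k ℕ.+ t₀
    open ≈-Reasoning
    go : Dec (x ≡ y) → φ F (suc t) x y - E F * C (suc t) (y ⊟ x) ∈± w ^ suc k * b
    go (yes ≡.refl) = 0∈± (0≤* (0≤w^ (suc k)) 0≤b) (trans
      (+-cong (φ-diagonal F (suc t) x) (-‿cong (trans
        (*-congˡ (trans (reflexive (≡.cong (C (suc t)) (⊟-self x))) (C-𝟎 {d} (suc t))))
        (*-identityʳ (E F)))))
      (-‿inverseʳ (E F)))
    go (no x≢y) = ∈±-weaken (≤-reflexive (sym (*-assoc w _ b)))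
      (∈±-resp (sym eq) (∈±-*ˡ 0≤w (avg-∈± (λ x′ →
        avg-∈± (λ y′ → φ-decay F t₀ 0≤b past base k x′ y′) y) x)))
      where
      D : V → V → ℝ
      D x′ y′ = φ F t x′ y′ - E F * C t (y′ ⊟ x′)
      eq : φ F (suc t) x y - E F * C (suc t) (y ⊟ x) ≈ w * avg (λ x′ → avg (λ y′ → D x′ y′) y) x
      eq = begin
        φ F (suc t) x y - E F * C (suc t) (y ⊟ x)
          ≈⟨ +-cong (φ-step F t x≢y (Past-weaken (ℕ.m≤n+m t₀ k) past))
               (-‿cong (*-congˡ (trans (C-≢𝟎 t (λ y⊟x≡𝟎 → x≢y (≡.sym (⊟≡𝟎⇒≡ y x y⊟x≡𝟎))))
                 (*-congˡ (sym (avg²-difference (C t) x y)))))) ⟩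
        w * avg (λ x′ → avg (λ y′ → φ F t x′ y′) y) x -
          E F * (w * avg (λ x′ → avg (λ y′ → C t (y′ ⊟ x′)) y) x)
          ≈⟨ solve 4 (λ w a e c → w :* a :- e :* (w :* c) := w :* (a :- e :* c)) refl w _ (E F) _ ⟩
        w * (avg (λ x′ → avg (λ y′ → φ F t x′ y′) y) x -
          E F * avg (λ x′ → avg (λ y′ → C t (y′ ⊟ x′)) y) x)
          ≈⟨ *-congˡ (trans (avg-cong (λ x′ → trans (avg-- _ _ y) (+-congˡ (-‿cong (avg-*ˡ (E F) _ y)))) x)
               (trans (avg-- _ _ x) (+-congˡ (-‿cong (avg-*ˡ (E F) _ x))))) ⟨
        w * avg (λ x′ → avg (λ y′ → D x′ y′) y) x ∎

  module Observed (u : V) where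
    g : ℕ → Polynomial
    g j = σ (2 ℕ.+ j) u ⊗ σ j u

    Past-g : ∀ j → Past (2 ℕ.+ j) (g j)
    Past-g j = On-⊗ (Past-σ (2 ℕ.+ j) u) (Past-weaken (ℕ.m≤n+m j 2) (Past-σ j u))

    -- Tracing the spin of time j + 2 back to time j turns the expectation into `w` times an average
    -- of `φ F j`, and the same average of `C j` is `γ d j` up to the factor `w`. The error is
    -- averaged along.
    E-g-⊗ : ∀ F j {b} → Past j F → (∀ x y → φ F j x y - E F * C j (y ⊟ x) ∈± b) →
            E (g j ⊗ F) - E F * γ d j ∈± w * b
    E-g-⊗ F j {b} past φ∈ = ∈±-resp (sym eq) (∈±-*ˡ 0≤w (avg-∈± (λ v → avg-∈± (λ v′ → φ∈ v′ u) v) u))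
      where
      open ≈-Reasoning
      eq : E (g j ⊗ F) - E F * γ d j ≈
           w * avg (λ v → avg (λ v′ → φ F j v′ u - E F * C j (u ⊟ v′)) v) u
      eq = begin
        E (g j ⊗ F) - E F * γ d j
          ≈⟨ +-cong (begin
               E (g j ⊗ F)
                 ≈⟨ E-cong (g j ⊗ F) (σ (2 ℕ.+ j) u ⊗ (σ j u ⊗ F)) (λ ω →
                      trans (eval-⊗ (g j) F ω) (trans (*-congʳ (eval-⊗ (σ (2 ℕ.+ j) u) (σ j u) ω))
                        (trans (*-assoc _ _ _) (sym (trans (eval-⊗ (σ (2 ℕ.+ j) u) _ ω)
                          (*-congˡ (eval-⊗ (σ j u) F ω))))))) ⟩
               E (σ (2 ℕ.+ j) u ⊗ (σ j u ⊗ F))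
                 ≈⟨ E-σ-step (suc j) u _ (past⇒fresh (Past-weaken (ℕ.n≤1+n j) past-σF)) ⟩
               z * avg (λ v → E (σ (suc j) v ⊗ (σ j u ⊗ F))) u
                 ≈⟨ *-congˡ (avg-cong (λ v → E-σ-step j v _ (past⇒fresh past-σF)) u) ⟩
               z * avg (λ v → z * avg (λ v′ → φ F j v′ u) v) u
                 ≈⟨ trans (*-congˡ (avg-*ˡ z _ u)) (sym (*-assoc z z _)) ⟩
               w * avg (λ v → avg (λ v′ → φ F j v′ u) v) u ∎)
             (-‿cong (*-congˡ (*-congˡ (sym reflected)))) ⟩
        w * avg (λ v → avg (λ v′ → φ F j v′ u) v) u -
          E F * (w * avg (λ v → avg (λ v′ → C j (u ⊟ v′)) v) u)
          ≈⟨ solve 4 (λ w a e c → w :* a :- e :* (w :* c) := w :* (a :- e :* c)) refl w _ (E F) _ ⟩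
        w * (avg (λ v → avg (λ v′ → φ F j v′ u) v) u -
          E F * avg (λ v → avg (λ v′ → C j (u ⊟ v′)) v) u)
          ≈⟨ *-congˡ (trans (avg-cong (λ v → trans (avg-- _ _ v) (+-congˡ (-‿cong (avg-*ˡ (E F) _ v)))) u)
               (trans (avg-- _ _ u) (+-congˡ (-‿cong (avg-*ˡ (E F) _ u))))) ⟨
        w * avg (λ v → avg (λ v′ → φ F j v′ u - E F * C j (u ⊟ v′)) v) u ∎
        where
        past-σF : Past j (σ j u ⊗ F)
        past-σF = On-⊗ (Past-σ j u) past
        reflected : avg (λ v → avg (λ v′ → C j (u ⊟ v′)) v) u ≈ avg² (C j) (𝟎 {d})
        reflected = trans (avg-cong (λ v → avg-reflect (C j) u v) u) (trans
          (avg-reflect (avg (C j)) u u) (reflexive (≡.cong (avg² (C j)) (⊟-self u))))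

    private
      one : Polynomial
      one = const 1#

      -- At time 0 spins of distinct vertices are independent with mean 0. The error bound 0 is
      -- preserved by `φ-decay`, which makes `E-g` an exact equation.
      φ-one : ∀ x y → φ one 0 x y - E one * C 0 (y ⊟ x) ∈± 0#
      φ-one x y = go (x ≟ᵥ y)
        where
        go : Dec (x ≡ y) → φ one 0 x y - E one * C 0 (y ⊟ x) ∈± 0#
        go (yes ≡.refl) = 0∈± ≤-refl (trans (+-cong (φ-diagonal one 0 x) (-‿cong (trans
          (*-congˡ (trans (reflexive (≡.cong δ (⊟-self x))) (δ-𝟎 {d}))) (*-identityʳ _)))) (-‿inverseʳ _))
        go (no x≢y) = 0∈± ≤-refl (trans (+-cong
          (E-σ-initial x (σ 0 y ⊗ one) (On-⊗ avoids (On-const 1#)))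
          (-‿cong (trans (*-congˡ (δ-≢𝟎 (λ y⊟x≡𝟎 → x≢y (≡.sym (⊟≡𝟎⇒≡ y x y⊟x≡𝟎))))) (zeroʳ _))))
          (-‿inverseʳ 0#))
          where
          avoids : On (λ s → ¬ (X₀ x ≡ s)) (σ 0 y)
          avoids = On-++ (On-++ (On-lit λ { ≡.refl → x≢y ≡.refl }) (On-lit λ { ≡.refl → x≢y ≡.refl }))
            (On-scale (- 1#) (On-const 1#))

    E-g : ∀ j → E (g j) ≈ γ d j
    E-g j = begin
      E (g j)                        ≈⟨ E-cong (g j) (g j ⊗ one) (λ ω → sym (trans (eval-⊗ (g j) one ω)
                                          (trans (*-congˡ (eval-const 1# ω)) (*-identityʳ _)))) ⟩
      E (g j ⊗ one)                  ≈⟨ solve 2 (λ a b → a := a :- b :+ b) refl _ (E one * γ d j) ⟩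
      (E (g j ⊗ one) - E one * γ d j) + E one * γ d j
        ≈⟨ +-cong (∈±0⇒≈0 (∈±-weaken (≤-reflexive (zeroʳ w)) (E-g-⊗ one j (On-const 1#) φ≈)))
             (trans (*-congʳ (E-const 1#)) (*-identityˡ _)) ⟩
      0# + γ d j                     ≈⟨ +-identityˡ _ ⟩
      γ d j                          ∎
      where
      open ≈-Reasoning
      φ≈ : ∀ x y → φ one j x y - E one * C j (y ⊟ x) ∈± 0#
      φ≈ x y = ∈±-weaken (≤-reflexive (zeroʳ (w ^ j)))
        (≡.subst (λ t → φ one t x y - E one * C t (y ⊟ x) ∈± w ^ j * 0#) (ℕ.+-identityʳ j)
          (φ-decay one 0 ≤-refl (On-const 1#) φ-one j x y))

-- Variance of the number of repetitions

repetitions-≡ : ∀ d t (x : ℕ → ℕ) → repetitions d t (x ∘ Fin.toℕ) ≡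
  sum (List.tabulate {n = t ∸ d} λ j → 𝟙 ⌊ x (suc (Fin.toℕ j)) ℕ.≟ x (suc (Fin.toℕ j) ℕ.+ d) ⌋)
repetitions-≡ d t x = ≡.cong sum (List.tabulate-cong λ j →
  ≡.cong₂ (λ m n → 𝟙 ⌊ x m ℕ.≟ x n ⌋)
    (Fin.toℕ-fromℕ< (ℕ.s≤s (ℕ.≤-trans (ℕ.m≤m+n (suc (Fin.toℕ j)) d) (bound j))))
    (Fin.toℕ-fromℕ< (ℕ.s≤s (bound j))))
  where
  bound : ∀ (j : Fin (t ∸ d)) → suc (Fin.toℕ j) ℕ.+ d ℕ.≤ t
  bound j = ℕ.m≤o∸n⇒m+n≤o (suc (Fin.toℕ j)) d≤t (Fin.toℕ<n j)
    where
    d≤t : d ℕ.≤ t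
    d≤t = ℕ.<⇒≤ (ℕ.m∸n≢0⇒n<m λ eq → ℕ.n≮0 (≡.subst (Fin.toℕ j ℕ.<_) eq (Fin.toℕ<n j)))

module Variance {R : Reals} {𝒫 : ProbabilitySpace R} {d : ℕ} .{{d≢0 : NonZero d}} {ε : Reals.ℝ R}
                (0<ε : Reals._<_ R (Reals.0# R) ε) (ε<1 : Reals._<_ R ε (Reals.1# R))
                (M : NoisyVoterModel 𝒫 (ℤ^ d) ε) (u : Vec ℤ d) where
  open Reals R hiding (zero; _#_)
  open RealProperties R
  open Sums R
  open Naturals R
  open Noise R ε 0<ε ε<1
  open Correlations R w 0<w w<1
  open Exp (CommutativeRing.semiring commutativeRing) using (_^_)
  open ProbabilitySpace 𝒫
  open Events 𝒫
  open NoisyVoterModel M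
  open Covariances 0<ε ε<1 M public
  open Observed u public

  private
    2# : ℝ
    2# = 1# + 1#

    Unit : Polynomial → Set
    Unit p = ∀ ω → eval p ω * eval p ω ≈ 1#

    unit-⊗ : ∀ p p′ → Unit p → Unit p′ → Unit (p ⊗ p′)
    unit-⊗ p p′ pp≈1 p′p′≈1 ω = trans (*-cong (eval-⊗ p p′ ω) (eval-⊗ p p′ ω)) (trans
      (solve 2 (λ a b → a :* b :* (a :* b) := a :* a :* (b :* b)) refl _ _)
      (trans (*-cong (pp≈1 ω) (p′p′≈1 ω)) (*-identityʳ 1#)))

    unit-σ : ∀ t x → Unit (σ t x)
    unit-σ = σ²≈1

    unit-g : ∀ j → Unit (g j)
    unit-g j = unit-⊗ (σ (2 ℕ.+ j) u) (σ j u) (unit-σ (2 ℕ.+ j) u) (unit-σ j u)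

    E-unit : ∀ p → Unit p → E p ∈± 1#
    E-unit p pp≈1 =
      ≤-trans (E-mono p (const 1#) (λ ω →
        ≤-resp refl (sym (eval-const 1# ω)) (proj₁ (square≈1⇒∈±1 (pp≈1 ω))))) (≤-reflexive (E-const 1#)) ,
      ≤-trans (≤-reflexive (sym (E-const (- 1#)))) (E-mono (const (- 1#)) p (λ ω →
        ≤-resp (sym (eval-const (- 1#) ω)) refl (proj₂ (square≈1⇒∈±1 (pp≈1 ω)))))

    E-⊗-comm : ∀ p p′ → E (p ⊗ p′) ≈ E (p′ ⊗ p)
    E-⊗-comm p p′ = E-cong (p ⊗ p′) (p′ ⊗ p) λ ω →
      trans (eval-⊗ p p′ ω) (trans (*-comm _ _) (sym (eval-⊗ p′ p ω)))

    E-⊗-++ : ∀ p p′ p″ → E ((p ++ p′) ⊗ p″) ≈ E (p ⊗ p″) + E (p′ ⊗ p″)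
    E-⊗-++ p p′ p″ = trans (E-cong ((p ++ p′) ⊗ p″) (p ⊗ p″ ++ p′ ⊗ p″) λ ω →
      trans (eval-⊗ (p ++ p′) p″ ω) (trans (*-congʳ (eval-++ p p′ ω)) (trans (distribʳ _ _ _)
        (sym (trans (eval-++ (p ⊗ p″) (p′ ⊗ p″) ω) (+-cong (eval-⊗ p p″ ω) (eval-⊗ p′ p″ ω)))))))
      (E-++ (p ⊗ p″) (p′ ⊗ p″))

    *∈±1 : ∀ {x y} → x ∈± 1# → 0# ≤ y → y ≤ 1# → x * y ∈± 1#
    *∈±1 {x} {y} x∈ 0≤y y≤1 = ∈±-weaken (≤-trans (≤-reflexive (*-identityʳ y)) y≤1)
      (∈±-resp (*-comm y x) (∈±-*ˡ 0≤y x∈))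

  g̃ : ℕ → Polynomial
  g̃ j = g j ⊖ const (γ d j)

  covariance : ∀ i j → E (g̃ j ⊗ g̃ i) ≈ E (g j ⊗ g i) - E (g i) * γ d j
  covariance i j = begin
    E (g̃ j ⊗ g̃ i)
      ≈⟨ E-cong (g̃ j ⊗ g̃ i) expanded (λ ω → trans
           (trans (eval-⊗ (g̃ j) (g̃ i) ω) (*-cong (eval-g̃ j ω) (eval-g̃ i ω)))
           (trans (solve 4 (λ a b c e → (a :- c) :* (b :- e) := (a :* b :- c :* b) :- (e :* a :- c :* e))
                refl _ _ (γ d j) (γ d i))
             (sym (trans (eval-⊖ _ _ ω) (+-cong
               (trans (eval-⊖ _ _ ω) (+-cong (eval-⊗ (g j) (g i) ω) (-‿cong (eval-scale (γ d j) (g i) ω))))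
               (-‿cong (trans (eval-⊖ _ _ ω) (+-cong (eval-scale (γ d i) (g j) ω)
                 (-‿cong (eval-const _ ω)))))))))) ⟩
    E expanded
      ≈⟨ trans (E-⊖ _ _) (+-cong
           (trans (E-⊖ _ _) (+-congˡ (-‿cong (E-scale (γ d j) (g i)))))
           (-‿cong (trans (E-⊖ _ _) (+-cong (trans (E-scale (γ d i) (g j)) (*-congˡ (E-g j)))
             (-‿cong (E-const _)))))) ⟩
    (E (g j ⊗ g i) - γ d j * E (g i)) - (γ d i * γ d j - γ d j * γ d i)
      ≈⟨ solve 4 (λ a b c e → (a :- c :* b) :- (e :* c :- c :* e) := a :- b :* c)
           refl _ (E (g i)) (γ d j) (γ d i) ⟩
    E (g j ⊗ g i) - E (g i) * γ d j ∎
    where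
    open ≈-Reasoning
    expanded : Polynomial
    expanded = (g j ⊗ g i ⊖ scale (γ d j) (g i)) ⊖ (scale (γ d i) (g j) ⊖ const (γ d j * γ d i))
    eval-g̃ : ∀ j ω → eval (g̃ j) ω ≈ eval (g j) ω - γ d j
    eval-g̃ j ω = trans (eval-⊖ (g j) (const (γ d j)) ω) (+-congˡ (-‿cong (eval-const _ ω)))

  covariance-≤2 : ∀ i j → E (g̃ j ⊗ g̃ i) ≤ 2#
  covariance-≤2 i j = proj₁ (∈±-resp (sym (covariance i j))
    (∈±-- (E-unit (g j ⊗ g i) (unit-⊗ (g j) (g i) (unit-g j) (unit-g i)))
          (*∈±1 (E-unit (g i) (unit-g i)) (0≤γ d j) (≤-trans (γ≤w d j) (<⇒≤ w<1)))))

  -- `g i` belongs to the past of time i + 2. From then on pairs of spins forget it at rate `w`,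
  -- starting from the crude bound 2 for the difference of two numbers between -1 and 1.
  covariance-decay : ∀ i k → E (g̃ (k ℕ.+ (2 ℕ.+ i)) ⊗ g̃ i) ≤ w ^ k * 2#
  covariance-decay i k = ≤-trans
    (proj₁ (∈±-resp (sym (covariance i j))
      (E-g-⊗ (g i) j (Past-weaken (ℕ.m≤n+m (2 ℕ.+ i) k) (Past-g i))
        (φ-decay (g i) (2 ℕ.+ i) 0≤2 (Past-g i) base k))))
    (≤-trans (*-monoʳ-≤ (0≤* (0≤w^ k) 0≤2) (<⇒≤ w<1)) (≤-reflexive (*-identityˡ _)))
    where
    j : ℕ
    j = k ℕ.+ (2 ℕ.+ i)
    0≤2 : 0# ≤ 2#
    0≤2 = 0≤+ 0≤1 0≤1
    base : ∀ x y → φ (g i) (2 ℕ.+ i) x y - E (g i) * C (2 ℕ.+ i) (y ⊟ x) ∈± 2#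
    base x y = ∈±-- (E-unit (σ (2 ℕ.+ i) x ⊗ (σ (2 ℕ.+ i) y ⊗ g i))
        (unit-⊗ (σ (2 ℕ.+ i) x) (σ (2 ℕ.+ i) y ⊗ g i) (unit-σ (2 ℕ.+ i) x)
          (unit-⊗ (σ (2 ℕ.+ i) y) (g i) (unit-σ (2 ℕ.+ i) y) (unit-g i))))
      (*∈±1 (E-unit (g i) (unit-g i)) (0≤C (2 ℕ.+ i) (y ⊟ x)) (C≤1 (2 ℕ.+ i) (y ⊟ x)))

  -- The sum runs over the times 1 to n, those counted by the statistic at t = n + 2.
  W : ℕ → Polynomial
  W zero    = const 0#
  W (suc n) = W n ++ g̃ (suc n)

  private
    E-W0 : ∀ p → E (W 0 ⊗ p) ≈ 0#
    E-W0 p = trans (E-cong (W 0 ⊗ p) (const 0#) λ ω →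
      trans (eval-⊗ (W 0) p ω) (trans (trans (*-congʳ (eval-const 0# ω)) (zeroˡ _))
        (sym (eval-const 0# ω)))) (E-const 0#)

    -- A geometric series summed by induction: enlarging `W` by one term raises the lag of the
    -- previous ones by one, and `w * tailBound + 2# ≈ tailBound`.
    W-far : ∀ n k → E (W n ⊗ g̃ (k ℕ.+ (2 ℕ.+ n))) ≤ w ^ k * tailBound
    W-far zero    k = ≤-trans (≤-reflexive (E-W0 (g̃ (k ℕ.+ 2)))) (0≤* (0≤w^ k) 0≤tailBound)
    W-far (suc n) k = ≤-trans
      (≤-trans (≤-reflexive (E-⊗-++ (W n) (g̃ (suc n)) (g̃ j)))
        (+-mono-≤ (≤-trans (≤-reflexive (reflexive (≡.cong (λ j → E (W n ⊗ g̃ j)) (ℕ.+-suc k (2 ℕ.+ n)))))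
                    (W-far n (suc k)))
                  (≤-trans (≤-reflexive (E-⊗-comm (g̃ (suc n)) (g̃ j))) (covariance-decay (suc n) k))))
      (≤-reflexive (trans
        (+-congˡ (*-congˡ (sym tailBound*q)))
        (solve 3 (λ w v t → w :* v :* t :+ v :* (t :* (con (+ 1) :- w)) := v :* t) refl w (w ^ k) tailBound)))
      where
      j : ℕ
      j = k ℕ.+ (2 ℕ.+ suc n)

    -- At lag 1 the time windows of the two products interlace and `covariance-decay` does not
    -- apply; that term is paid for by the crude bound 2.
    W-next : ∀ n → E (W n ⊗ g̃ (suc n)) ≤ tailBound + 2#
    W-next zero    = ≤-trans (≤-reflexive (E-W0 (g̃ 1))) (0≤+ 0≤tailBound (0≤+ 0≤1 0≤1))
    W-next (suc n) = ≤-trans (≤-reflexive (E-⊗-++ (W n) (g̃ (suc n)) (g̃ (2 ℕ.+ n))))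
      (+-mono-≤ (≤-trans (W-far n 0) (≤-reflexive (*-identityˡ _))) (covariance-≤2 (2 ℕ.+ n) (suc n)))

  variance : ∀ n → E (W n ⊗ W n) ≤ fromℕ n * varianceRate
  variance zero    = ≤-reflexive (trans (E-W0 (W 0)) (sym (trans (*-congʳ fromℕ-0) (zeroˡ _))))
  variance (suc n) = ≤-trans
    (≤-reflexive (trans (E-⊗-++ (W n) (g̃ (suc n)) (W (suc n)))
      (+-cong (trans (E-⊗-comm (W n) (W (suc n))) (E-⊗-++ (W n) (g̃ (suc n)) (W n)))
              (trans (E-⊗-comm (g̃ (suc n)) (W (suc n))) (E-⊗-++ (W n) (g̃ (suc n)) (g̃ (suc n)))))))
    (≤-trans
      (+-mono-≤ (+-mono-≤ (variance n) (≤-trans (≤-reflexive (E-⊗-comm (g̃ (suc n)) (W n))) (W-next n)))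
                (+-mono-≤ (W-next n) (covariance-≤2 (suc n) (suc n))))
      (≤-reflexive (trans
        (solve 3 (λ n t v → n :* v :+ t :+ (t :+ con (+ 2)) := n :* v :+ (t :+ t :+ con (+ 2)))
          refl (fromℕ n) (tailBound + 2#) varianceRate)
        (trans (solve 2 (λ n v → n :* v :+ v := (con (+ 1) :+ n) :* v) refl (fromℕ n) varianceRate)
          (*-congʳ (sym (fromℕ-suc n)))))))

  chebyshev : ∀ n (A : Event) c → (∀ ω → Dec (ω ∈ᵉ A)) →
              (∀ ω → ω ∈ᵉ A → c * c ≤ eval (W n) ω * eval (W n) ω) →
              c * c * P A ≤ fromℕ n * varianceRate
  chebyshev n A c A? c≤ = ≤-trans
    (markov (W n ⊗ W n) A (c * c) A?
      (λ ω → ≤-resp refl (sym (eval-⊗ (W n) (W n) ω)) (0≤square _))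
      (λ ω ω∈A → ≤-resp refl (sym (eval-⊗ (W n) (W n) ω)) (c≤ ω ω∈A)))
    (variance n)

  agreements : ℕ → Ω → ℝ
  agreements n ω = ∑< n (λ j → fromℕ (𝟙 ⌊ X (suc j) u ω ℕ.≟ X (3 ℕ.+ j) u ω ⌋))

  -- Twice the indicator that two spins agree is 1 plus their product; the products are then split
  -- into centred part and mean.
  agreements-W : ∀ n ω → agreements n ω + agreements n ω ≈
                         fromℕ n + (eval (W n) ω + ∑< n (γ d ∘ suc))
  agreements-W zero    ω = sym (trans (+-cong fromℕ-0 (+-congʳ (eval-const 0# ω))) (+-identityˡ _))
  agreements-W (suc n) ω = begin
    agreements n ω + a + (agreements n ω + a)
      ≈⟨ solve 2 (λ s a → s :+ a :+ (s :+ a) := s :+ s :+ (a :+ a)) refl _ a ⟩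
    agreements n ω + agreements n ω + (a + a)
      ≈⟨ +-cong (agreements-W n ω) (trans
           (agree (X (suc n) u ω) (X (3 ℕ.+ n) u ω) (X-01 (suc n) u ω) (X-01 (3 ℕ.+ n) u ω))
           (+-congˡ (sym (trans (eval-⊗ (σ (3 ℕ.+ n) u) (σ (suc n) u) ω)
             (*-cong (eval-σ (3 ℕ.+ n) u ω) (eval-σ (suc n) u ω)))))) ⟩
    fromℕ n + (eval (W n) ω + ∑< n (γ d ∘ suc)) + (1# + eval (g (suc n)) ω)
      ≈⟨ solve 5 (λ n w s e c → n :+ (w :+ s) :+ (con (+ 1) :+ e) :=
           (con (+ 1) :+ n) :+ (w :+ (e :- c) :+ (s :+ c))) refl _ _ _ _ (γ d (suc n)) ⟩
    (1# + fromℕ n) + (eval (W n) ω + (eval (g (suc n)) ω - γ d (suc n)) + ∑< (suc n) (γ d ∘ suc))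
      ≈⟨ +-cong (fromℕ-suc n) (+-congʳ (trans (eval-++ (W n) (g̃ (suc n)) ω) (+-congˡ
           (trans (eval-⊖ (g (suc n)) (const (γ d (suc n))) ω) (+-congˡ (-‿cong (eval-const _ ω))))))) ⟨
    fromℕ (suc n) + (eval (W (suc n)) ω + ∑< (suc n) (γ d ∘ suc)) ∎
    where
    open ≈-Reasoning
    a : ℝ
    a = fromℕ (𝟙 ⌊ X (suc n) u ω ℕ.≟ X (3 ℕ.+ n) u ω ⌋)
    s₀ : fromℕ 0 + fromℕ 0 - 1# ≈ - 1#
    s₀ = trans (+-congʳ (+-cong fromℕ-0 fromℕ-0)) (solve 0 (con (+ 0) :+ con (+ 0) :- con (+ 1) := :- con (+ 1)) refl)
    s₁ : fromℕ 1 + fromℕ 1 - 1# ≈ 1#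
    s₁ = trans (+-congʳ (+-cong fromℕ-1 fromℕ-1)) (solve 0 (con (+ 1) :+ con (+ 1) :- con (+ 1) := con (+ 1)) refl)
    agree : ∀ m m′ → m ≡ 0 ⊎ m ≡ 1 → m′ ≡ 0 ⊎ m′ ≡ 1 →
            fromℕ (𝟙 ⌊ m ℕ.≟ m′ ⌋) + fromℕ (𝟙 ⌊ m ℕ.≟ m′ ⌋) ≈
            1# + (fromℕ m′ + fromℕ m′ - 1#) * (fromℕ m + fromℕ m - 1#)
    agree _ _ (inj₁ ≡.refl) (inj₁ ≡.refl) = trans (+-cong fromℕ-1 fromℕ-1) (sym (trans
      (+-congˡ (*-cong s₀ s₀)) (solve 0 (con (+ 1) :+ (:- con (+ 1)) :* (:- con (+ 1)) := con (+ 1) :+ con (+ 1)) refl)))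
    agree _ _ (inj₁ ≡.refl) (inj₂ ≡.refl) = trans (+-cong fromℕ-0 fromℕ-0) (sym (trans
      (+-congˡ (*-cong s₁ s₀)) (solve 0 (con (+ 1) :+ con (+ 1) :* (:- con (+ 1)) := con (+ 0) :+ con (+ 0)) refl)))
    agree _ _ (inj₂ ≡.refl) (inj₁ ≡.refl) = trans (+-cong fromℕ-0 fromℕ-0) (sym (trans
      (+-congˡ (*-cong s₀ s₁)) (solve 0 (con (+ 1) :+ (:- con (+ 1)) :* con (+ 1) := con (+ 0) :+ con (+ 0)) refl)))
    agree _ _ (inj₂ ≡.refl) (inj₂ ≡.refl) = trans (+-cong fromℕ-1 fromℕ-1) (sym (trans
      (+-congˡ (*-cong s₁ s₁)) (solve 0 (con (+ 1) :+ con (+ 1) :* con (+ 1) := con (+ 1) :+ con (+ 1)) refl)))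

  repetitions-agreements : ∀ t ω → fromℕ (repetitions 2 t (λ i → X (Fin.toℕ i) u ω)) ≈ agreements (t ∸ 2) ω
  repetitions-agreements t ω = trans
    (reflexive (≡.cong fromℕ sums-agree))
    (fromℕ-sum-tabulate (t ∸ 2) (λ j → 𝟙 ⌊ X (suc j) u ω ℕ.≟ X (3 ℕ.+ j) u ω ⌋))
    where
    sums-agree : repetitions 2 t (λ i → X (Fin.toℕ i) u ω) ≡
      sum (List.tabulate {n = t ∸ 2} λ j → 𝟙 ⌊ X (suc (Fin.toℕ j)) u ω ℕ.≟ X (3 ℕ.+ Fin.toℕ j) u ω ⌋)
    sums-agree = ≡.trans (repetitions-≡ 2 t (λ i → X i u ω)) (≡.cong sum (List.tabulate-cong {n = t ∸ 2} λ j →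
      ≡.cong (λ i → 𝟙 ⌊ X (suc (Fin.toℕ j)) u ω ℕ.≟ X i u ω ⌋) (ℕ.+-comm (suc (Fin.toℕ j)) 2)))

    fromℕ-sum-tabulate : ∀ n (f : ℕ → ℕ) →
      fromℕ (sum (List.tabulate {n = n} (f ∘ Fin.toℕ))) ≈ ∑< n (fromℕ ∘ f)
    fromℕ-sum-tabulate zero    f = fromℕ-0
    fromℕ-sum-tabulate (suc n) f = trans (fromℕ-+ (f 0) _)
      (trans (+-congˡ (fromℕ-sum-tabulate n (f ∘ suc))) (sym (∑<-shift n (fromℕ ∘ f))))

-- Measurability of the statistic

module Measurability {R : Reals} (𝒫 : ProbabilitySpace R) where
  open ProbabilitySpace 𝒫

  -- An explicit list of the possible values reduces every condition on `f` to a finite union over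
  -- them, the only unions under which events are closed.
  record Simple {A : Set} (f : Ω → A) : Set₁ where
    field
      range    : List A
      in-range : ∀ ω → f ω ∈ range
      isEvent  : ∀ a → IsEvent (λ ω → f ω ≡ a)
  open Simple

  isEvent-dec : {A : Set} → Dec A → IsEvent (λ _ → A)
  isEvent-dec (yes a) = isEvent-≐ ((λ _ → a) , _) isEvent-U
  isEvent-dec (no ¬a) = isEvent-≐ ((λ ¬⊤ → contradiction _ ¬⊤) , λ a _ → ¬a a) (isEvent-∁ isEvent-U)

  isEvent-∘ : {A : Set} {f : Ω → A} → Simple f → (Q : A → Pred Ω 0ℓ) →
              (∀ a → IsEvent (Q a)) → IsEvent (λ ω → Q (f ω) ω)
  isEvent-∘ {A} {f} f-simple Q Q-event = isEvent-≐
    ((λ {ω} → from (range f-simple)) , λ {ω} → to (range f-simple) (in-range f-simple ω))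
    (isEvent-cases (range f-simple))
    where
    cases : List A → Pred Ω 0ℓ
    cases []       = ∁ U
    cases (a ∷ as) = ((λ ω → f ω ≡ a) ∩ Q a) ∪ cases as

    isEvent-cases : ∀ as → IsEvent (cases as)
    isEvent-cases []       = isEvent-∁ isEvent-U
    isEvent-cases (a ∷ as) = isEvent-∪ (isEvent-∩ (isEvent f-simple a) (Q-event a)) (isEvent-cases as)

    from : ∀ as {ω} → cases as ω → Q (f ω) ω
    from []       ω∈                   = contradiction _ ω∈
    from (a ∷ as) (inj₁ (≡.refl , q)) = q
    from (a ∷ as) (inj₂ ω∈)           = from as ω∈

    to : ∀ as {ω} → f ω ∈ as → Q (f ω) ω → cases as ω
    to (a ∷ as) (here ≡.refl) q = inj₁ (≡.refl , q)
    to (a ∷ as) (there fω∈)   q = inj₂ (to as fω∈ q)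

  simple-cong : {A : Set} {f g : Ω → A} → (∀ ω → f ω ≡ g ω) → Simple g → Simple f
  simple-cong f≡g g-simple = record
    { range    = range g-simple
    ; in-range = λ ω → ≡.subst (_∈ range g-simple) (≡.sym (f≡g ω)) (in-range g-simple ω)
    ; isEvent  = λ a → isEvent-≐ ((λ {ω} → ≡.trans (f≡g ω)) , λ {ω} → ≡.trans (≡.sym (f≡g ω)))
                                 (isEvent g-simple a)
    }

  simple-const : {A : Set} → DecidableEquality A → (a : A) → Simple (λ _ → a)
  simple-const _≟_ a = record
    { range = a ∷ [] ; in-range = λ _ → here ≡.refl ; isEvent = λ b → isEvent-dec (a ≟ b) }

  simple-map₂ : {A B C : Set} {f : Ω → A} {g : Ω → B} → DecidableEquality C → (h : A → B → C) →
                Simple f → Simple g → Simple (λ ω → h (f ω) (g ω))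
  simple-map₂ {f = f} {g} _≟_ h f-simple g-simple = record
    { range    = List.cartesianProductWith h (range f-simple) (range g-simple)
    ; in-range = λ ω → Membership.∈-cartesianProductWith⁺ h (in-range f-simple ω) (in-range g-simple ω)
    ; isEvent  = λ c → isEvent-∘ f-simple (λ a ω → h a (g ω) ≡ c) λ a →
                       isEvent-∘ g-simple (λ b _ → h a b ≡ c) λ b → isEvent-dec (h a b ≟ c)
    }

  simple-map : {A C : Set} {f : Ω → A} → DecidableEquality C → (h : A → C) → Simple f → Simple (h ∘ f)
  simple-map _≟_ h f-simple = simple-map₂ _≟_ (λ a _ → h a) f-simple f-simple

  simple-Bool : (f : Ω → Bool) → IsEvent (λ ω → f ω ≡ true) → Simple f
  simple-Bool f f-event = record
    { range    = false ∷ true ∷ []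
    ; in-range = λ ω → ∈-range (f ω)
    ; isEvent  = λ { true → f-event ; false → isEvent-≐ (Bool.¬-not , λ eq eq′ → contradiction (≡.trans (≡.sym eq) eq′) λ ())
                                                        (isEvent-∁ f-event) }
    }
    where
    ∈-range : ∀ b → b ∈ false ∷ true ∷ []
    ∈-range false = here ≡.refl
    ∈-range true  = there (here ≡.refl)

  simple-sum-map : {A : Set} (xs : List A) (f : A → Ω → ℕ) → (∀ x → Simple (f x)) →
                   Simple (λ ω → sum (List.map (λ x → f x ω) xs))
  simple-sum-map []       f f-simple = simple-const ℕ._≟_ 0
  simple-sum-map (x ∷ xs) f f-simple =
    simple-map₂ ℕ._≟_ ℕ._+_ (f-simple x) (simple-sum-map xs f f-simple)

  simple-sum-tabulate : ∀ n (f : Fin n → Ω → ℕ) → (∀ i → Simple (f i)) →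
                        Simple (λ ω → sum (List.tabulate (λ i → f i ω)))
  simple-sum-tabulate zero    f f-simple = simple-const ℕ._≟_ 0
  simple-sum-tabulate (suc n) f f-simple =
    simple-map₂ ℕ._≟_ ℕ._+_ (f-simple Fin.zero) (simple-sum-tabulate n (f ∘ Fin.suc) (f-simple ∘ Fin.suc))

  simple-repetitions : ∀ d t {x : ℕ → Ω → ℕ} → (∀ i → Simple (x i)) →
                       Simple (λ ω → repetitions d t (λ i → x (Fin.toℕ i) ω))
  simple-repetitions d t {x} x-simple = simple-cong (λ ω → repetitions-≡ d t (λ i → x i ω))
    (simple-sum-tabulate (t ∸ d) _ λ j → simple-map₂ ℕ._≟_ (λ m n → 𝟙 ⌊ m ℕ.≟ n ⌋)
      (x-simple (suc (Fin.toℕ j))) (x-simple (suc (Fin.toℕ j) ℕ.+ d)))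

  module _ {G : Graph} {ε : Reals.ℝ R} (M : NoisyVoterModel 𝒫 G ε) where
    open NoisyVoterModel M
    open Graph G

    private
      -- `η` may take any vertex as its value, so it is its comparison with a fixed vertex that has
      -- finite range.
      simple-η : ∀ t u v → Simple (λ ω → ⌊ value (source (η t u)) ω ≟ v ⌋)
      simple-η t u v = simple-Bool _ (isEvent-≐
        ((λ {ω} → ≡⇒true _) , λ {ω} → true⇒≡ (value (source (η t u)) ω ≟ v))
        (measurable (source (η t u)) v))
        where
        ≡⇒true : ∀ {A : Set} (a? : Dec A) → A → ⌊ a? ⌋ ≡ true
        ≡⇒true (yes _) _ = ≡.refl
        ≡⇒true (no ¬a) a = contradiction a ¬a
        true⇒≡ : ∀ {A : Set} (a? : Dec A) → ⌊ a? ⌋ ≡ true → A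
        true⇒≡ (yes a) _ = a

    simple-X : ∀ t u → Simple (X t u)
    simple-X zero    u = simple-map ℕ._≟_ 𝟙 (simple-Bool _ (measurable (source (X₀ u)) true))
    simple-X (suc t) u = simple-map₂ ℕ._≟_ ℕ._+_
      (simple-map₂ ℕ._≟_ (λ a b → 𝟙 a ℕ.* 𝟙 b) simple-ξ (simple-Bool _ (measurable (source (Y t u)) true)))
      (simple-map₂ ℕ._≟_ (λ a n → (1 ∸ 𝟙 a) ℕ.* n) simple-ξ (simple-sum-map (neighbours u) _ λ v →
        simple-map₂ ℕ._≟_ (λ a n → 𝟙 a ℕ.* n) (simple-η t u v) (simple-X t v)))
      where
      simple-ξ : Simple (value (source (ξ t u)))
      simple-ξ = simple-Bool _ (measurable (source (ξ t u)) true)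

-- Separation by a threshold

distinguishable-sym : ∀ {R : Reals} {𝒫 : ProbabilitySpace R} {ε} {G₁ G₂ : Graph}
  {M₁ : NoisyVoterModel 𝒫 G₁ ε} {u₁} {M₂ : NoisyVoterModel 𝒫 G₂ ε} {u₂} {S : Statistic R} →
  Distinguishable M₁ u₁ M₂ u₂ S → Distinguishable M₂ u₂ M₁ u₁ S
distinguishable-sym {R} {𝒫} D = record
  { 𝒮₁                = 𝒮₂
  ; 𝒮₂                = 𝒮₁
  ; 𝒮₁-resp-≈         = 𝒮₂-resp-≈
  ; 𝒮₂-resp-≈         = 𝒮₁-resp-≈
  ; disjoint          = λ t (p , q) → disjoint t (q , p)
  ; separated-isEvent = λ t → isEvent-≐ ∩-swap (separated-isEvent t)
  ; P-separated⟶1     = λ δ 0<δ →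
      let N , within = P-separated⟶1 δ 0<δ in
      N , λ t N≤t →
        let P-∩-swap = P-cong (separated-isEvent t) (isEvent-≐ ∩-swap (separated-isEvent t)) ∩-swap in
        <-resp (+-congʳ P-∩-swap) refl (proj₁ (within t N≤t)) ,
        <-resp (+-congˡ (-‿cong P-∩-swap)) refl (proj₂ (within t N≤t))
  }
  where
  open Reals R using (+-congʳ; +-congˡ; -‿cong; refl)
  open RealProperties R using (<-resp)
  open ProbabilitySpace 𝒫 using (isEvent-≐; P-cong)
  open Distinguishable D
  ∩-swap : ∀ {A : Set} {A B : Pred A 0ℓ} → (A ∩ B) ≐ (B ∩ A)
  ∩-swap = (λ (p , q) → q , p) , (λ (p , q) → q , p)

module Separation {R : Reals} {𝒫 : ProbabilitySpace R} {ε : Reals.ℝ R}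
  (0<ε : Reals._<_ R (Reals.0# R) ε) (ε<1 : Reals._<_ R ε (Reals.1# R))
  {d₁ d₂ : ℕ} .{{d₁≢0 : NonZero d₁}} .{{d₂≢0 : NonZero d₂}} (d₁<d₂ : d₁ ℕ.< d₂)
  (u₁ : Vec ℤ d₁) (u₂ : Vec ℤ d₂)
  (M₁ : NoisyVoterModel 𝒫 (ℤ^ d₁) ε) (M₂ : NoisyVoterModel 𝒫 (ℤ^ d₂) ε) where
  open Reals R hiding (zero; _#_)
  open RealProperties R
  open Sums R
  open Naturals R
  open Noise R ε 0<ε ε<1
  open Correlations R w 0<w w<1
  open Gap d₁<d₂
  open ProbabilitySpace 𝒫
  open Events 𝒫
  open Measurability 𝒫

  private
    module V₁ = Variance 0<ε ε<1 M₁ u₁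
    module V₂ = Variance 0<ε ε<1 M₂ u₂
    module M₁ = NoisyVoterModel M₁
    module M₂ = NoisyVoterModel M₂

    Γ₁ Γ₂ : ℕ → ℝ
    Γ₁ n = ∑< n (γ d₁ ∘ suc)
    Γ₂ n = ∑< n (γ d₂ ∘ suc)

    -- Four times the number of repetitions is 2n + 2Γᵢ + 2Wᵢ with n = t - 2, so
    -- this threshold lies between the two means.
    midpoint : ℕ → ℝ
    midpoint n = fromℕ n + fromℕ n + (Γ₁ n + Γ₂ n)

    -- The statistic is rational, so a rational threshold makes the comparison decidable. Its
    -- displacement by less than 1 from the midpoint is absorbed by the gap.
    threshold-∃ : ∀ n → ∃[ p ] (midpoint n < fromℚ p × fromℚ p < midpoint n + 1#)
    threshold-∃ n = archimedean (<-by 0<1 (solve 1 (λ x → x :+ con (+ 1) :- x := con (+ 1)) refl (midpoint n)))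

    threshold : ℕ → ℚ
    threshold n = proj₁ (threshold-∃ n)

    fourfold : ℕ → ℚ
    fourfold n = + (4 ℕ.* n) ℚ./ 1

    Above Below : ℕ → Pred ℝ 0ℓ
    Above t x = fromℚ (threshold (t ∸ 2)) < fromℚ (fourfold (t ∸ 2)) * x
    Below t x = fromℚ (fourfold (t ∸ 2)) * x < fromℚ (threshold (t ∸ 2))

    above? : ∀ t q → Dec (Above t (fromℚ q))
    above? t q = map′ (λ lt → <-resp refl (fromℚ-homo.*-homo _ q) (fromℚ-mono-< lt))
      (λ lt → fromℚ-cancel-< (<-resp refl (sym (fromℚ-homo.*-homo _ q)) lt))
      (threshold (t ∸ 2) ℚ.<? fourfold (t ∸ 2) ℚ.* q)

    below? : ∀ t q → Dec (Below t (fromℚ q))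
    below? t q = map′ (λ lt → <-resp (fromℚ-homo.*-homo _ q) refl (fromℚ-mono-< lt))
      (λ lt → fromℚ-cancel-< (<-resp (sym (fromℚ-homo.*-homo _ q)) refl lt))
      (fourfold (t ∸ 2) ℚ.* q ℚ.<? threshold (t ∸ 2))

    count₁ count₂ : ℕ → Ω → ℕ
    count₁ t ω = repetitions 2 t (λ i → M₁.X (Fin.toℕ i) u₁ ω)
    count₂ t ω = repetitions 2 t (λ i → M₂.X (Fin.toℕ i) u₂ ω)

    A₁ A₂ : ℕ → Event
    A₁ t = (λ ω → Above t (fromℚ (ratio (count₁ t ω) (t ∸ 2)))) ,
      isEvent-∘ (simple-repetitions 2 t (λ i → simple-X M₁ i u₁))
        (λ m _ → Above t (fromℚ (ratio m (t ∸ 2)))) (λ m → isEvent-dec (above? t _))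
    A₂ t = (λ ω → Below t (fromℚ (ratio (count₂ t ω) (t ∸ 2)))) ,
      isEvent-∘ (simple-repetitions 2 t (λ i → simple-X M₂ i u₂))
        (λ m _ → Below t (fromℚ (ratio m (t ∸ 2)))) (λ m → isEvent-dec (below? t _))

    A₁? : ∀ t ω → Dec (ω ∈ᵉ A₁ t)
    A₁? t ω = above? t (ratio (count₁ t ω) (t ∸ 2))

    A₂? : ∀ t ω → Dec (ω ∈ᵉ A₂ t)
    A₂? t ω = below? t (ratio (count₂ t ω) (t ∸ 2))

    fromℕ-2 : fromℕ 2 ≈ 1# + 1#
    fromℕ-2 = trans (fromℕ-+ 1 1) (+-cong fromℕ-1 fromℕ-1)

    fromℕ-4 : fromℕ 4 ≈ 1# + 1# + (1# + 1#)
    fromℕ-4 = trans (fromℕ-+ 2 2) (+-cong fromℕ-2 fromℕ-2)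

    fromℕ-6 : fromℕ 6 ≈ (1# + (1# + 1#)) + (1# + (1# + 1#))
    fromℕ-6 = trans (fromℕ-+ 3 3) (+-cong fromℕ-3 fromℕ-3)
      where
      fromℕ-3 : fromℕ 3 ≈ 1# + (1# + 1#)
      fromℕ-3 = trans (fromℕ-+ 1 2) (+-cong fromℕ-1 fromℕ-2)

    rescale : ∀ m n .{{_ : NonZero n}} x s → fromℕ m ≈ x → x + x ≈ s →
              fromℚ (fourfold n) * fromℚ (ratio m n) ≈ s + s
    rescale m n x s m≈x xx≈s = begin
      fromℚ (fourfold n) * fromℚ (ratio m n)
        ≈⟨ *-congʳ (trans (fromℕ-* 4 n) (*-congʳ fromℕ-4)) ⟩
      (1# + 1# + (1# + 1#)) * fromℕ n * fromℚ (ratio m n)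
        ≈⟨ trans (*-assoc _ _ _) (*-congˡ (trans (fromℕ-*-ratio m n) m≈x)) ⟩
      (1# + 1# + (1# + 1#)) * x
        ≈⟨ solve 1 (λ x → (con (+ 1) :+ con (+ 1) :+ (con (+ 1) :+ con (+ 1))) :* x := x :+ x :+ (x :+ x)) refl x ⟩
      x + x + (x + x)
        ≈⟨ +-cong xx≈s xx≈s ⟩
      s + s ∎
      where
      open ≈-Reasoning

    ι : ∃[ i ] (0# < i × i * fromℕ 4 ≈ 1#)
    ι = inverse (0<fromℕ 4)

    -- With c = n κ′ the gap is at least 4c - 2. Missing the threshold forces a deviation of 2W by
    -- at least 4c - 3, where the third 1 comes from the choice of the threshold. If 4c is at least
    -- 6, the bound in `large`, this is at least 2c, so W deviates by at least c.
    κ′ : ℝ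
    κ′ = proj₁ ι * η′

    0<κ′ : 0# < κ′
    0<κ′ = *-pos (proj₁ (proj₂ ι)) 0<η′

    nη′≈4nκ′ : ∀ n → fromℕ n * η′ ≈ (fromℕ n * κ′ + fromℕ n * κ′) + (fromℕ n * κ′ + fromℕ n * κ′)
    nη′≈4nκ′ n = trans
      (trans (sym (*-identityˡ _)) (*-congʳ (trans (sym (proj₂ (proj₂ ι))) (*-congˡ fromℕ-4))))
      (solve 3 (λ i n e → i :* (con (+ 1) :+ con (+ 1) :+ (con (+ 1) :+ con (+ 1))) :* (n :* e) :=
          (n :* (i :* e) :+ n :* (i :* e)) :+ (n :* (i :* e) :+ n :* (i :* e))) refl (proj₁ ι) (fromℕ n) η′)

    half-≤ : ∀ {x y} → x + x ≤ y + y → x ≤ y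
    half-≤ {x} {y} xx≤yy = *-cancelˡ-≤ (0<+ 0<1 0<1) (≤-resp (double x) (double y) xx≤yy)
      where
      double : ∀ x → x + x ≈ (1# + 1#) * x
      double = solve 1 (λ x → x :+ x := (con (+ 1) :+ con (+ 1)) :* x) refl

    module _ (t : ℕ) .{{n≢0 : NonZero (t ∸ 2)}} (large : fromℕ 6 ≤ fromℕ (t ∸ 2) * η′) where
      private
        n : ℕ
        n = t ∸ 2

        c : ℝ
        c = fromℕ n * κ′

        0≤c : 0# ≤ c
        0≤c = 0≤* (0≤fromℕ n) (<⇒≤ 0<κ′)

        three : 1# + (1# + 1#) ≤ c + c
        three = half-≤ (≤-resp fromℕ-6 (nη′≈4nκ′ n) large)

        gapₙ : (c + c) + (c + c) - (1# + 1#) ≤ Γ₁ n - Γ₂ n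
        gapₙ = ≤-resp (+-congʳ (nη′≈4nκ′ n)) refl (gap n (≤-trans
          (≤-trans (≤-reflexive (sym fromℕ-1)) (fromℕ-mono-≤ {1} {6} (ℕ.s≤s ℕ.z≤n))) large))

        below-mean : ∀ x ω → fromℚ (fourfold n) * x ≈
            (fromℕ n + (V₁.eval (V₁.W n) ω + Γ₁ n)) + (fromℕ n + (V₁.eval (V₁.W n) ω + Γ₁ n)) →
          ¬ (Above t x) → c ≤ - V₁.eval (V₁.W n) ω
        below-mean x ω eq ¬above = half-≤ (≤-by
          (0≤+ (0≤+ (0≤-sub (≤-trans (≤-resp eq refl ¬above) (<⇒≤ (proj₂ (proj₂ (threshold-∃ n))))))
                    (0≤-sub gapₙ)) (0≤-sub three))
          (solve 5 (λ n W g h c → (:- W) :+ (:- W) :- (c :+ c) :=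
              ((n :+ n :+ (g :+ h)) :+ con (+ 1)) :- ((n :+ (W :+ g)) :+ (n :+ (W :+ g)))
              :+ ((g :- h) :- ((c :+ c) :+ (c :+ c) :- (con (+ 1) :+ con (+ 1))))
              :+ ((c :+ c) :- (con (+ 1) :+ (con (+ 1) :+ con (+ 1)))))
            refl (fromℕ n) (V₁.eval (V₁.W n) ω) (Γ₁ n) (Γ₂ n) c))

        above-mean : ∀ x ω → fromℚ (fourfold n) * x ≈
            (fromℕ n + (V₂.eval (V₂.W n) ω + Γ₂ n)) + (fromℕ n + (V₂.eval (V₂.W n) ω + Γ₂ n)) →
          ¬ (Below t x) → c ≤ V₂.eval (V₂.W n) ω
        above-mean x ω eq ¬below = half-≤ (≤-by
          (0≤+ (0≤+ (0≤+ (0≤-sub (≤-trans (<⇒≤ (proj₁ (proj₂ (threshold-∃ n)))) (≤-resp refl eq ¬below)))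
                         (0≤-sub gapₙ)) (0≤-sub three)) 0≤1)
          (solve 5 (λ n W g h c → W :+ W :- (c :+ c) :=
              ((n :+ (W :+ h)) :+ (n :+ (W :+ h))) :- (n :+ n :+ (g :+ h))
              :+ ((g :- h) :- ((c :+ c) :+ (c :+ c) :- (con (+ 1) :+ con (+ 1))))
              :+ ((c :+ c) :- (con (+ 1) :+ (con (+ 1) :+ con (+ 1)))) :+ con (+ 1))
            refl (fromℕ n) (V₂.eval (V₂.W n) ω) (Γ₁ n) (Γ₂ n) c))

        -- The squared deviation grows like n², the variance bound like n; the factor n that is left
        -- drives the failure probability to 0.
        cancel-n : ∀ {p} → c * c * p ≤ fromℕ n * varianceRate → c * κ′ * p ≤ varianceRate
        cancel-n {p} = *-cancelˡ-≤ (0<fromℕ n) ∘ ≤-resp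
          (solve 3 (λ n k p → n :* k :* (n :* k) :* p := n :* (n :* k :* k :* p)) refl (fromℕ n) κ′ p) refl

      P-∁A₁ : fromℕ n * κ′ * κ′ * P (∁ᵉ (A₁ t)) ≤ varianceRate
      P-∁A₁ = cancel-n (V₁.chebyshev n (∁ᵉ (A₁ t)) c (λ ω → ¬? (A₁? t ω)) λ ω ¬above →
        ≤-resp refl (solve 1 (λ x → (:- x) :* (:- x) := x :* x) refl _)
          (square-mono-≤ 0≤c (below-mean _ ω
            (rescale (count₁ t ω) n _ _ (V₁.repetitions-agreements t ω) (V₁.agreements-W n ω)) ¬above)))

      P-∁A₂ : fromℕ n * κ′ * κ′ * P (∁ᵉ (A₂ t)) ≤ varianceRate
      P-∁A₂ = cancel-n (V₂.chebyshev n (∁ᵉ (A₂ t)) c (λ ω → ¬? (A₂? t ω)) λ ω ¬below →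
        square-mono-≤ 0≤c (above-mean _ ω
          (rescale (count₂ t ω) n _ _ (V₂.repetitions-agreements t ω) (V₂.agreements-W n ω)) ¬below))

    limit : (λ t → P (A₁ t ∩ᵉ A₂ t)) ⟶ 1#
    -- `N₁` exceeds 6/η′, which gives `large`; `N₂` exceeds twice `varianceRate` divided by κ′ κ′ δ,
    -- which makes the two failure probabilities add up to less than δ. Of the 3, two compensate for
    -- `t ∸ 2` and one makes it nonzero.
    limit δ 0<δ = 3 ℕ.+ (N₁ ℕ.+ N₂) , λ t N≤t →
      let n : ℕ
          n = t ∸ 2
          n≥ : suc (N₁ ℕ.+ N₂) ℕ.≤ n
          n≥ = ℕ.∸-monoˡ-≤ 2 N≤t
          instance
            n≢0 : NonZero n
            n≢0 = ℕ.>-nonZero (ℕ.≤-trans (ℕ.s≤s ℕ.z≤n) n≥)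
          large : fromℕ 6 ≤ fromℕ n * η′
          large = <⇒≤ (scaled {b = fromℕ 6} (ℕ.≤-trans (ℕ.≤-trans (ℕ.m≤m+n N₁ N₂) (ℕ.n≤1+n _)) n≥)
                    (proj₂ I₁) (proj₂ large₁))
          small : 1# - P (A₁ t ∩ᵉ A₂ t) < δ
          small = ≤-<-trans (P-∩-bound (A₁ t) (A₂ t) (A₁? t) (A₂? t))
            (*-cancelˡ-< (*-pos (*-pos (0<fromℕ n) 0<κ′) 0<κ′) (≤-<-trans
              (≤-resp (sym (distribˡ _ _ _)) refl (+-mono-≤ (P-∁A₁ t large) (P-∁A₂ t large)))
              (<-resp refl (solve 3 (λ n k e → n :* (k :* k :* e) := n :* k :* k :* e) refl (fromℕ n) κ′ δ)
                (scaled {b = varianceRate + varianceRate}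
                  (ℕ.≤-trans (ℕ.≤-trans (ℕ.m≤n+m N₂ N₁) (ℕ.n≤1+n _)) n≥) (proj₂ I₂) (proj₂ large₂)))))
      in
      ≤-<-trans (≤-resp refl (-‿inverseʳ 1#) (+-monoˡ-≤ (- 1#) (P≤1 (A₁ t ∩ᵉ A₂ t) (λ ω → A₁? t ω ×-dec A₂? t ω))))
        0<δ ,
      small
      where
      scaled : ∀ {b x i N n} → N ℕ.≤ n → 0# < i × i * x ≈ 1# → b * i < fromℕ N → b < fromℕ n * x
      scaled {b} {x} {i} {N} {n} N≤n (0<i , ix≈1) bi<N = *-cancelˡ-< 0<i
        (<-resp (*-comm b i) (sym (trans (solve 3 (λ i n x → i :* (n :* x) := n :* (i :* x)) refl i (fromℕ n) x)
            (trans (*-congˡ ix≈1) (*-identityʳ _))))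
          (<-≤-trans bi<N (fromℕ-mono-≤ N≤n)))

      I₁ : ∃[ i ] (0# < i × i * η′ ≈ 1#)
      I₁ = inverse 0<η′
      I₂ : ∃[ i ] (0# < i × i * (κ′ * κ′ * δ) ≈ 1#)
      I₂ = inverse (*-pos (*-pos 0<κ′ 0<κ′) 0<δ)
      large₁ : ∃[ N ] (fromℕ 6 * proj₁ I₁ < fromℕ N)
      large₁ = ∃-above _
      large₂ : ∃[ N ] ((varianceRate + varianceRate) * proj₁ I₂ < fromℕ N)
      large₂ = ∃-above _
      N₁ N₂ : ℕ
      N₁ = proj₁ large₁
      N₂ = proj₁ large₂

  distinguishable : Distinguishable M₁ u₁ M₂ u₂ (repetition R 2)
  distinguishable = record
    { 𝒮₁                = Above
    ; 𝒮₂                = Below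
    ; 𝒮₁-resp-≈         = λ t x≈y → <-resp refl (*-congˡ x≈y)
    ; 𝒮₂-resp-≈         = λ t x≈y → <-resp (*-congˡ x≈y) refl
    ; disjoint          = λ t (above , below) → <-asym above below
    ; separated-isEvent = λ t → proj₂ (A₁ t ∩ᵉ A₂ t)
    ; P-separated⟶1     = limit
    }

theorem1p3 : (R : Reals) (𝒫 : ProbabilitySpace R) → let open Reals R in
    (ε : ℝ) → 0# < ε → ε < 1# →
    (d₁ d₂ : ℕ) → .{{_ : NonZero d₁}} → .{{_ : NonZero d₂}} → d₁ ≢ d₂ →
    (u₁ : Graph.V (ℤ^ d₁)) (u₂ : Graph.V (ℤ^ d₂)) →
    (M₁ : NoisyVoterModel 𝒫 (ℤ^ d₁) ε) (M₂ : NoisyVoterModel 𝒫 (ℤ^ d₂) ε) →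
    Distinguishable M₁ u₁ M₂ u₂ (repetition R 2)
theorem1p3 R 𝒫 ε 0<ε ε<1 d₁ d₂ d₁≢d₂ u₁ u₂ M₁ M₂ with ℕ.<-cmp d₁ d₂
... | tri< d₁<d₂ _ _ = Separation.distinguishable 0<ε ε<1 d₁<d₂ u₁ u₂ M₁ M₂
... | tri≈ _ d₁≡d₂ _ = contradiction d₁≡d₂ d₁≢d₂
... | tri> _ _ d₂<d₁ = distinguishable-sym (Separation.distinguishable 0<ε ε<1 d₂<d₁ u₂ u₁ M₂ M₁)
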